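{- Let $X,Y,Z$ be strongly minimal sets definable in a sufficiently saturated structure $\mathcal{M}$ and let $F\subseteq X\times Y\times Z$ be a definable set of Morley rank $2$. If the Morley degree of $F$ is $1$, then the following three conditions are mutually exclusive (no two of them hold simultaneously). (a) There is some real $\varepsilon>0$ such that for all $A\subseteq X$, $B\subseteq Y$, $C\subseteq Z$ with $|A|,|B|,|C|\le n$ we have $|F\cap (A\times B\times C)|=O(n^{2-\varepsilon})$. (b) $F$ is group-like. (c) $F$ is cylindrical.
   Context: Algebraic closure $\operatorname{acl}$ is always taken in $\mathcal{M}^{\mathrm{eq}}$; $\operatorname{RM}$ denotes Morley rank; "definable" means definable with parameters. The $O$-notation: $f(n)=O(g(n))$ means there are $K>0$ and $n_0\in\mathbb{N}$ with $f(n)\le K g(n)$ for all $n>n_0$. In (a), $\varepsilon$, $K$ and $n_0$ depend on $F$ but not on $A,B,C$. Cartesian: a subset $E\subseteq U\times V$ is cartesian if $I\times J\subseteq E$ for some infinite $I\subseteq U$, $J\subseteq V$. Cylindrical: $E\subseteq S_1\times\dots\times S_k$ is cylindrical if for some $i\in\{1,\dots,k\}$ it is cartesian as a subset of $S_i\times\prod_{j\ne i}S_j$. Generic: $\bar a=(a_1,a_2,a_3)\in F$ is generic in $F$ over a set of parameters $C$ if $\operatorname{RM}(\bar a/C)=\operatorname{RM}(F)=2$. Group-like: $F$ is group-like if there are a group $G$ of Morley rank $1$ and Morley degree $1$ (hence abelian) definable in $\mathcal{M}$ over a small set of parameters $C\subseteq X\times Y\times Z$, elements $g_1,g_2,g_3\in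 G$, and $\alpha_1\in X$, $\alpha_2\in Y$, $\alpha_3\in Z$ such that $\alpha_i$ and $g_i$ are inter-algebraic over $C$ for $i=1,2,3$ (i.e. $\alpha_i\in\operatorname{acl}(g_iC)$ and $g_i\in\operatorname{acl}(\alpha_iC)$), $(\alpha_1,\alpha_2,\alpha_3)\in F$ is generic in $F$ over $C$, and $g_1\cdot g_2\cdot g_3=1$ in $G$.
   Formalization: In "group-like", genericity of (α₁,α₂,α₃) in F over C additionally requires F to be definable over C; without this, K×K×{d} in an algebraically closed field K with d transcendental (C=∅, G=(K,+)) is both group-like and cylindrical. -}

module Defs where

open import Level using (Level; Setω; suc; _⊔_)
open import Axiom.ExcludedMiddle using (ExcludedMiddle)
open import Algebra.Structures using (IsGroup)
open import Data.Empty.Polymorphic using (⊥)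
open import Data.Unit.Polymorphic using (⊤; tt)
open import Data.Nat as ℕ using (ℕ; _^_; _≤_)
open import Data.Integer as ℤ using ()
open import Data.Rational as ℚ using (ℚ; 0ℚ; ↥_; ↧ₙ_)
open import Data.Fin using (Fin)
open import Data.List using (List; []; _∷_; _++_; map; length)
open import Data.List.Relation.Unary.All as All using (All; []; _∷_)
open import Data.List.Relation.Unary.All.Properties using (map⁺; map⁻; ++⁺)
open import Data.List.Relation.Unary.Any using (here; there)
open import Data.List.Membership.Propositional using (_∈_)
open import Data.List.Membership.Setoid as SetoidMembership using ()
open import Data.Product using (Σ; Σ-syntax; ∃; _×_; _,_; proj₁; proj₂)
open import Data.Product.Relation.Binary.Pointwise.NonDependent using (_×ₛ_)
open import Data.Sum using (_⊎_; inj₁; inj₂)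
open import Function.Base using (_∘_)
open import Function.Bundles using (_⇔_; _↣_)
open import Relation.Binary.Bundles using (Setoid)
open import Relation.Binary.Definitions using (Reflexive; Symmetric; Transitive)
open import Relation.Binary.PropositionalEquality using (_≢_; refl)
open import Relation.Binary.Structures using (IsEquivalence)
open import Relation.Nullary using (¬_)

-- The metatheory of the source is classical.  For arbitrary types (not only
-- propositions) this also yields choice, since  Dec P  carries an inhabitant.
Classical : Setω
Classical = ∀ {ℓ : Level} → ExcludedMiddle ℓ

------------------------------------------------------------------------
-- Cardinality

module Size {c ℓ : Level} (S : Setoid c ℓ) where
  open Setoid S using () renaming (Carrier to A)

  AtMost : {p : Level} → ℕ → (A → Set p) → Set (c ⊔ ℓ ⊔ p)
  AtMost n P = Σ[ xs ∈ List A ] (length xs ≤ n × (∀ a → P a → SetoidMembership._∈_ S a xs))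

  Finite : {p : Level} → (A → Set p) → Set (c ⊔ ℓ ⊔ p)
  Finite P = Σ[ n ∈ ℕ ] AtMost n P

  Infinite : {p : Level} → (A → Set p) → Set (c ⊔ ℓ ⊔ p)
  Infinite P = ¬ Finite P

InfiniteCardinal : {ℓ : Level} → Set ℓ → Set ℓ
InfiniteCardinal κ = ℕ ↣ κ

-- |I| < |κ|
_≺_ : {ℓ : Level} → Set ℓ → Set ℓ → Set ℓ
I ≺ κ = (I ↣ κ) × ¬ (κ ↣ I)

------------------------------------------------------------------------
-- Tuples of prescribed sorts, over a sort-indexed family of setoids

module _ {ℓ : Level} {Sort : Set ℓ} (U : Sort → Setoid ℓ ℓ) where

  TupleOf : List Sort → Set ℓ
  TupleOf = All (Setoid.Carrier ∘ U)

  Pointwise : {Γ : List Sort} → TupleOf Γ → TupleOf Γ → Set ℓ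
  Pointwise []                []       = ⊤
  Pointwise {Γ = s ∷ Γ} (x ∷ xs) (y ∷ ys) = Setoid._≈_ (U s) x y × Pointwise xs ys

  private
    pw-refl : {Γ : List Sort} → Reflexive (Pointwise {Γ})
    pw-refl {[]}    {[]}     = tt
    pw-refl {s ∷ Γ} {x ∷ xs} = Setoid.refl (U s) , pw-refl

    pw-sym : {Γ : List Sort} → Symmetric (Pointwise {Γ})
    pw-sym {[]}    {[]}     {[]}     _       = tt
    pw-sym {s ∷ Γ} {x ∷ xs} {y ∷ ys} (p , q) = Setoid.sym (U s) p , pw-sym q

    pw-trans : {Γ : List Sort} → Transitive (Pointwise {Γ})
    pw-trans {[]}    {[]}    {[]}    {[]}    _        _        = tt
    pw-trans {s ∷ Γ} {_ ∷ _} {_ ∷ _} {_ ∷ _} (p , q) (p′ , q′) =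
      Setoid.trans (U s) p p′ , pw-trans q q′

  tupleSetoid : List Sort → Setoid ℓ ℓ
  tupleSetoid Γ = record
    { Carrier       = TupleOf Γ
    ; _≈_           = Pointwise
    ; isEquivalence = record { refl = pw-refl ; sym = pw-sym ; trans = pw-trans }
    }

  pw-lookup : {Γ : List Sort} {a b : TupleOf Γ} → Pointwise a b →
              {s : Sort} (x : s ∈ Γ) → Setoid._≈_ (U s) (All.lookup a x) (All.lookup b x)
  pw-lookup {a = _ ∷ _} {_ ∷ _} (p , _) (here refl) = p
  pw-lookup {a = _ ∷ _} {_ ∷ _} (_ , q) (there x)   = pw-lookup q x

  pw-++ : {Γ Δ : List Sort} {a b : TupleOf Γ} {c d : TupleOf Δ} →
          Pointwise a b → Pointwise c d → Pointwise (++⁺ a c) (++⁺ b d)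
  pw-++ {a = []}    {[]}    _       r = r
  pw-++ {a = _ ∷ _} {_ ∷ _} (p , q) r = p , pw-++ q r

pw-map⁻ : {ℓ : Level} {S T : Set ℓ} (f : S → T) (U : T → Setoid ℓ ℓ)
          {Γ : List S} {a b : TupleOf U (map f Γ)} →
          Pointwise U a b → Pointwise (U ∘ f) (map⁻ a) (map⁻ b)
pw-map⁻ f U {[]}    {[]}    {[]}    _       = tt
pw-map⁻ f U {_ ∷ _} {_ ∷ _} {_ ∷ _} (p , q) = p , pw-map⁻ f U q

------------------------------------------------------------------------
-- Many-sorted first-order logic with equality

record Language (ℓ : Level) : Set (suc ℓ) where
  field
    Sort  : Set ℓ
    Fun   : Set ℓ
    dom   : Fun → List Sort
    cod   : Fun → Sort
    Rel   : Set ℓ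
    arity : Rel → List Sort

module _ {ℓ : Level} (L : Language ℓ) where
  open Language L

  data Term (Γ : List Sort) : Sort → Set ℓ where
    var : {s : Sort} → s ∈ Γ → Term Γ s
    app : (f : Fun) → All (Term Γ) (dom f) → Term Γ (cod f)

  data Formula (Γ : List Sort) : Set ℓ where
    _≐_  : {s : Sort} → Term Γ s → Term Γ s → Formula Γ
    rel  : (R : Rel) → All (Term Γ) (arity R) → Formula Γ
    ¬′_  : Formula Γ → Formula Γ
    _∧′_ : Formula Γ → Formula Γ → Formula Γ
    ∃′   : (s : Sort) → Formula (s ∷ Γ) → Formula Γ

-- Carriers are setoids, the setoid equality being the equality of the
-- structure; this makes quotient sorts available.
record Structure {ℓ : Level} (L : Language ℓ) : Set (suc ℓ) where
  open Language L
  field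
    universe : Sort → Setoid ℓ ℓ
    funᴹ     : (f : Fun) → TupleOf universe (dom f) → Setoid.Carrier (universe (cod f))
    fun-cong : (f : Fun) {a b : TupleOf universe (dom f)} → Pointwise universe a b →
               Setoid._≈_ (universe (cod f)) (funᴹ f a) (funᴹ f b)
    relᴹ     : (R : Rel) → TupleOf universe (arity R) → Set ℓ
    rel-cong : (R : Rel) {a b : TupleOf universe (arity R)} → Pointwise universe a b →
               relᴹ R a → relᴹ R b

  ∣_∣ : Sort → Set ℓ
  ∣ s ∣ = Setoid.Carrier (universe s)

  Tuple : List Sort → Set ℓ
  Tuple = TupleOf universe

  infix 4 _≋_
  _≋_ : {Γ : List Sort} → Tuple Γ → Tuple Γ → Set ℓ
  _≋_ = Pointwise universe

  tuples : List Sort → Setoid ℓ ℓ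
  tuples = tupleSetoid universe

  infixr 5 _⧺_
  _⧺_ : {Γ Δ : List Sort} → Tuple Γ → Tuple Δ → Tuple (Γ ++ Δ)
  _⧺_ = ++⁺

module Semantics {ℓ : Level} {L : Language ℓ} (M : Structure L) where
  open Language L
  open Structure M

  mutual
    eval : {Γ : List Sort} {s : Sort} → Tuple Γ → Term L Γ s → ∣ s ∣
    eval a (var x)    = All.lookup a x
    eval a (app f ts) = funᴹ f (evals a ts)

    evals : {Γ Δ : List Sort} → Tuple Γ → All (Term L Γ) Δ → Tuple Δ
    evals a []       = []
    evals a (t ∷ ts) = eval a t ∷ evals a ts

  infix 4 _⊨_
  _⊨_ : {Γ : List Sort} → Tuple Γ → Formula L Γ → Set ℓ
  a ⊨ (_≐_ {s} t u) = Setoid._≈_ (universe s) (eval a t) (eval a u)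
  a ⊨ rel R ts      = relᴹ R (evals a ts)
  a ⊨ (¬′ φ)        = ¬ (a ⊨ φ)
  a ⊨ (φ ∧′ ψ)      = (a ⊨ φ) × (a ⊨ ψ)
  a ⊨ ∃′ s φ        = Σ[ x ∈ ∣ s ∣ ] (x ∷ a ⊨ φ)

  mutual
    eval-cong : {Γ : List Sort} {s : Sort} {a b : Tuple Γ} → a ≋ b → (t : Term L Γ s) →
                Setoid._≈_ (universe s) (eval a t) (eval b t)
    eval-cong p (var x)    = pw-lookup universe p x
    eval-cong p (app f ts) = fun-cong f (evals-cong p ts)

    evals-cong : {Γ Δ : List Sort} {a b : Tuple Γ} → a ≋ b → (ts : All (Term L Γ) Δ) →
                 evals a ts ≋ evals b ts
    evals-cong p []       = tt
    evals-cong p (t ∷ ts) = eval-cong p t , evals-cong p ts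

  ⊨-cong : {Γ : List Sort} {a b : Tuple Γ} → a ≋ b → (φ : Formula L Γ) → a ⊨ φ → b ⊨ φ
  ⊨-cong p (_≐_ {s} t u) h =
    Setoid.trans (universe s) (Setoid.sym (universe s) (eval-cong p t))
      (Setoid.trans (universe s) h (eval-cong p u))
  ⊨-cong p (rel R ts) h       = rel-cong R (evals-cong p ts) h
  ⊨-cong {Γ} p (¬′ φ) h       = λ k → h (⊨-cong (Setoid.sym (tuples Γ) p) φ k)
  ⊨-cong p (φ ∧′ ψ) (h , k)   = ⊨-cong p φ h , ⊨-cong p ψ k
  ⊨-cong p (∃′ s φ) (x , h)   = x , ⊨-cong (Setoid.refl (universe s) , p) φ h

------------------------------------------------------------------------
-- Definable sets, algebraic closure, Morley rank and degree

module Definability {ℓ : Level} {L : Language ℓ} (M : Structure L) where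
  open Language L
  open Structure M
  open Semantics M

  ParamSet : Set (suc ℓ)
  ParamSet = (s : Sort) → ∣ s ∣ → Set ℓ

  entries : {Γ : List Sort} → Tuple Γ → ParamSet
  entries {Γ} a s e = Σ[ x ∈ s ∈ Γ ] Setoid._≈_ (universe s) (All.lookup a x) e

  _∪_ : ParamSet → ParamSet → ParamSet
  (B ∪ C) s e = B s e ⊎ C s e

  record Definable (Γ : List Sort) : Set ℓ where
    field
      {Δ}     : List Sort
      formula : Formula L (Γ ++ Δ)
      params  : Tuple Δ

  ⟦_⟧ : {Γ : List Sort} → Definable Γ → Tuple Γ → Set ℓ
  ⟦ D ⟧ a = a ⧺ Definable.params D ⊨ Definable.formula D

  Over : ParamSet → {Γ : List Sort} → Definable Γ → Set ℓ
  Over C D = {s : Sort} (x : s ∈ Definable.Δ D) → C s (All.lookup (Definable.params D) x)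

  DefinableOver : ParamSet → {Γ : List Sort} → (Tuple Γ → Set ℓ) → Set ℓ
  DefinableOver C {Γ} P = Σ[ D ∈ Definable Γ ] (Over C D × (∀ a → P a ⇔ ⟦ D ⟧ a))

  acl : ParamSet → ParamSet
  acl C s e = Σ[ D ∈ Definable (s ∷ []) ]
    (Over C D × ⟦ D ⟧ (e ∷ []) × Size.Finite (tuples (s ∷ [])) ⟦ D ⟧)

  _⊆acl_ : {Γ : List Sort} → Tuple Γ → ParamSet → Set ℓ
  _⊆acl_ {Γ} a C = {s : Sort} (x : s ∈ Γ) → acl C s (All.lookup a x)

  _⊑_ : {Γ : List Sort} → Definable Γ → Definable Γ → Set ℓ
  D ⊑ E = ∀ a → ⟦ D ⟧ a → ⟦ E ⟧ a

  Disjoint : {Γ : List Sort} → Definable Γ → Definable Γ → Set ℓ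
  Disjoint D E = ∀ a → ⟦ D ⟧ a → ¬ ⟦ E ⟧ a

  DisjointFamilyIn : {Γ : List Sort} → Definable Γ → (I : Set) → (I → Definable Γ) → Set ℓ
  DisjointFamilyIn D I E = (∀ i → E i ⊑ D) × (∀ i j → i ≢ j → Disjoint (E i) (E j))

  -- RM D ≥ n, evaluated inside M.  This is the Morley rank when M is
  -- ℵ₀-saturated, the only situation in which it is used; ranks below ω suffice.
  RM≥ : ℕ → {Γ : List Sort} → Definable Γ → Set ℓ
  RM≥ ℕ.zero    D     = ∃ ⟦ D ⟧
  RM≥ (ℕ.suc n) {Γ} D =
    Σ[ E ∈ (ℕ → Definable Γ) ] (DisjointFamilyIn D ℕ E × (∀ i → RM≥ n (E i)))

  HasRM : {Γ : List Sort} → Definable Γ → ℕ → Set ℓ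
  HasRM D r = RM≥ r D × ¬ RM≥ (ℕ.suc r) D

  -- RM(a/C) = r: the least rank of a C-definable set containing a.
  HasRM/ : {Γ : List Sort} → Tuple Γ → ParamSet → ℕ → Set ℓ
  HasRM/ {Γ} a C r =
      (∀ (D : Definable Γ) → Over C D → ⟦ D ⟧ a → RM≥ r D)
    × (Σ[ D ∈ Definable Γ ] (Over C D × ⟦ D ⟧ a × ¬ RM≥ (ℕ.suc r) D))

  Splits : {Γ : List Sort} → Definable Γ → ℕ → ℕ → Set ℓ
  Splits {Γ} D r d =
    Σ[ E ∈ (Fin d → Definable Γ) ] (DisjointFamilyIn D (Fin d) E × (∀ i → RM≥ r (E i)))

  -- D has Morley rank r and Morley degree d.
  HasRMDegree : {Γ : List Sort} → Definable Γ → ℕ → ℕ → Set ℓ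
  HasRMDegree D r d = HasRM D r × Splits D r d × ¬ Splits D r (ℕ.suc d)

  Minimal : {Γ : List Sort} → Definable Γ → Set ℓ
  Minimal {Γ} D = Infinite ⟦ D ⟧ ×
    (∀ (E : Definable Γ) → E ⊑ D → Finite ⟦ E ⟧ ⊎ Finite (λ a → ⟦ D ⟧ a × ¬ ⟦ E ⟧ a))
    where open Size (tuples Γ)

------------------------------------------------------------------------
-- Elementary extensions and strong minimality

record ElementaryExtension {ℓ : Level} {L : Language ℓ} (M : Structure L) : Set (suc ℓ) where
  open Language L
  field
    N     : Structure L
    embed : {s : Sort} → Structure.∣_∣ M s → Structure.∣_∣ N s

  embeds : {Γ : List Sort} → Structure.Tuple M Γ → Structure.Tuple N Γ
  embeds = All.map embed

  field
    elementary : {Γ : List Sort} (φ : Formula L Γ) (a : Structure.Tuple M Γ) →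
                 Semantics._⊨_ M a φ ⇔ Semantics._⊨_ N (embeds a) φ

  transfer : {Γ : List Sort} → Definability.Definable M Γ → Definability.Definable N Γ
  transfer D = record { formula = D.formula ; params = embeds D.params }
    where module D = Definability.Definable D

StronglyMinimal : {ℓ : Level} {L : Language ℓ} (M : Structure L) {Γ : List (Language.Sort L)} →
                  Definability.Definable M Γ → Set (suc ℓ)
StronglyMinimal M X = (E : ElementaryExtension M) →
  Definability.Minimal (ElementaryExtension.N E) (ElementaryExtension.transfer E X)

------------------------------------------------------------------------
-- Saturation

module Saturation {ℓ : Level} {L : Language ℓ} (M : Structure L) where
  open Language L
  open Structure M
  open Definability M

  range : {I : Set ℓ} → (I → Σ Sort ∣_∣) → ParamSet
  range {I} c s e = Σ[ i ∈ I ] entries (proj₂ (c i) ∷ []) s e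

  -- Parameter sets of size < κ are given as ranges of families indexed by
  -- types of size < κ.
  Saturated : Set ℓ → Set (suc ℓ)
  Saturated κ =
    (I : Set ℓ) → I ≺ κ → (c : I → Σ Sort ∣_∣) →
    (Γ : List Sort) (p : Definable Γ → Set ℓ) → (∀ D → p D → Over (range c) D) →
    (∀ (Ds : List (Definable Γ)) → All p Ds → Σ[ a ∈ Tuple Γ ] All (λ D → ⟦ D ⟧ a) Ds) →
    Σ[ a ∈ Tuple Γ ] (∀ D → p D → ⟦ D ⟧ a)

------------------------------------------------------------------------
-- M^eq: one new sort for each ∅-definable equivalence relation on tuples of
-- M, whose elements are the classes, together with the projection onto it.

module Imaginaries {ℓ : Level} {L : Language ℓ} (M : Structure L) where
  open Language L
  open Structure M
  open Semantics M

  record EqRel : Set ℓ where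
    field
      Γ       : List Sort
      formula : Formula L (Γ ++ Γ)

    _∼_ : Tuple Γ → Tuple Γ → Set ℓ
    a ∼ b = a ⧺ b ⊨ formula

    field
      isEquivalence : IsEquivalence _∼_

  Lᵉᵠ : Language ℓ
  Lᵉᵠ = record
    { Sort  = Sort ⊎ EqRel
    ; Fun   = Fun ⊎ EqRel
    ; dom   = λ { (inj₁ f) → map inj₁ (dom f) ; (inj₂ E) → map inj₁ (EqRel.Γ E) }
    ; cod   = λ { (inj₁ f) → inj₁ (cod f) ; (inj₂ E) → inj₂ E }
    ; Rel   = Rel
    ; arity = λ R → map inj₁ (arity R)
    }

  universeᵉᵠ : Sort ⊎ EqRel → Setoid ℓ ℓ
  universeᵉᵠ (inj₁ s) = universe s
  universeᵉᵠ (inj₂ E) = record { isEquivalence = EqRel.isEquivalence E }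

  Mᵉᵠ : Structure Lᵉᵠ
  Mᵉᵠ = record
    { universe = universeᵉᵠ
    ; funᴹ     = λ { (inj₁ f) a → funᴹ f (map⁻ a) ; (inj₂ E) a → map⁻ a }
    ; fun-cong = λ { (inj₁ f) p → fun-cong f (pw-map⁻ inj₁ universeᵉᵠ p)
                   ; (inj₂ E) {a} {b} p → proj-cong E {map⁻ a} {map⁻ b} (pw-map⁻ inj₁ universeᵉᵠ p) }
    ; relᴹ     = λ R a → relᴹ R (map⁻ a)
    ; rel-cong = λ R p h → rel-cong R (pw-map⁻ inj₁ universeᵉᵠ p) h
    }
    where
    proj-cong : (E : EqRel) {a b : Tuple (EqRel.Γ E)} → a ≋ b → EqRel._∼_ E a b
    proj-cong E {a} p =
      ⊨-cong (pw-++ universe (Setoid.refl (tuples (EqRel.Γ E)) {a}) p) (EqRel.formula E)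
        (IsEquivalence.refl (EqRel.isEquivalence E) {a})

  private
    module D  = Definability M
    module Dᵉ = Definability Mᵉᵠ

  homeTuple : {Γ : List Sort} → Tuple Γ → Structure.Tuple Mᵉᵠ (map inj₁ Γ)
  homeTuple = map⁺

  homeSet : D.ParamSet → Dᵉ.ParamSet
  homeSet C (inj₁ s) e = C s e
  homeSet C (inj₂ _) _ = ⊥

  infix 4 _∈aclᵉᵠ_
  _∈aclᵉᵠ_ : {Γ : List Sort} → Tuple Γ → D.ParamSet → Set ℓ
  a ∈aclᵉᵠ C = Dᵉ._⊆acl_ (homeTuple a) (homeSet C)

  InterAlgebraic : {Γ Δ : List Sort} → D.ParamSet → Tuple Γ → Tuple Δ → Set ℓ
  InterAlgebraic C a g = (a ∈aclᵉᵠ (D.entries g D.∪ C)) × (g ∈aclᵉᵠ (D.entries a D.∪ C))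

------------------------------------------------------------------------
-- Definable groups

record DefinableGroup {ℓ : Level} {L : Language ℓ} (M : Structure L)
                      (C : Definability.ParamSet M) : Set ℓ where
  open Language L
  open Structure M
  open Definability M
  field
    Γ         : List Sort
    domain    : Definable Γ
    dom-over  : Over C domain

  Element : Set ℓ
  Element = ∃ ⟦ domain ⟧

  _≈_ : Element → Element → Set ℓ
  g ≈ h = proj₁ g ≋ proj₁ h

  field
    _∙_        : Element → Element → Element
    ε          : Element
    _⁻¹        : Element → Element
    isGroup    : IsGroup _≈_ _∙_ ε _⁻¹
    graph      : Definable (Γ ++ Γ ++ Γ)
    graph-over : Over C graph
    graph-spec : ∀ g h k → ((g ∙ h) ≈ k) ⇔ ⟦ graph ⟧ (proj₁ g ⧺ proj₁ h ⧺ proj₁ k)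

------------------------------------------------------------------------
-- The three conditions

-- E ⊆ U × V
Cartesian : {ℓ : Level} (S T : Setoid ℓ ℓ)
            (U : Setoid.Carrier S → Set ℓ) (V : Setoid.Carrier T → Set ℓ)
            (E : Setoid.Carrier S → Setoid.Carrier T → Set ℓ) → Set (suc ℓ)
Cartesian {ℓ} S T U V E =
  Σ[ I ∈ (Setoid.Carrier S → Set ℓ) ] Σ[ J ∈ (Setoid.Carrier T → Set ℓ) ]
    ( (∀ x → I x → U x) × (∀ y → J y → V y)
    × Size.Infinite S I × Size.Infinite T J
    × (∀ x y → I x → J y → E x y))

module Conditions {ℓ : Level} {L : Language ℓ} (M : Structure L)
                  {Γ₁ Γ₂ Γ₃ : List (Language.Sort L)} where
  open Language L
  open Structure M
  open Definability M
  open Imaginaries M using (InterAlgebraic)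

  module _ (X : Definable Γ₁) (Y : Definable Γ₂) (Z : Definable Γ₃)
           (F : Definable (Γ₁ ++ Γ₂ ++ Γ₃)) where

    SubsetOfProduct : Set ℓ
    SubsetOfProduct = ∀ x y z → ⟦ F ⟧ (x ⧺ y ⧺ z) → ⟦ X ⟧ x × ⟦ Y ⟧ y × ⟦ Z ⟧ z

    -- For ε = p/q and n ≥ 1, the bound m ≤ K n^(2-ε) reads m^q n^p ≤ K^q n^(2q).
    PowerBound : ℚ → ℕ → ℕ → ℕ → Set
    PowerBound ε K n m =
      m ^ (↧ₙ ε) ℕ.* n ^ ℤ.∣ ↥ ε ∣ ≤ K ^ (↧ₙ ε) ℕ.* n ^ (2 ℕ.* ↧ₙ ε)

    PowerSaving : Set (suc ℓ)
    PowerSaving =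
      Σ[ ε ∈ ℚ ] (0ℚ ℚ.< ε × (Σ[ K ∈ ℕ ] (0 ℕ.< K × (Σ[ n₀ ∈ ℕ ] (∀ (n : ℕ) → n₀ ℕ.< n →
        (A : Tuple Γ₁ → Set ℓ) (B : Tuple Γ₂ → Set ℓ) (C : Tuple Γ₃ → Set ℓ) →
        (∀ x → A x → ⟦ X ⟧ x) → (∀ y → B y → ⟦ Y ⟧ y) → (∀ z → C z → ⟦ Z ⟧ z) →
        Size.AtMost (tuples Γ₁) n A → Size.AtMost (tuples Γ₂) n B →
        Size.AtMost (tuples Γ₃) n C →
        Σ[ m ∈ ℕ ] (PowerBound ε K n m ×
          Size.AtMost (tuples Γ₁ ×ₛ (tuples Γ₂ ×ₛ tuples Γ₃)) m
            (λ (x , y , z) → A x × B y × C z × ⟦ F ⟧ (x ⧺ y ⧺ z))))))))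

    -- Genericity over C is only meaningful for F definable over C.  Without
    -- that, K × K × {d} in an algebraically closed field K, with d
    -- transcendental, would have the generic point (a , -a-d , d) over ∅.
    GenericOver : ParamSet → Tuple (Γ₁ ++ Γ₂ ++ Γ₃) → Set ℓ
    GenericOver C a = DefinableOver C ⟦ F ⟧ × ⟦ F ⟧ a × HasRM/ a C 2 × HasRM F 2

    record GroupLike (κ : Set ℓ) : Set (suc ℓ) where
      field
        Index    : Set ℓ
        small    : Index ≺ κ
        triple   : Index → Tuple Γ₁ × Tuple Γ₂ × Tuple Γ₃
        triple∈  : ∀ i → let (x , y , z) = triple i in ⟦ X ⟧ x × ⟦ Y ⟧ y × ⟦ Z ⟧ z

      C : ParamSet
      C s e = Σ[ i ∈ Index ] (let (x , y , z) = triple i in entries (x ⧺ y ⧺ z) s e)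

      field
        G : DefinableGroup M C

      module G = DefinableGroup G

      field
        rank-degree  : HasRMDegree G.domain 1 1
        g₁ g₂ g₃     : G.Element
        α₁           : Tuple Γ₁
        α₂           : Tuple Γ₂
        α₃           : Tuple Γ₃
        α₁∈X         : ⟦ X ⟧ α₁
        α₂∈Y         : ⟦ Y ⟧ α₂
        α₃∈Z         : ⟦ Z ⟧ α₃
        α₁↔g₁        : InterAlgebraic C α₁ (proj₁ g₁)
        α₂↔g₂        : InterAlgebraic C α₂ (proj₁ g₂)
        α₃↔g₃        : InterAlgebraic C α₃ (proj₁ g₃)
        α-generic    : GenericOver C (α₁ ⧺ α₂ ⧺ α₃)
        product≈ε    : ((g₁ G.∙ g₂) G.∙ g₃) G.≈ G.ε

    Cylindrical : Set (suc ℓ)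
    Cylindrical =
        Cartesian T₁ (T₂ ×ₛ T₃) ⟦ X ⟧ (λ (y , z) → ⟦ Y ⟧ y × ⟦ Z ⟧ z)
          (λ x (y , z) → ⟦ F ⟧ (x ⧺ y ⧺ z))
      ⊎ Cartesian T₂ (T₁ ×ₛ T₃) ⟦ Y ⟧ (λ (x , z) → ⟦ X ⟧ x × ⟦ Z ⟧ z)
          (λ y (x , z) → ⟦ F ⟧ (x ⧺ y ⧺ z))
      ⊎ Cartesian T₃ (T₁ ×ₛ T₂) ⟦ Z ⟧ (λ (x , y) → ⟦ X ⟧ x × ⟦ Y ⟧ y)
          (λ z (x , y) → ⟦ F ⟧ (x ⧺ y ⧺ z))
      where
      T₁ = tuples Γ₁
      T₂ = tuples Γ₂
      T₃ = tuples Γ₃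

{-# OPTIONS --safe #-}

-- A group-like F contains n × n grids up to constants, and a cylinder does so
-- exactly, whereas power saving forbids them.  In the group G, whose definable
-- subsets are finite or cofinite, take finite H with |H H| = O(|H|): a
-- progression if some element has infinite order, a finite central subgroup
-- otherwise (the centre is then infinite, by Reineke's argument).  As g₁ and g₂
-- are independent over C, almost all (u , v) come from a point of F whose
-- coordinates correspond to u, v and (u v)⁻¹; so translates g H and H h can be
-- chosen such that all pairs in g H × H h do, with products in g H H h.
-- On the other hand, F contains a set D of rank 2 on which each coordinate is
-- algebraic over the other two.  An infinite cylinder in F meets D in
-- finite fibres, so it would give F ∖ D rank 2 as well, against degree 1.

module Submission where

open import Algebra.Bundles using (Group)
import Algebra.Properties.Group
import Algebra.Properties.Monoid.Mult
import Algebra.Solver.Monoid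
open import Data.Empty using (⊥; ⊥-elim)
open import Data.Fin using (Fin; zero; suc; toℕ; fromℕ<; combine; remQuot)
open import Data.Fin.Properties using (injective⇒≤; toℕ-injective; toℕ-fromℕ<; toℕ<n; combine-remQuot)
open import Data.Integer as ℤ using ()
open import Data.List using (List; []; _∷_; _++_; length; allFin; map; concat)
open import Data.List.Membership.Propositional using (_∈_)
open import Data.List.Membership.Propositional.Properties using (∈-allFin; ∈-++⁺ˡ; ∈-++⁺ʳ)
import Data.List.Membership.Setoid as SetoidMembership
import Data.List.Membership.Setoid.Properties as ∈-Properties
open import Data.List.Properties using (length-++; length-map; length-tabulate)
open import Data.List.Relation.Unary.All as All using (All; []; _∷_)
open import Data.List.Relation.Unary.All.Properties using (map⁺; map⁻; ++⁺; ++⁻ˡ; ++⁻ʳ)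
open import Data.List.Relation.Unary.Any as Any using (here; there)
import Data.List.Relation.Unary.Any.Properties as Any
open import Data.Nat as ℕ using (ℕ; zero; suc; _+_; _*_; _≤_; _<_; z≤n; s≤s; _^_; NonZero; _∸_)
open import Data.Nat.DivMod using (_%_; _/_; m≡m%n+[m/n]*n; m%n<n)
open import Data.Nat.Induction using (<-rec)
import Data.Nat.Properties as ℕ
open import Data.Nat.Solver using (module +-*-Solver)
open import Data.Product using (Σ; Σ-syntax; ∃; _×_; _,_; proj₁; proj₂)
open import Data.Product.Relation.Binary.Pointwise.NonDependent using (_×ₛ_)
open import Data.Rational as ℚ using (ℚ; 0ℚ; ↥_; ↧ₙ_; mkℚ)
open import Data.Sum as Sum using (_⊎_; inj₁; inj₂; [_,_]′)
open import Data.Unit.Polymorphic using (tt; ⊤)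
open import Function.Base using (_∘_; id)
open import Function.Bundles using (_⇔_; mk⇔; Equivalence)
open import Level using (Level; _⊔_; 0ℓ)
open import Relation.Binary.Bundles using (Setoid)
open import Relation.Binary.Definitions using (tri<; tri≈; tri>)
open import Relation.Binary.PropositionalEquality as ≡ using (_≡_; _≢_; refl; cong; cong₂; subst)
open import Relation.Nullary using (¬_; yes; no)
open import Defs

open Equivalence using (to; from)

-- The obstacle is uniformity: inter-algebraicity and independence concern the single tuples α and
-- g, whereas a grid needs statements about all arguments. Each is therefore turned into a definable
-- condition with a number in it. A formula over g and C with finitely many solutions becomes a
-- C-definable relation, cut down by the formula "at most k solutions", so that the bound k holds at
-- every argument. Genericity enters through two facts: a C-definable set that contains the generic
-- point has rank at least 2, and a set related finite-to-one to a minimal set does not. Applied to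
-- the points lying over a C-definable relation between u and v that holds at (g₁ , g₂), they say
-- that this relation bounds neither entry in terms of the other. So the fibre over g₁ of the pairs
-- that come from F is infinite, hence cofinite; missing at most k₀ elements is again a C-definable
-- property of g₁, so it holds for almost all u. The translates g H and H h have g and h on the
-- outer sides, so that the middle factor of a product is in H H whatever g and h commute with.

private variable ℓ ℓ₁ ℓ₂ : Level

-- Cardinality of subsets of a setoid, by covering lists.

module Classically (em : Classical) where

  byContradiction : {P : Set ℓ₁} → ¬ ¬ P → P
  byContradiction {P = P} ¬¬p with em {P = P}
  ... | yes h = h
  ... | no  h = ⊥-elim (¬¬p h)

module Card (em : Classical) {a ℓ : Level} (S : Setoid a ℓ) where
  open Setoid S renaming (Carrier to A; refl to ≈-refl; sym to ≈-sym; trans to ≈-trans)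
  open Size S public
  open SetoidMembership S using () renaming (_∈_ to _∈ˢ_; _∉_ to _∉ˢ_) public
  open ∈-Properties using (∈-resp-≈; index-injective)
  open Classically em

  Covers : List A → (A → Set ℓ₁) → Set (a ⊔ ℓ ⊔ ℓ₁)
  Covers xs P = ∀ x → P x → x ∈ˢ xs

  covers⇒finite : {P : A → Set ℓ₁} (xs : List A) → Covers xs P → Finite P
  covers⇒finite xs c = length xs , xs , ℕ.≤-refl , c

  atMost-⊆ : {P : A → Set ℓ₁} {Q : A → Set ℓ₂} {n : ℕ} → (∀ x → P x → Q x) → AtMost n Q → AtMost n P
  atMost-⊆ f (xs , l , c) = xs , l , λ x h → c x (f x h)

  atMost-≤ : {P : A → Set ℓ₁} {m n : ℕ} → m ≤ n → AtMost m P → AtMost n P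
  atMost-≤ m≤n (xs , l , c) = xs , ℕ.≤-trans l m≤n , c

  finite-⊆ : {P : A → Set ℓ₁} {Q : A → Set ℓ₂} → (∀ x → P x → Q x) → Finite Q → Finite P
  finite-⊆ f (n , b) = n , atMost-⊆ f b

  finite-∪ : {P : A → Set ℓ₁} {Q : A → Set ℓ₂} → Finite P → Finite Q → Finite (λ x → P x ⊎ Q x)
  finite-∪ (_ , xs , _ , c) (_ , ys , _ , d) =
    covers⇒finite (xs ++ ys) λ { x (inj₁ h) → ∈-Properties.∈-++⁺ˡ S (c x h) ; x (inj₂ h) → ∈-Properties.∈-++⁺ʳ S xs (d x h) }

  atMost1 : (x : A) → AtMost 1 (λ y → y ≈ x)
  atMost1 x = x ∷ [] , s≤s z≤n , λ _ y≈x → here y≈x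

  -- Excluded middle is applied to the type of such points itself, so the point obtained is a
  -- genuine witness and the choice can be iterated in `enumerate`.
  infinite-∃∉ : {P : A → Set ℓ₁} → Infinite P → (xs : List A) → Σ[ x ∈ A ] (P x × x ∉ˢ xs)
  infinite-∃∉ inf xs = byContradiction λ none → inf (covers⇒finite xs λ x Px →
    byContradiction λ x∉xs → none (x , Px , x∉xs))

  infinite-∖ : {P : A → Set ℓ₁} {Q : A → Set ℓ₂} → Infinite P → Finite Q → Σ[ x ∈ A ] (P x × ¬ Q x)
  infinite-∖ inf (_ , xs , _ , c) =
    let (x , Px , x∉xs) = infinite-∃∉ inf xs in x , Px , λ Qx → x∉xs (c x Qx)

  infinite-∖-infinite : {P : A → Set ℓ₁} {Q : A → Set ℓ₂} → Infinite P → Finite Q → Infinite (λ x → P x × ¬ Q x)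
  infinite-∖-infinite {Q = Q} inf finQ fin = inf (finite-⊆ split (finite-∪ fin finQ))
    where
    split : ∀ x → _ → _
    split x Px with em {P = Q x}
    ... | yes Qx = inj₂ Qx
    ... | no ¬Qx = inj₁ (Px , ¬Qx)

  module _ {P : A → Set ℓ₁} (inf : Infinite P) where

    private
      initial : ℕ → List A
      initial zero    = []
      initial (suc n) = proj₁ (infinite-∃∉ inf (initial n)) ∷ initial n

    enumerate : ℕ → A
    enumerate n = proj₁ (infinite-∃∉ inf (initial n))

    enumerate-∈ : ∀ n → P (enumerate n)
    enumerate-∈ n = proj₁ (proj₂ (infinite-∃∉ inf (initial n)))

    private
      enumerate-initial : ∀ {i j} → i ℕ.<′ j → enumerate i ∈ˢ initial j
      enumerate-initial ℕ.<′-base         = here ≈-refl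
      enumerate-initial (ℕ.≤′-step i<j)   = there (enumerate-initial i<j)

      enumerate-≉ : ∀ {i j} → i < j → ¬ enumerate i ≈ enumerate j
      enumerate-≉ {i} {j} i<j eq = proj₂ (proj₂ (infinite-∃∉ inf (initial j)))
        (∈-resp-≈ S eq (enumerate-initial (ℕ.≤⇒≤′ i<j)))

    enumerate-injective : ∀ i j → enumerate i ≈ enumerate j → i ≡ j
    enumerate-injective i j eq with ℕ.<-cmp i j
    ... | tri< i<j _ _ = ⊥-elim (enumerate-≉ i<j eq)
    ... | tri≈ _ i≡j _ = i≡j
    ... | tri> _ _ j<i = ⊥-elim (enumerate-≉ j<i (≈-sym eq))

  -- `AtMost` bounds a set only from above, by a list that may repeat or overshoot. Lower bounds
  -- come from here: an injective family sends its indices to positions in the covering list,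
  -- injectively because a position determines its element up to `≈`.
  pigeonhole : {P : A → Set ℓ₁} {m n : ℕ} → AtMost m P → (f : Fin n → A) → (∀ i → P (f i)) →
               (∀ i j → f i ≈ f j → i ≡ j) → n ≤ m
  pigeonhole (xs , l , c) f f∈ f-inj = ℕ.≤-trans
    (injective⇒≤ {f = λ i → Any.index (c (f i) (f∈ i))}
      (λ {i} {j} eq → f-inj i j (index-injective S (c (f i) (f∈ i)) (c (f j) (f∈ j)) eq)))
    l

  infinite-fromSequence : {P : A → Set ℓ₁} (f : ℕ → A) → (∀ i → P (f i)) →
                          (∀ i j → f i ≈ f j → i ≡ j) → Infinite P
  infinite-fromSequence f f∈ f-inj (n , b) =
    ℕ.1+n≰n (pigeonhole {n = suc n} b (λ i → f (toℕ i)) (λ i → f∈ (toℕ i))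
      λ i j eq → toℕ-injective (f-inj _ _ eq))

  -- The same `n` is the length of an injective family and an upper bound, so it is the exact size;
  -- the finite subgroup below uses both halves.
  finite-enum : (P : A → Set ℓ₁) → Finite P →
    Σ[ n ∈ ℕ ] Σ[ f ∈ (Fin n → A) ]
      ((∀ i → P (f i)) × (∀ i j → f i ≈ f j → i ≡ j) × AtMost n P)
  finite-enum P (_ , xs , _ , c) = go xs P c
    where
    go : ∀ {r} (xs : List A) (P : A → Set r) → Covers xs P → Σ[ n ∈ ℕ ] Σ[ f ∈ (Fin n → A) ]
           ((∀ i → P (f i)) × (∀ i j → f i ≈ f j → i ≡ j) × AtMost n P)
    go []       P c = 0 , (λ ()) , (λ ()) , (λ ()) , [] , z≤n , c
    go (x ∷ xs) P c
      with go xs (λ y → P y × ¬ y ≈ x) (λ y (Py , y≉x) → case-∈ (c y Py) y≉x) | em {P = Σ[ y ∈ A ] (P y × y ≈ x)}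
      where
      case-∈ : ∀ {y} → y ∈ˢ x ∷ xs → ¬ y ≈ x → y ∈ˢ xs
      case-∈ (here y≈x) y≉x = ⊥-elim (y≉x y≈x)
      case-∈ (there y∈) _   = y∈
    ... | n , f , f∈ , f-inj , ys , l , d | no none =
      n , f , (λ i → proj₁ (f∈ i)) , f-inj , ys , l , λ y Py → d y (Py , λ y≈x → none (y , Py , y≈x))
    -- `P` need not respect `≈`, so the class of `x` is represented by an element `z` that satisfies
    -- `P`, not by `x` itself.
    ... | n , f , f∈ , f-inj , ys , l , d | yes (z , Pz , z≈x) =
      suc n , g , g∈ , g-inj , z ∷ ys , s≤s l , cover
      where
      g : Fin (suc n) → A
      g zero    = z
      g (suc i) = f i
      g∈ : ∀ i → P (g i)
      g∈ zero    = Pz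
      g∈ (suc i) = proj₁ (f∈ i)
      g-inj : ∀ i j → g i ≈ g j → i ≡ j
      g-inj zero    zero    _  = refl
      g-inj zero    (suc j) eq = ⊥-elim (proj₂ (f∈ j) (≈-trans (≈-sym eq) z≈x))
      g-inj (suc i) zero    eq = ⊥-elim (proj₂ (f∈ i) (≈-trans eq z≈x))
      g-inj (suc i) (suc j) eq = cong suc (f-inj i j eq)
      cover : ∀ y → P y → y ∈ˢ z ∷ ys
      cover y Py with em {P = y ≈ x}
      ... | yes y≈x = here (≈-trans y≈x (≈-sym z≈x))
      ... | no  y≉x = there (d y (Py , y≉x))

module CardBind (em : Classical) {a ℓ b m : Level} (S : Setoid a ℓ) (T : Setoid b m) where
  open Setoid S using (_≈_) renaming (Carrier to A)
  open Setoid T using () renaming (Carrier to B)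
  private
    module S = Card em S
    module T = Card em T

  -- The bound on `Q x` is asked for every `x`, since the list that covers `P` may contain elements
  -- outside `P`. It names elements only up to `≈`, whence `resp`.
  atMost-bind : {P : A → Set ℓ₁} {Q : A → B → Set ℓ₂} {n k : ℕ} →
                (∀ {x x′} y → x ≈ x′ → Q x y → Q x′ y) →
                S.AtMost n P → (∀ x → T.AtMost k (Q x)) →
                T.AtMost (n * k) (λ y → Σ[ x ∈ A ] (P x × Q x y))
  atMost-bind {P = P} {Q} {n} {k} resp (xs , l , c) bound =
    T.atMost-≤ (ℕ.*-monoˡ-≤ k l) (T.atMost-⊆ (λ y (x , Px , Qxy) → x , c x Px , Qxy) (go xs))
    where
    go : ∀ xs → T.AtMost (length xs * k) (λ y → Σ[ x ∈ A ] (x S.∈ˢ xs × Q x y))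
    go []       = [] , z≤n , λ { y (x , () , _) }
    go (x ∷ xs) with bound x | go xs
    ... | ys , l₁ , c₁ | zs , l₂ , c₂ = ys ++ zs ,
      ℕ.≤-trans (ℕ.≤-reflexive (length-++ ys)) (ℕ.+-mono-≤ l₁ l₂) ,
      λ { y (x′ , here x′≈x , Qy)  → ∈-Properties.∈-++⁺ˡ T (c₁ y (resp y x′≈x Qy))
        ; y (x′ , there x′∈ , Qy) → ∈-Properties.∈-++⁺ʳ T ys (c₂ y (x′ , x′∈ , Qy)) }

  finite-bind : {P : A → Set ℓ₁} {Q : A → B → Set ℓ₂} →
                (∀ {x x′} y → x ≈ x′ → Q x y → Q x′ y) →
                S.Finite P → (∀ x → T.Finite (Q x)) →
                T.Finite (λ y → Σ[ x ∈ A ] (P x × Q x y))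
  finite-bind {P = P} {Q} resp (_ , xs , l , c) bound =
    T.finite-⊆ (λ y (x , Px , Qxy) → x , c x Px , Qxy) (go xs)
    where
    go : ∀ xs → T.Finite (λ y → Σ[ x ∈ A ] (x S.∈ˢ xs × Q x y))
    go []       = T.covers⇒finite [] λ { y (x , () , _) }
    go (x ∷ xs) = T.finite-⊆
      (λ { y (x′ , here x′≈x , Qy) → inj₁ (resp y x′≈x Qy) ; y (x′ , there x′∈ , Qy) → inj₂ (x′ , x′∈ , Qy) })
      (T.finite-∪ (bound x) (go xs))

  finite-image : {P : A → Set ℓ₁} (f : A → B) → (∀ {x x′} → x ≈ x′ → Setoid._≈_ T (f x) (f x′)) →
                 S.Finite P → T.Finite (λ y → Σ[ x ∈ A ] (P x × Setoid._≈_ T y (f x)))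
  finite-image f f-cong fin =
    finite-bind (λ y x≈x′ y≈ → Setoid.trans T y≈ (f-cong x≈x′)) fin (λ x → 1 , T.atMost1 (f x))

  finite-bind₃ : {P Q : A → Set ℓ₁} {W : A → A → A → Set ℓ₁} {R : A → B → Set ℓ₁} →
    (∀ {u u′ v v′} w → u ≈ u′ → v ≈ v′ → W u v w → W u′ v′ w) → (∀ {w w′} y → w ≈ w′ → R w y → R w′ y) →
    S.Finite P → S.Finite Q → (∀ u v → S.Finite (W u v)) → (∀ w → T.Finite (R w)) →
    T.Finite (λ y → Σ[ u ∈ A ] (P u × Σ[ v ∈ A ] (Q v × Σ[ w ∈ A ] (W u v w × R w y))))
  finite-bind₃ W-resp R-resp P-finite Q-finite W-finite R-finite =
    finite-bind (λ { y u≈u′ (v , Qv , w , Wuvw , Rwy) → v , Qv , w , W-resp w u≈u′ (Setoid.refl S) Wuvw , Rwy }) P-finite λ u →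
    finite-bind (λ { y v≈v′ (w , Wuvw , Rwy) → w , W-resp w (Setoid.refl S) v≈v′ Wuvw , Rwy }) Q-finite λ v →
    finite-bind R-resp (W-finite u v) R-finite

atMost-fin : (em : Classical) {b m r : Level} (T : Setoid b m) {k n : ℕ}
             {Q : Fin n → Setoid.Carrier T → Set r} →
             (∀ i → Size.AtMost T k (Q i)) → Size.AtMost T (n * k) (λ y → Σ[ i ∈ Fin n ] Q i y)
atMost-fin em T {n = n} bound = Card.atMost-⊆ em T (λ y (i , Qi) → i , tt , Qi)
  (CardBind.atMost-bind em (≡.setoid (Fin n)) T {P = λ _ → ⊤ {0ℓ}} (λ { y refl h → h })
    (allFin n , ℕ.≤-reflexive (length-tabulate {n = n} (λ i → i)) , λ i _ → ∈-allFin i) bound)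

finite-fin : (em : Classical) {b m r : Level} (T : Setoid b m) {n : ℕ}
             {Q : Fin n → Setoid.Carrier T → Set r} →
             (∀ i → Size.Finite T (Q i)) → Size.Finite T (λ y → Σ[ i ∈ Fin n ] Q i y)
finite-fin em T {n = n} fin = Card.finite-⊆ em T (λ y (i , Qi) → i , tt , Qi)
  (CardBind.finite-bind em (≡.setoid (Fin n)) T {P = λ _ → ⊤ {0ℓ}} (λ { y refl h → h })
    (Card.covers⇒finite em (≡.setoid (Fin n)) (allFin n) (λ i _ → ∈-allFin i)) fin)

-- Large grids contradict a power saving.

numerator-positive : (ε : ℚ) → 0ℚ ℚ.< ε → Σ[ p ∈ ℕ ] ℤ.∣ ↥ ε ∣ ≡ suc p
numerator-positive (mkℚ ℤ.+[1+ p ] _ _) _ = p , refl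
numerator-positive (mkℚ (ℤ.+ zero) d _) (ℚ.*<* (ℤ.+<+ ()))
numerator-positive (mkℚ ℤ.-[1+ _ ] d _) (ℚ.*<* ())

^-distribʳ-* : ∀ q m n → (m * n) ^ q ≡ m ^ q * n ^ q
^-distribʳ-* zero    m n = refl
^-distribʳ-* (suc q) m n = ≡.trans (cong (m * n *_) (^-distribʳ-* q m n))
  (solve 4 (λ m n x y → m :* n :* (x :* y) := m :* x :* (n :* y)) refl m n (m ^ q) (n ^ q))
  where open +-*-Solver using (solve; _:*_; _:=_)

module _ where
  open ℕ.≤-Reasoning

  -- Here `suc p` and `q` are the numerator and the denominator of ε, and the saving is applied at
  -- size `c * n`. Raising `n * n ≤ c * m` to the power `q` and multiplying by `(c * n) ^ suc p`
  -- lets the saving absorb `m ^ q`; then `n ^ (2 * q)` cancels. What remains on the left is at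
  -- least `n`, because the exponent `suc p` is positive, and on the right it is independent of `n`.
  grid-bound : ∀ c K p q m n → 0 < n → 0 < c → n * n ≤ c * m →
               m ^ q * (c * n) ^ suc p ≤ K ^ q * (c * n) ^ (2 * q) →
               n ≤ c ^ q * (K ^ q * c ^ (2 * q))
  grid-bound c@(suc _) K p q m n@(suc _) 0<n 0<c nn≤cm h =
    ℕ.*-cancelʳ-≤ n (c ^ q * (K ^ q * c ^ (2 * q))) (n ^ (2 * q)) {{ℕ.m^n≢0 n (2 * q)}} (begin
      n * n ^ (2 * q)                              ≤⟨ ℕ.*-monoˡ-≤ (n ^ (2 * q)) n≤N^p ⟩
      (c * n) ^ suc p * n ^ (2 * q)                ≡⟨ cong ((c * n) ^ suc p *_) n^2q ⟩
      (c * n) ^ suc p * (n * n) ^ q                ≤⟨ ℕ.*-monoʳ-≤ ((c * n) ^ suc p) (ℕ.^-monoˡ-≤ q nn≤cm) ⟩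
      (c * n) ^ suc p * (c * m) ^ q                ≡⟨ cong ((c * n) ^ suc p *_) (^-distribʳ-* q c m) ⟩
      (c * n) ^ suc p * (c ^ q * m ^ q)            ≡⟨ shuffle₁ ((c * n) ^ suc p) (c ^ q) (m ^ q) ⟩
      c ^ q * (m ^ q * (c * n) ^ suc p)            ≤⟨ ℕ.*-monoʳ-≤ (c ^ q) h ⟩
      c ^ q * (K ^ q * (c * n) ^ (2 * q))          ≡⟨ cong (λ x → c ^ q * (K ^ q * x)) (^-distribʳ-* (2 * q) c n) ⟩
      c ^ q * (K ^ q * (c ^ (2 * q) * n ^ (2 * q))) ≡⟨ shuffle₂ (c ^ q) (K ^ q) (c ^ (2 * q)) (n ^ (2 * q)) ⟩
      c ^ q * (K ^ q * c ^ (2 * q)) * n ^ (2 * q)  ∎)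
    where
    open +-*-Solver using (solve; _:*_; _:=_)
    shuffle₁ : ∀ x y z → x * (y * z) ≡ y * (z * x)
    shuffle₁ = solve 3 (λ x y z → x :* (y :* z) := y :* (z :* x)) refl
    shuffle₂ : ∀ x y z w → x * (y * (z * w)) ≡ x * (y * z) * w
    shuffle₂ = solve 4 (λ x y z w → x :* (y :* (z :* w)) := x :* (y :* z) :* w) refl
    n^2q : n ^ (2 * q) ≡ (n * n) ^ q
    n^2q = ≡.trans (≡.sym (ℕ.^-*-assoc n 2 q)) (cong (λ x → (n * x) ^ q) (ℕ.*-identityʳ n))
    n≤N^p : n ≤ (c * n) ^ suc p
    n≤N^p = begin
      n                ≤⟨ ℕ.m≤n*m n c ⟩
      c * n            ≤⟨ ℕ.m≤m*n (c * n) ((c * n) ^ p) {{ℕ.m^n≢0 (c * n) p}} ⟩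
      (c * n) ^ suc p  ∎

module _ {L : Language ℓ} (M : Structure L) {Γ₁ Γ₂ Γ₃ : List (Language.Sort L)} where
  open Structure M
  open Definability M
  open Conditions M {Γ₁} {Γ₂} {Γ₃}

  module _ (X : Definable Γ₁) (Y : Definable Γ₂) (Z : Definable Γ₃)
           (F : Definable (Γ₁ ++ Γ₂ ++ Γ₃)) where

    -- The number of points is bounded below through its upper bounds: every `m` that covers them
    -- satisfies the inequality in `many`. The constant `c` absorbs the finite-to-finite
    -- correspondences between coordinates and group elements.
    record Grid (c n : ℕ) : Set (Level.suc ℓ) where
      field
        A   : Tuple Γ₁ → Set ℓ
        B   : Tuple Γ₂ → Set ℓ
        C   : Tuple Γ₃ → Set ℓ
        A⊆X : ∀ x → A x → ⟦ X ⟧ x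
        B⊆Y : ∀ y → B y → ⟦ Y ⟧ y
        C⊆Z : ∀ z → C z → ⟦ Z ⟧ z
        ∣A∣ : Size.AtMost (tuples Γ₁) (c * n) A
        ∣B∣ : Size.AtMost (tuples Γ₂) (c * n) B
        ∣C∣ : Size.AtMost (tuples Γ₃) (c * n) C
        many : ∀ m → Size.AtMost (tuples Γ₁ ×ₛ (tuples Γ₂ ×ₛ tuples Γ₃)) m
                 (λ (x , y , z) → A x × B y × C z × ⟦ F ⟧ (x ⧺ y ⧺ z)) → n * n ≤ c * m

    grids⇒¬powerSaving : (c : ℕ) .{{_ : NonZero c}} → (∀ N → Σ[ n ∈ ℕ ] (N ≤ n × Grid c n)) → ¬ PowerSaving X Y Z F
    grids⇒¬powerSaving c@(suc _) grids (ε , ε>0 , K , _ , n₀ , saving)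
      with numerator-positive ε ε>0
    ... | p , eq = contra (grids (suc (n₀ + bound)))
      where
      q = ↧ₙ ε
      -- The bound on `n` from `grid-bound`; a grid with `n` beyond this and beyond `n₀` is a
      -- contradiction.
      bound : ℕ
      bound = c ^ q * (K ^ q * c ^ (2 * q))
      contra : Σ[ n ∈ ℕ ] (suc (n₀ + bound) ≤ n × Grid c n) → ⊥
      contra (n@(suc _) , s≤s N≤n , g)
        with saving (c * n) n₀<cn A B C A⊆X B⊆Y C⊆Z ∣A∣ ∣B∣ ∣C∣
        where
        open Grid g
        n₀<cn : n₀ < c * n
        n₀<cn = ℕ.≤-trans (s≤s (ℕ.≤-trans (ℕ.m≤m+n n₀ _) N≤n)) (ℕ.m≤n*m n c)
      ... | m , pb , atMost = ℕ.<⇒≱ (s≤s (ℕ.≤-trans (ℕ.m≤n+m (bound) n₀) N≤n))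
        (grid-bound c K p q m n (s≤s z≤n) (s≤s z≤n) (Grid.many g m atMost)
          (subst (λ e → m ^ q * (c * n) ^ e ≤ K ^ q * (c * n) ^ (2 * q)) eq pb))

-- Substitution in formulas, and the elimination of imaginaries.

≡⇒⇔ : {A B : Set ℓ} → A ≡ B → A ⇔ B
≡⇒⇔ refl = mk⇔ id id

module Logic {ℓ : Level} {L : Language ℓ} (M : Structure L) where
  open Language L
  open Structure M
  open Semantics M

  private
    Term′ : List Sort → Sort → Set ℓ
    Term′ = Term L

  vars : {Γ Θ : List Sort} → (∀ {s} → s ∈ Γ → s ∈ Θ) → All (Term′ Θ) Γ
  vars {[]}    ρ = []
  vars {s ∷ Γ} ρ = var (ρ (here refl)) ∷ vars (ρ ∘ there)

  mutual
    subT : {Γ Θ : List Sort} {s : Sort} → All (Term′ Θ) Γ → Term′ Γ s → Term′ Θ s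
    subT σ (var x)    = All.lookup σ x
    subT σ (app f ts) = app f (subTs σ ts)

    subTs : {Γ Θ Δ : List Sort} → All (Term′ Θ) Γ → All (Term′ Γ) Δ → All (Term′ Θ) Δ
    subTs σ []       = []
    subTs σ (t ∷ ts) = subT σ t ∷ subTs σ ts

  weaken : {Γ : List Sort} {s : Sort} → All (Term′ (s ∷ Γ)) Γ
  weaken = vars there

  lift : {Γ Θ : List Sort} (s : Sort) → All (Term′ Θ) Γ → All (Term′ (s ∷ Θ)) (s ∷ Γ)
  lift s σ = var (here refl) ∷ subTs weaken σ

  subF : {Γ Θ : List Sort} → All (Term′ Θ) Γ → Formula L Γ → Formula L Θ
  subF σ (t ≐ u)    = subT σ t ≐ subT σ u
  subF σ (rel R ts) = rel R (subTs σ ts)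
  subF σ (¬′ φ)     = ¬′ subF σ φ
  subF σ (φ ∧′ ψ)   = subF σ φ ∧′ subF σ ψ
  subF σ (∃′ s φ)   = ∃′ s (subF (lift s σ) φ)

  lookup-evals : {Γ Θ : List Sort} (a : Tuple Θ) (σ : All (Term′ Θ) Γ) {s : Sort} (x : s ∈ Γ) →
                 eval a (All.lookup σ x) ≡ All.lookup (evals a σ) x
  lookup-evals a (t ∷ σ) (here refl) = refl
  lookup-evals a (t ∷ σ) (there x)   = lookup-evals a σ x

  mutual
    eval-subT : {Γ Θ : List Sort} {s : Sort} (a : Tuple Θ) (σ : All (Term′ Θ) Γ) (t : Term′ Γ s) →
                eval a (subT σ t) ≡ eval (evals a σ) t
    eval-subT a σ (var x)    = lookup-evals a σ x
    eval-subT a σ (app f ts) = cong (funᴹ f) (evals-subTs a σ ts)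

    evals-subTs : {Γ Θ Δ : List Sort} (a : Tuple Θ) (σ : All (Term′ Θ) Γ) (ts : All (Term′ Γ) Δ) →
                  evals a (subTs σ ts) ≡ evals (evals a σ) ts
    evals-subTs a σ []       = refl
    evals-subTs a σ (t ∷ ts) = cong₂ _∷_ (eval-subT a σ t) (evals-subTs a σ ts)

  evals-vars : {Γ Θ : List Sort} (ρ : ∀ {s} → s ∈ Γ → s ∈ Θ) (a : Tuple Θ) (b : Tuple Γ) →
               (∀ {s} (x : s ∈ Γ) → All.lookup a (ρ x) ≡ All.lookup b x) → evals a (vars ρ) ≡ b
  evals-vars ρ a []      h = refl
  evals-vars ρ a (e ∷ b) h = cong₂ _∷_ (h (here refl)) (evals-vars (ρ ∘ there) a b (h ∘ there))

  evals-lift : {Γ Θ : List Sort} {s : Sort} (a : Tuple Θ) (e : ∣ s ∣) (σ : All (Term′ Θ) Γ) →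
               evals (e ∷ a) (lift s σ) ≡ e ∷ evals a σ
  evals-lift a e σ = cong (e ∷_) (≡.trans (evals-subTs (e ∷ a) weaken σ)
    (cong (λ b → evals b σ) (evals-vars there (e ∷ a) a (λ _ → refl))))

  ⊨-subF : {Γ Θ : List Sort} (a : Tuple Θ) (σ : All (Term′ Θ) Γ) (φ : Formula L Γ) →
           (a ⊨ subF σ φ) ⇔ (evals a σ ⊨ φ)
  ⊨-subF a σ (_≐_ {s} t u) = ≡⇒⇔ (cong₂ (Setoid._≈_ (universe s)) (eval-subT a σ t) (eval-subT a σ u))
  ⊨-subF a σ (rel R ts) = ≡⇒⇔ (cong (relᴹ R) (evals-subTs a σ ts))
  ⊨-subF a σ (¬′ φ)     = mk⇔ (λ h k → h (from (⊨-subF a σ φ) k)) (λ h k → h (to (⊨-subF a σ φ) k))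
  ⊨-subF a σ (φ ∧′ ψ)   = mk⇔ (λ (h , k) → to (⊨-subF a σ φ) h , to (⊨-subF a σ ψ) k)
                              (λ (h , k) → from (⊨-subF a σ φ) h , from (⊨-subF a σ ψ) k)
  ⊨-subF a σ (∃′ s φ)   = mk⇔
    (λ (e , h) → e , subst (_⊨ φ) (evals-lift a e σ) (to (⊨-subF (e ∷ a) (lift s σ) φ) h))
    (λ (e , h) → e , from (⊨-subF (e ∷ a) (lift s σ) φ) (subst (_⊨ φ) (≡.sym (evals-lift a e σ)) h))

  ∃ᵇ : (Γ : List Sort) {Θ : List Sort} → Formula L (Γ ++ Θ) → Formula L Θ
  ∃ᵇ []      φ = φ
  ∃ᵇ (s ∷ Γ) φ = ∃ᵇ Γ (∃′ s φ)

  ⊨-∃ᵇ : (Γ : List Sort) {Θ : List Sort} (φ : Formula L (Γ ++ Θ)) (a : Tuple Θ) →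
         (a ⊨ ∃ᵇ Γ φ) ⇔ (Σ[ t ∈ Tuple Γ ] (t ⧺ a ⊨ φ))
  ⊨-∃ᵇ []      φ a = mk⇔ (λ h → [] , h) (λ { ([] , h) → h })
  ⊨-∃ᵇ (s ∷ Γ) φ a = mk⇔
    (λ h → let (t , e , k) = to (⊨-∃ᵇ Γ (∃′ s φ) a) h in e ∷ t , k)
    (λ { (e ∷ t , k) → from (⊨-∃ᵇ Γ (∃′ s φ) a) (t , e , k) })

  evals-++⁺ : {Γ Δ Θ : List Sort} (a : Tuple Θ) (σ : All (Term′ Θ) Γ) (τ : All (Term′ Θ) Δ) →
              evals a (++⁺ σ τ) ≡ evals a σ ⧺ evals a τ
  evals-++⁺ a []      τ = refl
  evals-++⁺ a (t ∷ σ) τ = cong (eval a t ∷_) (evals-++⁺ a σ τ)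

  lookup-⧺ˡ : {Γ Δ : List Sort} (a : Tuple Γ) (b : Tuple Δ) {s : Sort} (x : s ∈ Γ) →
              All.lookup (a ⧺ b) (∈-++⁺ˡ x) ≡ All.lookup a x
  lookup-⧺ˡ (_ ∷ a) b (here refl) = refl
  lookup-⧺ˡ (_ ∷ a) b (there x)   = lookup-⧺ˡ a b x

  lookup-⧺ʳ : {Γ Δ : List Sort} (a : Tuple Γ) (b : Tuple Δ) {s : Sort} (x : s ∈ Δ) →
              All.lookup (a ⧺ b) (∈-++⁺ʳ Γ x) ≡ All.lookup b x
  lookup-⧺ʳ []      b x = refl
  lookup-⧺ʳ (_ ∷ a) b x = lookup-⧺ʳ a b x

  lookup-⧺-elim : {p : Level} {Γ Δ : List Sort} (a : Tuple Γ) (b : Tuple Δ) (P : (s : Sort) → ∣ s ∣ → Set p) →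
                  (∀ {s} (x : s ∈ Γ) → P s (All.lookup a x)) → (∀ {s} (x : s ∈ Δ) → P s (All.lookup b x)) →
                  ∀ {s} (x : s ∈ Γ ++ Δ) → P s (All.lookup (a ⧺ b) x)
  lookup-⧺-elim []      b P h k x           = k x
  lookup-⧺-elim (_ ∷ a) b P h k (here refl) = h (here refl)
  lookup-⧺-elim (_ ∷ a) b P h k (there x)   = lookup-⧺-elim a b P (h ∘ there) k x

  ≋-refl : {Γ : List Sort} (a : Tuple Γ) → a ≋ a
  ≋-refl {Γ} a = Setoid.refl (tuples Γ) {a}

  ≋-sym : {Γ : List Sort} {a b : Tuple Γ} → a ≋ b → b ≋ a
  ≋-sym {Γ} = Setoid.sym (tuples Γ)

  ≋-trans : {Γ : List Sort} {a b c : Tuple Γ} → a ≋ b → b ≋ c → a ≋ c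
  ≋-trans {Γ} {a} = Setoid.trans (tuples Γ) {a}

  ⟦⟧-resp : {Γ : List Sort} (D : Definability.Definable M Γ) {a b : Tuple Γ} → a ≋ b →
            Definability.⟦_⟧ M D a → Definability.⟦_⟧ M D b
  ⟦⟧-resp D a≋b = ⊨-cong (pw-++ universe a≋b (≋-refl (Definability.Definable.params D))) (Definability.Definable.formula D)

  ⧺-injective : {Γ Δ : List Sort} {a a′ : Tuple Γ} {b b′ : Tuple Δ} → a ⧺ b ≋ a′ ⧺ b′ → (a ≋ a′) × (b ≋ b′)
  ⧺-injective {a = []}    {[]}    h       = tt , h
  ⧺-injective {a = _ ∷ _} {_ ∷ _} (p , h) = let (q , r) = ⧺-injective h in (p , q) , r

-- Formulas of M^eq are rewritten over M by replacing each variable of an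
-- imaginary sort by a tuple of representatives.
module Elimination {ℓ : Level} {L : Language ℓ} (M : Structure L) where
  open Language L
  open Structure M
  open Semantics M
  open Logic M
  open Imaginaries M
  private
    module Mᵉ = Structure Mᵉᵠ
    module Sᵉ = Semantics Mᵉᵠ
    module D  = Definability M
    module Dᵉ = Definability Mᵉᵠ
    Sortᵉ = Language.Sort Lᵉᵠ

  ⌊_⌋ : List Sortᵉ → List Sort
  ⌊ [] ⌋         = []
  ⌊ inj₁ s ∷ Γ ⌋ = s ∷ ⌊ Γ ⌋
  ⌊ inj₂ E ∷ Γ ⌋ = EqRel.Γ E ++ ⌊ Γ ⌋

  represent : {Γ : List Sortᵉ} → Mᵉ.Tuple Γ → Tuple ⌊ Γ ⌋
  represent {[]}         []      = []
  represent {inj₁ s ∷ Γ} (x ∷ a) = x ∷ represent a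
  represent {inj₂ E ∷ Γ} (t ∷ a) = t ⧺ represent a

  -- An element of a quotient sort is carried by a tuple of `M`, with the equivalence relation as
  -- its equality. A term of that sort therefore becomes a tuple of terms, and the projection onto
  -- the sort becomes the identity.
  Represented : List Sort → Sortᵉ → Set ℓ
  Represented Θ (inj₁ s) = Term L Θ s
  Represented Θ (inj₂ E) = All (Term L Θ) (EqRel.Γ E)

  evalR : {Θ : List Sort} (s : Sortᵉ) → Tuple Θ → Represented Θ s → Mᵉ.∣ s ∣
  evalR (inj₁ s) a t  = eval a t
  evalR (inj₂ E) a ts = evals a ts

  ⌊var⌋ : {Γ : List Sortᵉ} {s : Sortᵉ} {Θ : List Sort} → (∀ {s′} → s′ ∈ ⌊ Γ ⌋ → s′ ∈ Θ) → s ∈ Γ → Represented Θ s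
  ⌊var⌋ {inj₁ s ∷ Γ} ρ (here refl) = var (ρ (here refl))
  ⌊var⌋ {inj₂ E ∷ Γ} ρ (here refl) = vars (ρ ∘ ∈-++⁺ˡ)
  ⌊var⌋ {inj₁ s ∷ Γ} ρ (there x)   = ⌊var⌋ {Γ} (ρ ∘ there) x
  ⌊var⌋ {inj₂ E ∷ Γ} ρ (there x)   = ⌊var⌋ {Γ} (ρ ∘ ∈-++⁺ʳ (EqRel.Γ E)) x

  mutual
    ⌊_⌋ₜ : {Γ : List Sortᵉ} {s : Sortᵉ} → Term Lᵉᵠ Γ s → Represented ⌊ Γ ⌋ s
    ⌊ var x ⌋ₜ           = ⌊var⌋ id x
    ⌊ app (inj₁ f) ts ⌋ₜ = app f ⌊ ts ⌋ₜₛ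
    ⌊ app (inj₂ E) ts ⌋ₜ = ⌊ ts ⌋ₜₛ

    ⌊_⌋ₜₛ : {Γ : List Sortᵉ} {Δ : List Sort} → All (Term Lᵉᵠ Γ) (map inj₁ Δ) → All (Term L ⌊ Γ ⌋) Δ
    ⌊_⌋ₜₛ {Δ = []}    []       = []
    ⌊_⌋ₜₛ {Δ = _ ∷ _} (t ∷ ts) = ⌊ t ⌋ₜ ∷ ⌊ ts ⌋ₜₛ

  eval-⌊var⌋ : {Γ : List Sortᵉ} {s : Sortᵉ} {Θ : List Sort} (ρ : ∀ {s′} → s′ ∈ ⌊ Γ ⌋ → s′ ∈ Θ)
               (b : Tuple Θ) (a : Mᵉ.Tuple Γ) →
               (∀ {s′} (x : s′ ∈ ⌊ Γ ⌋) → All.lookup b (ρ x) ≡ All.lookup (represent a) x) →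
               (x : s ∈ Γ) → evalR s b (⌊var⌋ ρ x) ≡ All.lookup a x
  eval-⌊var⌋ {inj₁ s ∷ Γ} ρ b (_ ∷ a) h (here refl) = h (here refl)
  eval-⌊var⌋ {inj₂ E ∷ Γ} ρ b (t ∷ a) h (here refl) =
    evals-vars (ρ ∘ ∈-++⁺ˡ) b t (λ x → ≡.trans (h (∈-++⁺ˡ x)) (lookup-⧺ˡ t (represent a) x))
  eval-⌊var⌋ {inj₁ s ∷ Γ} ρ b (_ ∷ a) h (there x) = eval-⌊var⌋ (ρ ∘ there) b a (h ∘ there) x
  eval-⌊var⌋ {inj₂ E ∷ Γ} ρ b (t ∷ a) h (there x) = eval-⌊var⌋ (ρ ∘ ∈-++⁺ʳ (EqRel.Γ E)) b a
    (λ y → ≡.trans (h (∈-++⁺ʳ (EqRel.Γ E) y)) (lookup-⧺ʳ t (represent a) y)) x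

  mutual
    eval-⌊⌋ₜ : {Γ : List Sortᵉ} {s : Sortᵉ} (a : Mᵉ.Tuple Γ) (t : Term Lᵉᵠ Γ s) →
               evalR s (represent a) ⌊ t ⌋ₜ ≡ Sᵉ.eval a t
    eval-⌊⌋ₜ a (var x)           = eval-⌊var⌋ id (represent a) a (λ _ → refl) x
    eval-⌊⌋ₜ a (app (inj₁ f) ts) = cong (funᴹ f) (evals-⌊⌋ₜₛ a ts)
    eval-⌊⌋ₜ a (app (inj₂ E) ts) = evals-⌊⌋ₜₛ a ts

    evals-⌊⌋ₜₛ : {Γ : List Sortᵉ} {Δ : List Sort} (a : Mᵉ.Tuple Γ) (ts : All (Term Lᵉᵠ Γ) (map inj₁ Δ)) →
                 evals (represent a) ⌊ ts ⌋ₜₛ ≡ map⁻ (Sᵉ.evals a ts)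
    evals-⌊⌋ₜₛ {Δ = []}    a []       = refl
    evals-⌊⌋ₜₛ {Δ = _ ∷ _} a (t ∷ ts) = cong₂ _∷_ (eval-⌊⌋ₜ a t) (evals-⌊⌋ₜₛ a ts)

  ⌊_⌋ᶠ : {Γ : List Sortᵉ} → Formula Lᵉᵠ Γ → Formula L ⌊ Γ ⌋
  ⌊ _≐_ {inj₁ s} t u ⌋ᶠ = ⌊ t ⌋ₜ ≐ ⌊ u ⌋ₜ
  -- Equality in a quotient sort is the defining formula of `E`, applied to representatives.
  ⌊ _≐_ {inj₂ E} t u ⌋ᶠ = subF (++⁺ ⌊ t ⌋ₜ ⌊ u ⌋ₜ) (EqRel.formula E)
  ⌊ rel R ts ⌋ᶠ         = rel R ⌊ ts ⌋ₜₛ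
  ⌊ ¬′ φ ⌋ᶠ             = ¬′ ⌊ φ ⌋ᶠ
  ⌊ φ ∧′ ψ ⌋ᶠ           = ⌊ φ ⌋ᶠ ∧′ ⌊ ψ ⌋ᶠ
  ⌊ ∃′ (inj₁ s) φ ⌋ᶠ    = ∃′ s ⌊ φ ⌋ᶠ
  ⌊ ∃′ (inj₂ E) φ ⌋ᶠ    = ∃ᵇ (EqRel.Γ E) ⌊ φ ⌋ᶠ

  ⊨-⌊⌋ᶠ : {Γ : List Sortᵉ} (a : Mᵉ.Tuple Γ) (φ : Formula Lᵉᵠ Γ) →
          (represent a ⊨ ⌊ φ ⌋ᶠ) ⇔ (a Sᵉ.⊨ φ)
  ⊨-⌊⌋ᶠ a (_≐_ {inj₁ s} t u) = ≡⇒⇔ (cong₂ (Setoid._≈_ (universe s)) (eval-⌊⌋ₜ a t) (eval-⌊⌋ₜ a u))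
  ⊨-⌊⌋ᶠ a (_≐_ {inj₂ E} t u) = mk⇔ (subst id eq ∘ to sem) (from sem ∘ subst id (≡.sym eq))
    where
    sem = ⊨-subF (represent a) (++⁺ ⌊ t ⌋ₜ ⌊ u ⌋ₜ) (EqRel.formula E)
    eq = cong (_⊨ EqRel.formula E) (≡.trans (evals-++⁺ (represent a) ⌊ t ⌋ₜ ⌊ u ⌋ₜ)
           (cong₂ _⧺_ (eval-⌊⌋ₜ a t) (eval-⌊⌋ₜ a u)))
  ⊨-⌊⌋ᶠ a (rel R ts) = ≡⇒⇔ (cong (relᴹ R) (evals-⌊⌋ₜₛ a ts))
  ⊨-⌊⌋ᶠ a (¬′ φ)     = mk⇔ (λ h k → h (from (⊨-⌊⌋ᶠ a φ) k)) (λ h k → h (to (⊨-⌊⌋ᶠ a φ) k))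
  ⊨-⌊⌋ᶠ a (φ ∧′ ψ)   = mk⇔ (λ (h , k) → to (⊨-⌊⌋ᶠ a φ) h , to (⊨-⌊⌋ᶠ a ψ) k)
                           (λ (h , k) → from (⊨-⌊⌋ᶠ a φ) h , from (⊨-⌊⌋ᶠ a ψ) k)
  ⊨-⌊⌋ᶠ a (∃′ (inj₁ s) φ) = mk⇔ (λ (e , h) → e , to (⊨-⌊⌋ᶠ (e ∷ a) φ) h) (λ (e , h) → e , from (⊨-⌊⌋ᶠ (e ∷ a) φ) h)
  ⊨-⌊⌋ᶠ a (∃′ (inj₂ E) φ) = mk⇔
    (λ h → let (e , k) = to (⊨-∃ᵇ (EqRel.Γ E) ⌊ φ ⌋ᶠ (represent a)) h in e , to (⊨-⌊⌋ᶠ (e ∷ a) φ) k)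
    (λ (e , h) → from (⊨-∃ᵇ (EqRel.Γ E) ⌊ φ ⌋ᶠ (represent a)) (e , from (⊨-⌊⌋ᶠ (e ∷ a) φ) h))

  represent-over : (C : D.ParamSet) {Δ : List Sortᵉ} (c : Mᵉ.Tuple Δ) →
                   (∀ {s} (x : s ∈ Δ) → homeSet C s (All.lookup c x)) →
                   ∀ {s} (x : s ∈ ⌊ Δ ⌋) → C s (All.lookup (represent c) x)
  represent-over C {inj₁ s ∷ Δ} (e ∷ c) h (here refl) = h (here refl)
  represent-over C {inj₁ s ∷ Δ} (e ∷ c) h (there x)   = represent-over C c (h ∘ there) x
  represent-over C {inj₂ E ∷ Δ} (e ∷ c) h x with h (here refl)
  ... | ()

  -- On home sorts `represent` changes nothing, and `homeSet C` has no imaginary elements. The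
  -- translated formula thus has the same parameters and the same solutions, and finiteness carries
  -- over with the same bound.
  aclᵉᵠ⇒acl : (C : D.ParamSet) {s : Sort} (e : ∣ s ∣) → Dᵉ.acl (homeSet C) (inj₁ s) e → D.acl C s e
  aclᵉᵠ⇒acl C {s} e (D , over , e∈D , n , xs , l , c) =
    record { formula = ⌊ formula ⌋ᶠ ; params = represent params } ,
    represent-over C params over ,
    from (⊨-⌊⌋ᶠ (e ∷ params) formula) e∈D ,
    n , map down xs , ≡.subst (ℕ._≤ n) (≡.sym (length-map down xs)) l ,
    λ { (x ∷ []) h → Any.map⁺ (Any.map down-cong (c (x ∷ []) (to (⊨-⌊⌋ᶠ (x ∷ params) formula) h))) }
    where
    open Dᵉ.Definable D
    down : Mᵉ.Tuple (inj₁ s ∷ []) → Tuple (s ∷ [])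
    down (x ∷ []) = x ∷ []
    down-cong : {x : ∣ s ∣} {y : Mᵉ.Tuple (inj₁ s ∷ [])} → Mᵉ._≋_ (x ∷ []) y → (x ∷ []) ≋ down y
    down-cong {y = _ ∷ []} x≋y = x≋y

  ∈aclᵉᵠ⇒∈acl : (C : D.ParamSet) {Γ : List Sort} (a : Tuple Γ) → a ∈aclᵉᵠ C → D._⊆acl_ a C
  ∈aclᵉᵠ⇒∈acl C (e ∷ a) h (here refl) = aclᵉᵠ⇒acl C e (h (here refl))
  ∈aclᵉᵠ⇒∈acl C (e ∷ a) h (there x)   = ∈aclᵉᵠ⇒∈acl C a (h ∘ there) x

-- A calculus of definable relations between tuples.

module DefinableRelations (em : Classical) {ℓ : Level} {L : Language ℓ} (M : Structure L)
                          (s₀ : Language.Sort L) where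
  open Language L
  open Structure M
  open Semantics M
  open Logic M
  open Definability M
  open Classically em

  Context : Set ℓ
  Context = List (List Sort)

  Env : Context → Set ℓ
  Env = All Tuple

  flat : {Ξ : Context} → Env Ξ → Tuple (concat Ξ)
  flat []      = []
  flat (t ∷ e) = t ⧺ flat e

  _≋ᵉ_ : {Ξ : Context} → Env Ξ → Env Ξ → Set ℓ
  []      ≋ᵉ []        = ⊤
  (t ∷ e) ≋ᵉ (t′ ∷ e′) = (t ≋ t′) × (e ≋ᵉ e′)

  flat-cong : {Ξ : Context} {e e′ : Env Ξ} → e ≋ᵉ e′ → flat e ≋ flat e′
  flat-cong {e = []}    {[]}    _       = tt
  flat-cong {e = _ ∷ _} {_ ∷ _} (p , q) = pw-++ universe p (flat-cong q)

  -- Maps on environments that are given by terms. Along these a formula can be pulled back by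
  -- substitution, which is how blocks of variables are moved, joined and split.
  record TermMap {Ξ : Context} {Θ : List Sort} (f : Env Ξ → Tuple Θ) : Set ℓ where
    constructor mkTermMap
    field
      terms : All (Term L (concat Ξ)) Θ
      value : ∀ e → evals (flat e) terms ≡ f e

  private
    ∈-concat : {Ξ : Context} {Γ : List Sort} → Γ ∈ Ξ → ∀ {s} → s ∈ Γ → s ∈ concat Ξ
    ∈-concat (here refl)              y = ∈-++⁺ˡ y
    ∈-concat {Γ′ ∷ _} (there x) y = ∈-++⁺ʳ Γ′ (∈-concat x y)

    lookup-flat : {Ξ : Context} (e : Env Ξ) {Γ : List Sort} (x : Γ ∈ Ξ) → ∀ {s} (y : s ∈ Γ) →
                  All.lookup (flat e) (∈-concat x y) ≡ All.lookup (All.lookup e x) y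
    lookup-flat (t ∷ e) (here refl) y = lookup-⧺ˡ t (flat e) y
    lookup-flat (t ∷ e) (there x)   y = ≡.trans (lookup-⧺ʳ t (flat e) (∈-concat x y)) (lookup-flat e x y)

  block : {Ξ : Context} {Γ : List Sort} (x : Γ ∈ Ξ) → TermMap {Ξ} (λ e → All.lookup e x)
  block x = mkTermMap (vars (∈-concat x)) λ e → evals-vars (∈-concat x) (flat e) (All.lookup e x) (lookup-flat e x)

  infixr 5 _⧺ᵗ_
  _⧺ᵗ_ : {Ξ : Context} {Γ Δ : List Sort} {f : Env Ξ → Tuple Γ} {g : Env Ξ → Tuple Δ} →
         TermMap f → TermMap g → TermMap (λ e → f e ⧺ g e)
  mkTermMap σ p ⧺ᵗ mkTermMap τ q = mkTermMap (++⁺ σ τ) λ e → ≡.trans (evals-++⁺ (flat e) σ τ) (cong₂ _⧺_ (p e) (q e))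

  evalsᵗ : {Ξ : Context} {Γ Δ : List Sort} {f : Env Ξ → Tuple Γ} (τ : All (Term L Γ) Δ) →
           TermMap f → TermMap (λ e → evals (f e) τ)
  evalsᵗ τ (mkTermMap σ p) = mkTermMap (subTs σ τ) λ e → ≡.trans (evals-subTs (flat e) σ τ) (cong (λ a → evals a τ) (p e))

  select : {Ξ Ξ′ : Context} → All (_∈ Ξ) Ξ′ → Env Ξ → Env Ξ′
  select xs e = All.map (All.lookup e) xs

  selectᵗ : {Ξ Ξ′ : Context} (xs : All (_∈ Ξ) Ξ′) → TermMap (λ e → flat (select xs e))
  selectᵗ []       = mkTermMap [] λ _ → refl
  selectᵗ (x ∷ xs) = block x ⧺ᵗ selectᵗ xs

  everything : {Ξ : Context} → All (_∈ Ξ) Ξ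
  everything = All.tabulate id

  shifted : {Ξ : Context} {Γ : List Sort} → All (_∈ Γ ∷ Ξ) Ξ
  shifted = All.tabulate there

  select-tabulate : {Ξ Ξ′ : Context} (ρ : ∀ {Γ} → Γ ∈ Ξ′ → Γ ∈ Ξ) (e : Env Ξ) (e′ : Env Ξ′) →
                    (∀ {Γ} (x : Γ ∈ Ξ′) → All.lookup e (ρ x) ≡ All.lookup e′ x) →
                    select (All.tabulate ρ) e ≡ e′
  select-tabulate ρ e []       h = refl
  select-tabulate ρ e (t ∷ e′) h = cong₂ _∷_ (h (here refl)) (select-tabulate (ρ ∘ there) e e′ (h ∘ there))

  select-shifted : {Ξ : Context} {Γ : List Sort} (t : Tuple Γ) (e : Env Ξ) → select shifted (t ∷ e) ≡ e
  select-shifted t e = select-tabulate there (t ∷ e) e (λ _ → refl)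

  _In_ : {Γ : List Sort} → Tuple Γ → ParamSet → Set ℓ
  _In_ {Γ} c C = ∀ {s} (x : s ∈ Γ) → C s (All.lookup c x)

  -- P is definable over C; the parameters form the first block of the formula.
  record Def (C : ParamSet) {Ξ : Context} (P : Env Ξ → Set ℓ) : Set ℓ where
    constructor mkDef
    field
      {Δ}      : List Sort
      params   : Tuple Δ
      params∈  : params In C
      formula  : Formula L (concat (Δ ∷ Ξ))
      correct  : ∀ e → P e ⇔ (flat (params ∷ e) ⊨ formula)

  private
    Reindexed : {Ξ : Context} {Θ : List Sort} → (Env Ξ → Tuple Θ) → Formula L Θ → Set ℓ
    Reindexed {Ξ} f φ = Σ[ ψ ∈ Formula L (concat Ξ) ] (∀ e a → f e ≡ a → (a ⊨ φ) ⇔ (flat e ⊨ ψ))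

    reindex : {Ξ : Context} {Θ : List Sort} {f : Env Ξ → Tuple Θ} → TermMap f → (φ : Formula L Θ) → Reindexed f φ
    reindex (mkTermMap σ p) φ = subF σ φ , λ e a eq →
      mk⇔ (from (⊨-subF (flat e) σ φ) ∘ subst (_⊨ φ) (≡.sym (≡.trans (p e) eq)))
          (subst (_⊨ φ) (≡.trans (p e) eq) ∘ to (⊨-subF (flat e) σ φ))

    leftPart : {Γ Δ : List Sort} → Tuple (Γ ++ Δ) → Tuple Γ
    leftPart {Γ} = ++⁻ˡ Γ

    rightPart : {Γ Δ : List Sort} → Tuple (Γ ++ Δ) → Tuple Δ
    rightPart {Γ} = ++⁻ʳ Γ

    leftPart-⧺ : {Γ Δ : List Sort} (a : Tuple Γ) (b : Tuple Δ) → leftPart (a ⧺ b) ≡ a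
    leftPart-⧺ []      b = refl
    leftPart-⧺ (_ ∷ a) b = cong (_ ∷_) (leftPart-⧺ a b)

    rightPart-⧺ : {Γ Δ : List Sort} (a : Tuple Γ) (b : Tuple Δ) → rightPart {Γ} (a ⧺ b) ≡ b
    rightPart-⧺ []      b = refl
    rightPart-⧺ (_ ∷ a) b = rightPart-⧺ a b

    evals-++⁻ˡ : {Γ Δ Θ : List Sort} (a : Tuple Θ) (σ : All (Term L Θ) (Γ ++ Δ)) →
                 evals a (++⁻ˡ Γ σ) ≡ leftPart (evals a σ)
    evals-++⁻ˡ {[]}    a σ       = refl
    evals-++⁻ˡ {_ ∷ _} a (t ∷ σ) = cong (_ ∷_) (evals-++⁻ˡ a σ)

    evals-++⁻ʳ : {Γ Δ Θ : List Sort} (a : Tuple Θ) (σ : All (Term L Θ) (Γ ++ Δ)) →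
                 evals a (++⁻ʳ Γ σ) ≡ rightPart {Γ} (evals a σ)
    evals-++⁻ʳ {[]}    a σ       = refl
    evals-++⁻ʳ {_ ∷ _} a (t ∷ σ) = evals-++⁻ʳ a σ

    leftᵗ : {Ξ : Context} {Γ Δ : List Sort} {f : Env Ξ → Tuple (Γ ++ Δ)} →
            TermMap f → TermMap (λ e → leftPart (f e))
    leftᵗ {Γ = Γ} (mkTermMap σ p) = mkTermMap (++⁻ˡ Γ σ) λ e → ≡.trans (evals-++⁻ˡ (flat e) σ) (cong leftPart (p e))

    rightᵗ : {Ξ : Context} {Γ Δ : List Sort} {f : Env Ξ → Tuple (Γ ++ Δ)} →
             TermMap f → TermMap (λ e → rightPart {Γ} (f e))
    rightᵗ {Γ = Γ} (mkTermMap σ p) = mkTermMap (++⁻ʳ Γ σ) λ e → ≡.trans (evals-++⁻ʳ {Γ} (flat e) σ) (cong (rightPart {Γ}) (p e))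

  module _ {C : ParamSet} where
   abstract

      def-⇔ : {Ξ : Context} {P Q : Env Ξ → Set ℓ} → (∀ e → P e ⇔ Q e) → Def C P → Def C Q
      def-⇔ h (mkDef c c∈ φ ok) = mkDef c c∈ φ λ e → mk⇔ (to (ok e) ∘ from (h e)) (to (h e) ∘ from (ok e))

      -- The combinators produce predicates that read an environment through lookups. Once the
      -- environment is matched, these reduce to the intended relation and the two sides agree by
      -- `refl`.
      def-≡ : {Ξ : Context} {P Q : Env Ξ → Set ℓ} → Def C P → (∀ e → P e ≡ Q e) → Def C Q
      def-≡ d h = def-⇔ (λ e → ≡⇒⇔ (h e)) d

      def-resp : {Ξ : Context} {P : Env Ξ → Set ℓ} → Def C P → {e e′ : Env Ξ} → e ≋ᵉ e′ → P e → P e′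
      def-resp (mkDef c c∈ φ ok) {e} {e′} eq h =
        from (ok e′) (⊨-cong (pw-++ universe (Setoid.refl (tuples _) {c}) (flat-cong eq)) φ (to (ok e) h))

      def-atom : {Ξ : Context} {Δ Θ : List Sort} (c : Tuple Δ) → c In C → (φ : Formula L Θ) →
                 {f : Env (Δ ∷ Ξ) → Tuple Θ} → TermMap f → Def C {Ξ} (λ e → f (c ∷ e) ⊨ φ)
      def-atom c c∈ φ (mkTermMap σ p) = mkDef c c∈ (subF σ φ) λ e → mk⇔
        (λ h → from (⊨-subF (flat (c ∷ e)) σ φ) (subst (_⊨ φ) (≡.sym (p (c ∷ e))) h))
        (λ h → subst (_⊨ φ) (p (c ∷ e)) (to (⊨-subF (flat (c ∷ e)) σ φ) h))

      def-select : {Ξ Ξ′ : Context} {P : Env Ξ′ → Set ℓ} → Def C P → (xs : All (_∈ Ξ) Ξ′) →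
                   Def C (λ e → P (select xs e))
      def-select {Ξ} {Ξ′} {P} (mkDef {Δ} c c∈ φ ok) xs =
        def-⇔ (λ e → mk⇔ (from (ok (select xs e)) ∘ subst (λ a → (c ⧺ flat a) ⊨ φ) (eq e))
                         (subst (λ a → (c ⧺ flat a) ⊨ φ) (≡.sym (eq e)) ∘ to (ok (select xs e))))
          (def-atom c c∈ φ (selectᵗ (here refl ∷ All.map there xs)))
        where
        eq : ∀ e → select (All.map there xs) (c ∷ e) ≡ select xs e
        eq e = go xs
          where
          go : ∀ {Ξ″} (ys : All (_∈ Ξ) Ξ″) → select (All.map there ys) (c ∷ e) ≡ select ys e
          go []       = refl
          go (y ∷ ys) = cong (_ ∷_) (go ys)

      -- The tuple `t` joins the parameter block, and the formula reads its former variable block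
      -- off the right part of the enlarged parameters.
      def-parameter : {Ξ : Context} {Γ : List Sort} {P : Env (Γ ∷ Ξ) → Set ℓ} → Def C P →
                      (t : Tuple Γ) → t In C → Def C (λ e → P (t ∷ e))
      def-parameter {Ξ} {Γ} {P} (mkDef {Δ} c c∈ φ ok) t t∈ =
        mkDef (c ⧺ t) (lookup-⧺-elim c t C c∈ t∈) (proj₁ r) λ e →
          let eq = cong₂ _⧺_ (leftPart-⧺ c t) (cong₂ _⧺_ (rightPart-⧺ c t) (cong flat (select-shifted (c ⧺ t) e)))
              sem = proj₂ r ((c ⧺ t) ∷ e) (c ⧺ t ⧺ flat e) eq
          in mk⇔ (to sem ∘ to (ok (t ∷ e))) (from (ok (t ∷ e)) ∘ from sem)
        where
        r : Reindexed {(Δ ++ Γ) ∷ Ξ}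
          (λ e → leftPart {Δ} (All.lookup e (here refl)) ⧺ rightPart {Δ} (All.lookup e (here refl)) ⧺ flat (select shifted e)) φ
        r = reindex (leftᵗ {Γ = Δ} (block (here refl)) ⧺ᵗ rightᵗ {Γ = Δ} (block (here refl)) ⧺ᵗ selectᵗ shifted) φ

      def-¬ : {Ξ : Context} {P : Env Ξ → Set ℓ} → Def C P → Def C (λ e → ¬ P e)
      def-¬ (mkDef c c∈ φ ok) = mkDef c c∈ (¬′ φ) λ e → mk⇔ (λ h k → h (from (ok e) k)) (λ h k → h (to (ok e) k))

      infixr 6 _def-∧_
      _def-∧_ : {Ξ : Context} {P Q : Env Ξ → Set ℓ} → Def C P → Def C Q → Def C (λ e → P e × Q e)
      _def-∧_ {Ξ} (mkDef {Δ} c c∈ φ ok) (mkDef {Δ′} d d∈ ψ ok′) =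
        mkDef (c ⧺ d) (lookup-⧺-elim c d C c∈ d∈) (proj₁ r ∧′ proj₁ r′) λ e →
          let tail = cong flat (select-shifted (c ⧺ d) e)
              sem  = proj₂ r ((c ⧺ d) ∷ e) (c ⧺ flat e) (cong₂ _⧺_ (leftPart-⧺ c d) tail)
              sem′ = proj₂ r′ ((c ⧺ d) ∷ e) (d ⧺ flat e) (cong₂ _⧺_ (rightPart-⧺ c d) tail)
          in mk⇔ (λ (p , q) → to sem (to (ok e) p) , to sem′ (to (ok′ e) q))
                 (λ (p , q) → from (ok e) (from sem p) , from (ok′ e) (from sem′ q))
        where
        r : Reindexed {(Δ ++ Δ′) ∷ Ξ} (λ e → leftPart {Δ} (All.lookup e (here refl)) ⧺ flat (select shifted e)) φ
        r  = reindex (leftᵗ {Γ = Δ} (block (here refl)) ⧺ᵗ selectᵗ shifted) φ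
        r′ : Reindexed {(Δ ++ Δ′) ∷ Ξ} (λ e → rightPart {Δ} (All.lookup e (here refl)) ⧺ flat (select shifted e)) ψ
        r′ = reindex (rightᵗ {Γ = Δ} (block (here refl)) ⧺ᵗ selectᵗ shifted) ψ

      -- Quantification removes the leading block, while the formula of a `Def` begins with its
      -- parameters; so these two blocks are exchanged first.
      def-∃ : {Ξ : Context} {Γ : List Sort} {P : Env (Γ ∷ Ξ) → Set ℓ} → Def C P →
              Def C (λ e → Σ[ t ∈ Tuple Γ ] P (t ∷ e))
      def-∃ {Ξ} {Γ} {P} (mkDef {Δ} c c∈ φ ok) = mkDef c c∈ (∃ᵇ Γ (proj₁ r)) λ e → mk⇔
        (λ (t , h) → from (⊨-∃ᵇ Γ (proj₁ r) (c ⧺ flat e)) (t , to (sem e t) (to (ok (t ∷ e)) h)))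
        (λ h → let (t , k) = to (⊨-∃ᵇ Γ (proj₁ r) (c ⧺ flat e)) h in t , from (ok (t ∷ e)) (from (sem e t) k))
        where
        skip₂ : {Θ : List Sort} → Θ ∈ Ξ → Θ ∈ Γ ∷ Δ ∷ Ξ
        skip₂ x = there (there x)
        r : Reindexed {Γ ∷ Δ ∷ Ξ}
          (λ e → All.lookup e (there (here refl)) ⧺ All.lookup e (here refl) ⧺ flat (select (All.tabulate skip₂) e)) φ
        r = reindex (block (there (here refl)) ⧺ᵗ block (here refl) ⧺ᵗ selectᵗ (All.tabulate skip₂)) φ
        sem : ∀ e t → (flat {Δ ∷ Γ ∷ Ξ} (c ∷ t ∷ e) ⊨ φ) ⇔ (flat {Γ ∷ Δ ∷ Ξ} (t ∷ c ∷ e) ⊨ proj₁ r)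
        sem e t = proj₂ r (t ∷ c ∷ e) (c ⧺ t ⧺ flat e) (cong (λ x → c ⧺ t ⧺ flat x)
          (select-tabulate skip₂ (t ∷ c ∷ e) e (λ _ → refl)))

      private
        ⊤ᶠ : {Θ : List Sort} → Formula L Θ
        -- The negation of a contradiction, true whatever the truth value of `⊥ᶠ`.
        ⊤ᶠ = ¬′ (⊥ᶠ ∧′ (¬′ ⊥ᶠ))
            where
          ⊥ᶠ : {Θ : List Sort} → Formula L Θ
          ⊥ᶠ = ∃′ s₀ (var (here refl) ≐ var (here refl))

        _≐ᶠ_ : {Γ Θ : List Sort} → All (Term L Θ) Γ → All (Term L Θ) Γ → Formula L Θ
        []      ≐ᶠ []      = ⊤ᶠ
        (t ∷ σ) ≐ᶠ (u ∷ τ) = (t ≐ u) ∧′ (σ ≐ᶠ τ)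

        ⊨-≐ᶠ : {Γ Θ : List Sort} (a : Tuple Θ) (σ τ : All (Term L Θ) Γ) →
               (evals a σ ≋ evals a τ) ⇔ (a ⊨ σ ≐ᶠ τ)
        ⊨-≐ᶠ a []      []      = mk⇔ (λ _ (h , k) → k h) (λ _ → tt)
        ⊨-≐ᶠ a (t ∷ σ) (u ∷ τ) = mk⇔ (λ (p , q) → p , to (⊨-≐ᶠ a σ τ) q) (λ (p , q) → p , from (⊨-≐ᶠ a σ τ) q)

      def-≋ : {Ξ : Context} {Γ : List Sort} {f g : Env Ξ → Tuple Γ} → TermMap f → TermMap g →
              Def C (λ e → f e ≋ g e)
      def-≋ (mkTermMap σ p) (mkTermMap τ q) = mkDef [] (λ ()) (σ ≐ᶠ τ) λ e → mk⇔
        (λ h → to (⊨-≐ᶠ (flat e) σ τ) (≡.subst₂ _≋_ (≡.sym (p e)) (≡.sym (q e)) h))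
        (λ h → ≡.subst₂ _≋_ (p e) (q e) (from (⊨-≐ᶠ (flat e) σ τ) h))

      def-⊤ : {Ξ : Context} → Def C {Ξ} (λ _ → ⊤)
      def-⊤ = mkDef [] (λ ()) ⊤ᶠ λ e → mk⇔ (λ _ (h , k) → k h) (λ _ → tt)

      def-⟦⟧ : {Ξ : Context} {Γ : List Sort} (D : Definable Γ) → Over C D → {f : Env Ξ → Tuple Γ} →
               TermMap f → Def C (λ e → ⟦ D ⟧ (f e))
      def-⟦⟧ {Ξ} D over {f} (mkTermMap σ p) = def-⇔
        (λ e → ≡⇒⇔ (cong (λ a → (a ⧺ D.params) ⊨ D.formula)
          (≡.trans (cong (λ e′ → evals (flat e′) σ) (select-shifted D.params e)) (p e))))
        (def-atom D.params over D.formula (evalsᵗ σ (selectᵗ shifted) ⧺ᵗ block (here refl)))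
        where module D = Definable D

  ↓₁ : {Γ : List Sort} → (Tuple Γ → Set ℓ) → Env (Γ ∷ []) → Set ℓ
  ↓₁ P (x ∷ []) = P x

  ↓₂ : {Γ Δ : List Sort} → (Tuple Γ → Tuple Δ → Set ℓ) → Env (Γ ∷ Δ ∷ []) → Set ℓ
  ↓₂ P (x ∷ y ∷ []) = P x y

  ↓₃ : {Γ Δ Θ : List Sort} → (Tuple Γ → Tuple Δ → Tuple Θ → Set ℓ) → Env (Γ ∷ Δ ∷ Θ ∷ []) → Set ℓ
  ↓₃ P (x ∷ y ∷ z ∷ []) = P x y z

  abstract
    def⇒definable : {C : ParamSet} {Γ : List Sort} {P : Tuple Γ → Set ℓ} → Def C (↓₁ P) → DefinableOver C P
    def⇒definable {C} {Γ} {P} (mkDef {Δ} c c∈ φ ok) =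
      record { formula = proj₁ r ; params = c ⧺ [] } , lookup-⧺-elim c [] C c∈ (λ ()) ,
      λ a → mk⇔ (to (proj₂ r (a ∷ c ∷ []) (c ⧺ a ⧺ []) refl) ∘ to (ok (a ∷ [])))
                (from (ok (a ∷ [])) ∘ from (proj₂ r (a ∷ c ∷ []) (c ⧺ a ⧺ []) refl))
      where
      r : Reindexed {Γ ∷ Δ ∷ []} (λ e → All.lookup e (there (here refl)) ⧺ All.lookup e (here refl) ⧺ []) φ
      r = reindex (selectᵗ (there (here refl) ∷ here refl ∷ [])) φ

  -- A first-order rendering of "at most `k` elements" for a fixed numeral `k`: some `k` deletions
  -- leave nothing. The deleted tuples need be neither distinct nor in `P`.
  CountedBy : {Γ : List Sort} → ℕ → (Tuple Γ → Set ℓ) → Set ℓ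
  CountedBy zero    P = ¬ ∃ P
  CountedBy (suc k) P = Σ[ c ∈ Tuple _ ] CountedBy k (λ x → P x × ¬ x ≋ c)

  module _ {Γ : List Sort} where
    open Card em (tuples Γ)

    countedBy⇒atMost : (k : ℕ) {P : Tuple Γ → Set ℓ} → CountedBy k P → AtMost k P
    countedBy⇒atMost zero    none    = [] , z≤n , λ x Px → ⊥-elim (none (x , Px))
    countedBy⇒atMost (suc k) {P} (c , h) with countedBy⇒atMost k h
    ... | xs , l , cover = c ∷ xs , s≤s l , cover′
      where
      cover′ : Covers (c ∷ xs) P
      cover′ x Px with em {P = x ≋ c}
      ... | yes x≋c = here x≋c
      ... | no  x≉c = there (cover x (Px , x≉c))

    covers⇒countedBy : (xs : List (Tuple Γ)) {P : Tuple Γ → Set ℓ} → Covers xs P → CountedBy (length xs) P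
    covers⇒countedBy []       cover (x , Px) with cover x Px
    ... | ()
    covers⇒countedBy (c ∷ xs) cover = c , covers⇒countedBy xs λ x (Px , x≉c) → tail (cover x Px) x≉c
      where
      tail : ∀ {x} → x ∈ˢ c ∷ xs → ¬ x ≋ c → x ∈ˢ xs
      tail (here eq) neq = ⊥-elim (neq eq)
      tail (there h) _   = h

    finite⇒countedBy : {P : Tuple Γ → Set ℓ} → Finite P → Σ[ k ∈ ℕ ] CountedBy k P
    finite⇒countedBy (_ , xs , _ , cover) = length xs , covers⇒countedBy xs cover

  abstract
    def-countedBy : {C : ParamSet} {Ξ : Context} {Γ : List Sort} (k : ℕ) {P : Env (Γ ∷ Ξ) → Set ℓ} →
                    Def C P → Def C (λ e → CountedBy k (λ t → P (t ∷ e)))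
    def-countedBy zero    d = def-¬ (def-∃ d)
    def-countedBy {Ξ = Ξ} {Γ} (suc k) {P} d = def-∃ {P = λ { (c ∷ e) → CountedBy k (λ t → P (t ∷ e) × ¬ t ≋ c) }}
     (def-≡ (def-countedBy k {P′}
        (def-≡ (def-select d xs def-∧ def-¬ (def-≋ (block (here refl)) (block (there (here refl)))))
          λ { (t ∷ c ∷ e) → cong (λ e′ → P (t ∷ e′) × ¬ t ≋ c)
                (select-tabulate (λ x → there (there x)) (t ∷ c ∷ e) e (λ _ → refl)) }))
      λ { (c ∷ e) → refl })
      where
      P′ : Env (Γ ∷ Γ ∷ Ξ) → Set ℓ
      P′ (t ∷ c ∷ e) = P (t ∷ e) × ¬ t ≋ c
      xs : All (_∈ Γ ∷ Γ ∷ Ξ) (Γ ∷ Ξ)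
      xs = here refl ∷ All.tabulate (λ x → there (there x))

  -- Intersecting with its own size condition makes a family uniformly bounded: a fibre that
  -- violates the condition becomes empty.
  atMost-countedBy : {Γ : List Sort} (k : ℕ) (Q : Tuple Γ → Set ℓ) →
                     Size.AtMost (tuples Γ) k (λ x → Q x × CountedBy k Q)
  atMost-countedBy {Γ} k Q with em {P = CountedBy k Q}
  ... | yes h = Card.atMost-⊆ em (tuples Γ) (λ _ → proj₁) (countedBy⇒atMost k h)
  ... | no ¬h = [] , z≤n , λ x (_ , h) → ⊥-elim (¬h h)

-- Algebraicity as a bounded definable relation.

module Algebraicity (em : Classical) {ℓ : Level} {L : Language ℓ} (M : Structure L)
                    (s₀ : Language.Sort L) where
  open Language L
  open Structure M
  open Semantics M
  open Logic M
  open Definability M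
  open DefinableRelations em M s₀

  -- The entries of `g` have become variables, and the bound `k` holds over every `u`, not only over
  -- `g`. In this form algebraicity can be applied at many group elements at once.
  record Algebraic (C : ParamSet) {Γ Δ : List Sort} (a : Tuple Γ) (g : Tuple Δ) : Set (Level.suc ℓ) where
    field
      R       : Tuple Γ → Tuple Δ → Set ℓ
      R-def   : Def C (↓₂ R)
      R-holds : R a g
      k       : ℕ
      bound   : ∀ u → Size.AtMost (tuples Γ) k (λ x → R x u)

  private
    -- A parameter in `C` is kept; one that equals an entry of `g` becomes a variable. Since
    -- `entries` is meant up to the equality of the structure, the parameters are recovered only up
    -- to `≋`.
    separateParameters : (C : ParamSet) {Γ : List Sort} (g : Tuple Γ) {Δ : List Sort} (p : Tuple Δ) →
      p In (entries g ∪ C) →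
      Σ[ Δ′ ∈ List Sort ] Σ[ c ∈ Tuple Δ′ ] ((c In C) ×
        Σ[ σ ∈ All (Term L (concat (Δ′ ∷ Γ ∷ []))) Δ ] (evals (flat (c ∷ g ∷ [])) σ ≋ p))
    separateParameters C g []      p∈ = [] , [] , (λ ()) , [] , tt
    separateParameters C {Γ} g (e ∷ p) p∈ with separateParameters C g p (p∈ ∘ there) | p∈ (here refl)
    ... | Δ′ , c , c∈ , σ , eq | inj₁ (x , gx≈e) =
      Δ′ , c , c∈ , All.lookup (TermMap.terms b) x ∷ σ ,
      subst (λ d → Setoid._≈_ (universe _) d e)
        (≡.sym (≡.trans (lookup-evals _ (TermMap.terms b) x) (cong (λ a → All.lookup a x) (TermMap.value b (c ∷ g ∷ []))))) gx≈e , eq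
      where b = block {Ξ = Δ′ ∷ Γ ∷ []} (there (here refl))
    ... | Δ′ , c , c∈ , σ , eq | inj₂ Ce =
      _ ∷ Δ′ , e ∷ c , (λ { (here refl) → Ce ; (there x) → c∈ x }) ,
      var (here refl) ∷ subTs weaken σ ,
      Setoid.refl (universe _) ,
      subst (_≋ p) (≡.sym (≡.trans (evals-subTs (e ∷ flat (c ∷ g ∷ [])) weaken σ)
        (cong (λ a → evals a σ) (evals-vars there _ (flat (c ∷ g ∷ [])) (λ _ → refl))))) eq

  acl⇒algebraic : (C : ParamSet) {Δ : List Sort} (g : Tuple Δ) {s : Sort} (e : ∣ s ∣) →
                  acl (entries g ∪ C) s e → Algebraic C (e ∷ []) g
  acl⇒algebraic C {Δ} g {s} e (D , over , e∈D , fin)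
    with separateParameters C g (Definable.params D) over
  ... | Δ′ , c , c∈ , σ , eq = record
    { R       = R′
    ; R-def   = R′-def
    ; R-holds = to (R₀⇔D (e ∷ [])) e∈D , proj₂ counted
    ; k       = k
    ; bound   = bound
    }
    where
    open Card em (tuples (s ∷ []))
    R₀ : Tuple (s ∷ []) → Tuple Δ → Set ℓ
    R₀ x u = x ⧺ evals (flat (c ∷ u ∷ [])) σ ⊨ Definable.formula D
    R₀-def : Def C (↓₂ R₀)
    R₀-def = def-≡ (def-atom {Ξ = (s ∷ []) ∷ Δ ∷ []} c c∈ (Definable.formula D)
      (block (there (here refl)) ⧺ᵗ evalsᵗ σ (selectᵗ (here refl ∷ there (there (here refl)) ∷ []))))
      λ { (x ∷ u ∷ []) → refl }
    R₀⇔D : ∀ x → ⟦ D ⟧ x ⇔ R₀ x g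
    R₀⇔D x = mk⇔
      (⊨-cong (pw-++ universe (Setoid.refl (tuples _) {x}) (Setoid.sym (tuples _) eq)) (Definable.formula D))
      (⊨-cong (pw-++ universe (Setoid.refl (tuples _) {x}) eq) (Definable.formula D))
    counted : Σ[ k ∈ ℕ ] CountedBy k (λ x → R₀ x g)
    counted = finite⇒countedBy (finite-⊆ (λ x → from (R₀⇔D x)) fin)
    k = proj₁ counted
    -- `R₀` has at most `k` solutions at `g`, but may have infinitely many elsewhere. The second
    -- conjunct empties those fibres and still holds at `g`.
    R′ : Tuple (s ∷ []) → Tuple Δ → Set ℓ
    R′ x u = R₀ x u × CountedBy k (λ x′ → R₀ x′ u)
    R′-def : Def C (↓₂ R′)
    R′-def = def-≡ (R₀-def def-∧ def-select (def-countedBy k R₀-def) (there (here refl) ∷ []))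
      λ { (x ∷ u ∷ []) → refl }
    bound : ∀ u → AtMost k (λ x → R′ x u)
    bound u with em {P = CountedBy k (λ x → R₀ x u)}
    ... | yes h = atMost-⊆ (λ x → proj₁) (countedBy⇒atMost k h)
    ... | no ¬h = [] , z≤n , λ x (_ , h) → ⊥-elim (¬h h)

  -- Coordinate by coordinate; the fibre bounds multiply.
  ⊆acl⇒algebraic : (C : ParamSet) {Γ Δ : List Sort} (g : Tuple Δ) (a : Tuple Γ) →
                   a ⊆acl (entries g ∪ C) → Algebraic C a g
  ⊆acl⇒algebraic C g [] h = record
    { R = λ _ _ → ⊤ ; R-def = def-≡ def-⊤ (λ { (_ ∷ _ ∷ []) → refl }) ; R-holds = tt ; k = 1
    ; bound = λ u → [] ∷ [] , s≤s z≤n , λ { [] _ → here tt } }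
  ⊆acl⇒algebraic C {s ∷ Γ} {Δ} g (e ∷ a) h = record
    { R       = R
    ; R-def   = R-def
    ; R-holds = e ∷ [] , E.R-holds , a , A.R-holds , Setoid.refl (tuples (s ∷ Γ)) {e ∷ a}
    ; k       = E.k * (A.k * 1)
    ; bound   = λ u →
        CardBind.atMost-bind em (tuples (s ∷ [])) (tuples (s ∷ Γ))
          (λ x y≋y′ (ys , h , eq) → ys , h ,
            Setoid.trans (tuples (s ∷ Γ)) {x} eq (pw-++ universe y≋y′ (Setoid.refl (tuples Γ) {ys}))) (E.bound u)
          λ y → CardBind.atMost-bind em (tuples Γ) (tuples (s ∷ Γ))
            (λ x ys≋ys′ eq → Setoid.trans (tuples (s ∷ Γ)) {x} eq (pw-++ universe (Setoid.refl (tuples (s ∷ [])) {y}) ys≋ys′))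
            (A.bound u) λ ys → Card.atMost1 em (tuples (s ∷ Γ)) (y ⧺ ys)
    }
    where
    module E = Algebraic (acl⇒algebraic C g e (h (here refl)))
    module A = Algebraic (⊆acl⇒algebraic C g a (h ∘ there))
    R : Tuple (s ∷ Γ) → Tuple Δ → Set ℓ
    R x u = Σ[ y ∈ Tuple (s ∷ []) ] (E.R y u × Σ[ ys ∈ Tuple Γ ] (A.R ys u × x ≋ y ⧺ ys))
    R-def : Def C (↓₂ R)
    R-def = def-≡ (def-∃ (def-select E.R-def (y₁ ∷ u₁ ∷ []) def-∧
                   def-∃ (def-select A.R-def (here refl ∷ there u₁ ∷ []) def-∧
                     def-≋ (block (there (there (here refl)))) (block (there y₁) ⧺ᵗ block (here refl)))))
      λ { (x ∷ u ∷ []) → refl }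
      where
      y₁ : (s ∷ []) ∈ (s ∷ []) ∷ (s ∷ Γ) ∷ Δ ∷ []
      y₁ = here refl
      u₁ : Δ ∈ (s ∷ []) ∷ (s ∷ Γ) ∷ Δ ∷ []
      u₁ = there (there (here refl))

-- Ranks 1 and 2, and minimal sets.

module Rank (em : Classical) {ℓ : Level} {L : Language ℓ} (M : Structure L)
            (s₀ : Language.Sort L) where
  open Language L
  open Structure M
  open Semantics M
  open Logic M
  open Definability M
  open DefinableRelations em M s₀
  open Classically em

  allParameters : ParamSet
  allParameters _ _ = ⊤

  def-⟦⟧₁ : {Γ : List Sort} (D : Definable Γ) → Def allParameters {Γ ∷ []} (λ e → ⟦ D ⟧ (All.lookup e (here refl)))
  def-⟦⟧₁ D = def-⟦⟧ D (λ _ → tt) (block (here refl))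

  def-weaken : {C : ParamSet} {Ξ : Context} {P : Env Ξ → Set ℓ} → Def C P → Def allParameters P
  def-weaken (mkDef c c∈ φ ok) = mkDef c (λ _ → tt) φ ok

  module _ {Γ : List Sort} where
    open Card em (tuples Γ)

    RM≥1⇒infinite : (D : Definable Γ) → RM≥ 1 D → Infinite ⟦ D ⟧
    RM≥1⇒infinite D (E , (E⊑D , disjoint) , nonempty) =
      infinite-fromSequence (proj₁ ∘ nonempty) (λ i → E⊑D i _ (proj₂ (nonempty i))) λ i j eq →
        byContradiction λ i≢j → disjoint i j i≢j _ (⟦⟧-resp (E i) eq (proj₂ (nonempty i))) (proj₂ (nonempty j))

    -- The singletons of an enumeration serve as the disjoint family.
    infinite⇒RM≥1 : (D : Definable Γ) → Infinite ⟦ D ⟧ → RM≥ 1 D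
    infinite⇒RM≥1 D inf =
      singleton ∘ point ,
      ((λ i a h → ⟦⟧-resp D (≋-sym {a = a} (from (spec (point i) a) h)) (enumerate-∈ inf i)) ,
       λ i j i≢j a h k → i≢j (enumerate-injective inf i j
         (≋-trans {a = point i} (≋-sym {a = a} (from (spec (point i) a) h)) (from (spec (point j) a) k)))) ,
      λ i → point i , to (spec (point i) (point i)) (≋-refl (point i))
      where
      point = enumerate inf
      singleton-def : (c : Tuple Γ) → Def allParameters (↓₁ (λ a → a ≋ c))
      singleton-def c = def-≡ (def-parameter (def-≋ (block (there (here refl))) (block (here refl))) c (λ _ → tt))
        λ { (a ∷ []) → refl }
      singleton : Tuple Γ → Definable Γ
      singleton c = proj₁ (def⇒definable (singleton-def c))
      spec : ∀ c a → (a ≋ c) ⇔ ⟦ singleton c ⟧ a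
      spec c = proj₂ (proj₂ (def⇒definable (singleton-def c)))

    -- If a definable subset and its complement in `D` were both infinite, both would have rank at
    -- least 1 and `D` would split in two.
    minimal : (D : Definable Γ) → HasRMDegree D 1 1 → Minimal D
    minimal D ((rm≥1 , _) , _ , ¬splits) = RM≥1⇒infinite D rm≥1 , dichotomy
      where
      dichotomy : ∀ E → E ⊑ D → Finite ⟦ E ⟧ ⊎ Finite (λ a → ⟦ D ⟧ a × ¬ ⟦ E ⟧ a)
      dichotomy E E⊑D with em {P = Finite ⟦ E ⟧} | em {P = Finite (λ a → ⟦ D ⟧ a × ¬ ⟦ E ⟧ a)}
      ... | yes fin | _       = inj₁ fin
      ... | no _    | yes fin = inj₂ fin
      ... | no inf  | no inf′ = ⊥-elim (¬splits (parts , (parts⊑ , parts-disjoint) , parts-rank))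
        where
        complement-def : DefinableOver allParameters (λ a → ⟦ D ⟧ a × ¬ ⟦ E ⟧ a)
        complement-def = def⇒definable (def-≡ (def-⟦⟧₁ D def-∧ def-¬ (def-⟦⟧₁ E)) λ { (a ∷ []) → refl })
        E′ = proj₁ complement-def
        E′-spec = proj₂ (proj₂ complement-def)
        parts : Fin 2 → Definable Γ
        parts zero       = E
        parts (suc zero) = E′
        parts⊑ : ∀ i → parts i ⊑ D
        parts⊑ zero       = E⊑D
        parts⊑ (suc zero) = λ a h → proj₁ (from (E′-spec a) h)
        parts-disjoint : ∀ i j → i ≢ j → Disjoint (parts i) (parts j)
        parts-disjoint zero       zero       i≢j = ⊥-elim (i≢j refl)
        parts-disjoint zero       (suc zero) _   = λ a h k → proj₂ (from (E′-spec a) k) h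
        parts-disjoint (suc zero) zero       _   = λ a h k → proj₂ (from (E′-spec a) h) k
        parts-disjoint (suc zero) (suc zero) i≢j = ⊥-elim (i≢j refl)
        parts-rank : ∀ i → RM≥ 1 (parts i)
        parts-rank zero       = infinite⇒RM≥1 E inf
        parts-rank (suc zero) = infinite⇒RM≥1 E′ (inf′ ∘ finite-⊆ (λ a → to (E′-spec a)))

  -- Given infinitely many disjoint pieces of rank at least 1, each piece is infinite, so its image
  -- under the finite-to-one relation is infinite, hence cofinite in the minimal set `B`. Finitely
  -- many cofinite subsets of `B` meet, so `suc K` of the pieces have a common image point `b`,
  -- whose fibre would contain `suc K` distinct elements.
  finiteToOne⇒¬RM≥2 : {Γ Δ : List Sort} (D : Definable Γ) (B : Definable Δ) → Minimal B →
    (S : Tuple Γ → Tuple Δ → Set ℓ) → Def allParameters (↓₂ S) →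
    (∀ a → ⟦ D ⟧ a → Σ[ b ∈ Tuple Δ ] (⟦ B ⟧ b × S a b)) →
    (K : ℕ) → (∀ b → Size.AtMost (tuples Γ) K (λ a → S a b)) → ¬ RM≥ 2 D
  finiteToOne⇒¬RM≥2 {Γ} {Δ} D B (B-infinite , B-minimal) S S-def related K bound (E , (E⊑D , disjoint) , rm) =
    ℕ.1+n≰n (Γ.pigeonhole {n = suc K} (bound b) (proj₁ ∘ inImage) (λ i → proj₂ (proj₂ (inImage i))) injective)
    where
    module Γ = Card em (tuples Γ)
    module Δ = Card em (tuples Δ)
    Image : ℕ → Tuple Δ → Set ℓ
    Image i b = Σ[ a ∈ Tuple Γ ] (⟦ E i ⟧ a × S a b)
    imageDefinable : ∀ i → DefinableOver allParameters (λ b → ⟦ B ⟧ b × Image i b)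
    imageDefinable i = def⇒definable (def-≡ (def-⟦⟧₁ B def-∧
      def-∃ (def-⟦⟧ (E i) (λ _ → tt) (block (here refl)) def-∧ def-select S-def (here refl ∷ there (here refl) ∷ [])))
      λ { (b ∷ []) → refl })
    S-resp : ∀ {b b′} a → b ≋ b′ → S a b → S a b′
    S-resp {b} {b′} a b≋b′ = def-resp S-def {a ∷ b ∷ []} {a ∷ b′ ∷ []} (Setoid.refl (tuples Γ) {a} , b≋b′ , tt)
    image-infinite : ∀ i → ¬ Δ.Finite (λ b → ⟦ B ⟧ b × Image i b)
    image-infinite i fin = RM≥1⇒infinite (E i) (rm i)
      (Γ.finite-⊆ (λ a a∈E → let (b , b∈B , Sab) = related a (E⊑D i a a∈E) in b , (b∈B , a , a∈E , Sab) , Sab)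
        (CardBind.finite-bind em (tuples Δ) (tuples Γ) S-resp fin (λ b → K , bound b)))
    cofinite : ∀ i → Δ.Finite (λ b → ⟦ B ⟧ b × ¬ Image i b)
    cofinite i with imageDefinable i
    ... | I , _ , spec with B-minimal I (λ b h → proj₁ (from (spec b) h))
    ...   | inj₁ fin = ⊥-elim (image-infinite i (Δ.finite-⊆ (λ b → to (spec b)) fin))
    ...   | inj₂ fin = Δ.finite-⊆ (λ b (b∈B , ¬im) → b∈B , ¬im ∘ proj₂ ∘ from (spec b)) fin
    common = Δ.infinite-∖ B-infinite (finite-fin em (tuples Δ) {suc K} (λ i → cofinite (toℕ i)))
    b = proj₁ common
    inImage : (i : Fin (suc K)) → Image (toℕ i) b
    inImage i = byContradiction λ ¬im → proj₂ (proj₂ common) (i , proj₁ (proj₂ common) , ¬im)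
    injective : ∀ i j → proj₁ (inImage i) ≋ proj₁ (inImage j) → i ≡ j
    injective i j eq = byContradiction λ i≢j → disjoint (toℕ i) (toℕ j) (i≢j ∘ toℕ-injective)
      (proj₁ (inImage j)) (⟦⟧-resp (E (toℕ i)) eq (proj₁ (proj₂ (inImage i)))) (proj₁ (proj₂ (inImage j)))

  -- D meets every slice of the cylinder in a finite set, so F ∖ D still
  -- contains infinitely many infinite slices and has rank 2 as well.
  cylinder⇒splits : {Θ : List Sort} {a b : Level} (F D : Definable Θ) → D ⊑ F → RM≥ 2 D →
    (S : Setoid a ℓ) (T : Setoid b ℓ) {I : Setoid.Carrier S → Set ℓ} {J : Setoid.Carrier T → Set ℓ} →
    Size.Infinite S I → Size.Infinite T J →
    (e : Setoid.Carrier S → Setoid.Carrier T → Tuple Θ) →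
    (∀ x y → I x → J y → ⟦ F ⟧ (e x y)) →
    (∀ {x x′ y} → e x y ≋ e x′ y → Setoid._≈_ S x x′) →
    (slice : Setoid.Carrier T → Definable Θ) →
    (∀ x y → ⟦ slice y ⟧ (e x y)) →
    (∀ {y y′} a → ⟦ slice y ⟧ a → ⟦ slice y′ ⟧ a → Setoid._≈_ T y y′) →
    (∀ y → Size.Finite S (λ x → ⟦ D ⟧ (e x y))) → Splits F 2 2
  cylinder⇒splits {Θ} F D D⊑F rmD S T {I} {J} I-infinite J-infinite e I×J⊆F e-injective slice ∈slice slice-disjoint D-finite =
    parts , (parts⊑ , parts-disjoint) , parts-rank
    where
    module S = Card em S
    module T = Card em T
    restDefinable : DefinableOver allParameters (λ a → ⟦ F ⟧ a × ¬ ⟦ D ⟧ a)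
    restDefinable = def⇒definable (def-≡ (def-⟦⟧₁ F def-∧ def-¬ (def-⟦⟧₁ D)) λ { (a ∷ []) → refl })
    rest = proj₁ restDefinable
    rest-spec = proj₂ (proj₂ restDefinable)
    point = T.enumerate J-infinite
    pieceDefinable : ∀ i → DefinableOver allParameters (λ a → ⟦ rest ⟧ a × ⟦ slice (point i) ⟧ a)
    pieceDefinable i = def⇒definable (def-≡ (def-⟦⟧₁ rest def-∧ def-⟦⟧₁ (slice (point i))) λ { (a ∷ []) → refl })
    piece : ℕ → Definable Θ
    piece i = proj₁ (pieceDefinable i)
    piece-spec : ∀ i a → (⟦ rest ⟧ a × ⟦ slice (point i) ⟧ a) ⇔ ⟦ piece i ⟧ a
    piece-spec i = proj₂ (proj₂ (pieceDefinable i))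
    piece-infinite : ∀ i → Size.Infinite (tuples Θ) ⟦ piece i ⟧
    piece-infinite i = Card.infinite-fromSequence em (tuples Θ) (λ n → e (S.enumerate inf n) (point i))
      (λ n → to (piece-spec i _)
        (to (rest-spec _) (I×J⊆F _ _ (proj₁ (S.enumerate-∈ inf n)) (T.enumerate-∈ J-infinite i) ,
                           proj₂ (S.enumerate-∈ inf n)) ,
         ∈slice _ _))
      (λ m n eq → S.enumerate-injective inf m n (e-injective eq))
      where
      inf : S.Infinite (λ x → I x × ¬ ⟦ D ⟧ (e x (point i)))
      inf = S.infinite-∖-infinite I-infinite (D-finite (point i))
    rest-rank : RM≥ 2 rest
    rest-rank = piece ,
      ((λ i a h → proj₁ (from (piece-spec i a) h)) ,
       λ i j i≢j a h k → i≢j (T.enumerate-injective J-infinite i j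
         (slice-disjoint a (proj₂ (from (piece-spec i a) h)) (proj₂ (from (piece-spec j a) k))))) ,
      λ i → infinite⇒RM≥1 (piece i) (piece-infinite i)
    parts : Fin 2 → Definable Θ
    parts zero       = D
    parts (suc zero) = rest
    parts⊑ : ∀ i → parts i ⊑ F
    parts⊑ zero       = D⊑F
    parts⊑ (suc zero) = λ a h → proj₁ (from (rest-spec a) h)
    parts-disjoint : ∀ i j → i ≢ j → Disjoint (parts i) (parts j)
    parts-disjoint zero       zero       i≢j = ⊥-elim (i≢j refl)
    parts-disjoint zero       (suc zero) _   = λ a h k → proj₂ (from (rest-spec a) k) h
    parts-disjoint (suc zero) zero       _   = λ a h k → proj₂ (from (rest-spec a) h) k
    parts-disjoint (suc zero) (suc zero) i≢j = ⊥-elim (i≢j refl)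
    parts-rank : ∀ i → RM≥ 2 (parts i)
    parts-rank zero       = rmD
    parts-rank (suc zero) = rest-rank

-- Groups whose centralizers and conjugacy classes are finite or cofinite.

module MinimalGroup (em : Classical) {a ℓ : Level} (𝔾 : Group a ℓ) where
  open Group 𝔾 renaming (Carrier to G; refl to ≈-refl)
  open Algebra.Properties.Group 𝔾 using (∙-cancelˡ; ∙-cancelʳ; ⁻¹-involutive)
  private module Mult = Algebra.Properties.Monoid.Mult monoid
  open Card em setoid
  open CardBind em setoid setoid
  open Classically em
  open import Relation.Binary.Reasoning.Setoid setoid
  private module Solver = Algebra.Solver.Monoid monoid
  open Solver using (_⊕_; _⊜_)

  infixr 8 _↑_
  _↑_ : G → ℕ → G
  x ↑ n = n Mult.× x

  ↑-cong : ∀ {x y} n → x ≈ y → x ↑ n ≈ y ↑ n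
  ↑-cong n = Mult.×-congʳ n

  ↑-+ : ∀ x m n → x ↑ (m + n) ≈ x ↑ m ∙ x ↑ n
  ↑-+ = Mult.×-homo-+

  ε↑ : ∀ n → ε ↑ n ≈ ε
  ε↑ zero    = ≈-refl
  ε↑ (suc n) = trans (identityˡ (ε ↑ n)) (ε↑ n)

  Commute : G → G → Set ℓ
  Commute x y = x ∙ y ≈ y ∙ x

  commute-ε : ∀ x → Commute x ε
  commute-ε x = trans (identityʳ x) (sym (identityˡ x))

  commute-∙ : ∀ {x y z} → Commute x y → Commute x z → Commute x (y ∙ z)
  commute-∙ {x} {y} {z} xy xz = begin
    x ∙ (y ∙ z) ≈⟨ assoc x y z ⟨
    (x ∙ y) ∙ z ≈⟨ ∙-congʳ xy ⟩
    (y ∙ x) ∙ z ≈⟨ assoc y x z ⟩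
    y ∙ (x ∙ z) ≈⟨ ∙-congˡ xz ⟩
    y ∙ (z ∙ x) ≈⟨ assoc y z x ⟨
    (y ∙ z) ∙ x ∎

  commute-↑ : ∀ {x y} n → Commute x y → Commute x (y ↑ n)
  commute-↑ {x} zero    xy = commute-ε x
  commute-↑     (suc n) xy = commute-∙ xy (commute-↑ n xy)

  commute-↑-even : ∀ {x y} n → Commute x (y ∙ y) → Commute x (y ↑ (n + n))
  commute-↑-even {x} zero    xyy = commute-ε x
  commute-↑-even {x} {y} (suc n) xyy = subst (λ k → Commute x (y ∙ y ↑ k)) (≡.sym (ℕ.+-suc n n))
    (trans (∙-congˡ (sym (assoc y y _))) (trans (commute-∙ xyy (commute-↑-even n xyy)) (∙-congʳ (assoc y y _))))

  commute-⁻¹ : ∀ {x y} → Commute x y → Commute x (y ⁻¹)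
  commute-⁻¹ {x} {y} xy = ∙-cancelˡ y _ _ (begin
    y ∙ (x ∙ y ⁻¹)   ≈⟨ assoc y x (y ⁻¹) ⟨
    (y ∙ x) ∙ y ⁻¹   ≈⟨ ∙-congʳ xy ⟨
    (x ∙ y) ∙ y ⁻¹   ≈⟨ assoc x y (y ⁻¹) ⟩
    x ∙ (y ∙ y ⁻¹)   ≈⟨ ∙-congˡ (inverseʳ y) ⟩
    x ∙ ε            ≈⟨ commute-ε x ⟩
    ε ∙ x            ≈⟨ ∙-congʳ (inverseʳ y) ⟨
    (y ∙ y ⁻¹) ∙ x   ≈⟨ assoc y (y ⁻¹) x ⟩
    y ∙ (y ⁻¹ ∙ x)   ∎)

  commute-resp : ∀ {x y z} → y ≈ z → Commute x y → Commute x z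
  commute-resp y≈z xy = trans (∙-congˡ (sym y≈z)) (trans xy (∙-congʳ y≈z))

  Central : G → Set (a ⊔ ℓ)
  Central z = ∀ x → Commute x z

  central-∙ : ∀ {y z} → Central y → Central z → Central (y ∙ z)
  central-∙ y z x = commute-∙ (y x) (z x)

  central-⁻¹ : ∀ {z} → Central z → Central (z ⁻¹)
  central-⁻¹ z x = commute-⁻¹ (z x)

  central-↑ : ∀ {z} n → Central z → Central (z ↑ n)
  central-↑ n z x = commute-↑ n (z x)

  central-resp : ∀ {y z} → y ≈ z → Central y → Central z
  central-resp y≈z c x = commute-resp y≈z (c x)

  -- Written without inverses, so that the graph of the product alone expresses it.
  Conjugate : G → G → Set (a ⊔ ℓ)
  Conjugate x y = Σ[ t ∈ G ] t ∙ x ≈ y ∙ t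

  -- The factor 2 is what a progression needs; a finite subgroup satisfies the bound with room to
  -- spare. The order of the latter cannot be prescribed, hence only `N ≤ n`.
  record ApproximateSubgroup (N : ℕ) : Set (a ⊔ ℓ) where
    field
      n         : ℕ
      N≤n       : N ≤ n
      elem      : Fin n → G
      injective : ∀ i j → elem i ≈ elem j → i ≡ j
      doubling  : AtMost (2 * n) (λ g → Σ[ i ∈ Fin n ] Σ[ j ∈ Fin n ] g ≈ elem i ∙ elem j)

  InfiniteOrder : G → Set ℓ
  InfiniteOrder d = ∀ n → 0 < n → ¬ d ↑ n ≈ ε

  progression : ∀ {d} → InfiniteOrder d → ∀ N → ApproximateSubgroup N
  progression {d} inf N = record
    { n         = N
    ; N≤n       = ℕ.≤-refl
    ; elem      = λ i → d ↑ toℕ i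
    ; injective = λ i j eq → toℕ-injective (↑-injective (toℕ i) (toℕ j) eq)
    ; doubling  = atMost-≤ (ℕ.≤-reflexive (ℕ.*-identityʳ (2 * N)))
        (atMost-⊆ inPowers (atMost-fin em setoid {n = 2 * N} (λ i → atMost1 (d ↑ toℕ i))))
    }
    where
    ↑-< : ∀ {m n} → m < n → ¬ d ↑ m ≈ d ↑ n
    ↑-< {m} {n} m<n eq = inf (n ∸ m) (ℕ.m<n⇒0<n∸m m<n) (∙-cancelˡ (d ↑ m) _ _ (begin
      d ↑ m ∙ d ↑ (n ∸ m)  ≈⟨ ↑-+ d m (n ∸ m) ⟨
      d ↑ (m + (n ∸ m))    ≡⟨ cong (d ↑_) (ℕ.m+[n∸m]≡n (ℕ.<⇒≤ m<n)) ⟩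
      d ↑ n                ≈⟨ eq ⟨
      d ↑ m                ≈⟨ identityʳ (d ↑ m) ⟨
      d ↑ m ∙ ε            ∎))
    ↑-injective : ∀ m n → d ↑ m ≈ d ↑ n → m ≡ n
    ↑-injective m n eq with ℕ.<-cmp m n
    ... | tri< m<n _ _ = ⊥-elim (↑-< m<n eq)
    ... | tri≈ _ m≡n _ = m≡n
    ... | tri> _ _ n<m = ⊥-elim (↑-< n<m (sym eq))
    inPowers : ∀ g → (Σ[ i ∈ Fin N ] Σ[ j ∈ Fin N ] g ≈ d ↑ toℕ i ∙ d ↑ toℕ j) → Σ[ k ∈ Fin (2 * N) ] g ≈ d ↑ toℕ k
    inPowers g (i , j , eq) = fromℕ< i+j<2N , (begin
      g                          ≈⟨ eq ⟩
      d ↑ toℕ i ∙ d ↑ toℕ j      ≈⟨ ↑-+ d (toℕ i) (toℕ j) ⟨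
      d ↑ (toℕ i + toℕ j)        ≡⟨ cong (d ↑_) (toℕ-fromℕ< i+j<2N) ⟨
      d ↑ toℕ (fromℕ< i+j<2N)    ∎)
      where
      i+j<2N : toℕ i + toℕ j < 2 * N
      i+j<2N = ℕ.<-≤-trans (ℕ.+-mono-< (toℕ<n i) (toℕ<n j)) (ℕ.≤-reflexive (cong (N +_) (≡.sym (ℕ.+-identityʳ N))))

  module Torsion (torsion : ∀ d → Σ[ n ∈ ℕ ] d ↑ suc n ≈ ε) where

    -- A finite subset of a group that contains `ε` and is closed under products is a subgroup, so
    -- inverses are not recorded. The family `elem` certifies that there are at least `N` elements.
    record CentralSubgroup (N : ℕ) : Set (Level.suc (a ⊔ ℓ)) where
      field
        S        : G → Set (a ⊔ ℓ)
        ε∈       : S ε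
        ∙∈       : ∀ {x y} → S x → S y → S (x ∙ y)
        resp     : ∀ {x y} → x ≈ y → S x → S y
        finite   : Finite S
        elem     : Fin N → G
        elem∈    : ∀ i → S (elem i)
        injective : ∀ i j → elem i ≈ elem j → i ≡ j

    ↑-mod : ∀ x {n} → x ↑ suc n ≈ ε → ∀ m → x ↑ m ≈ x ↑ (m % suc n)
    ↑-mod x {n} xⁿ≈ε m = begin
      x ↑ m                                    ≡⟨ cong (x ↑_) (m≡m%n+[m/n]*n m (suc n)) ⟩
      x ↑ (m % suc n + (m / suc n) * suc n)     ≈⟨ ↑-+ x (m % suc n) _ ⟩
      x ↑ (m % suc n) ∙ x ↑ ((m / suc n) * suc n) ≈⟨ ∙-congˡ (Mult.×-assocˡ x (m / suc n) (suc n)) ⟨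
      x ↑ (m % suc n) ∙ (x ↑ suc n) ↑ (m / suc n) ≈⟨ ∙-congˡ (trans (↑-cong (m / suc n) xⁿ≈ε) (ε↑ (m / suc n))) ⟩
      x ↑ (m % suc n) ∙ ε                      ≈⟨ identityʳ _ ⟩
      x ↑ (m % suc n)                          ∎

    -- Central elements `x` are adjoined one at a time, each outside the subgroup built so far.
    -- Centrality makes the elements `s ∙ x ↑ i` closed under products, and the finite order of `x`
    -- leaves finitely many exponents. The adjoined elements form `elem`; they are distinct because
    -- each is new.
    centralSubgroup : Infinite Central → ∀ N → CentralSubgroup N
    centralSubgroup Z-infinite zero = record
      { S = λ x → Level.Lift (a ⊔ ℓ) (x ≈ ε) ; ε∈ = Level.lift ≈-refl
      ; ∙∈ = λ (Level.lift p) (Level.lift q) → Level.lift (trans (∙-cong p q) (identityˡ ε))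
      ; resp = λ x≈y (Level.lift p) → Level.lift (trans (sym x≈y) p)
      ; finite = 1 , atMost-⊆ (λ x → Level.lower) (atMost1 ε)
      ; elem = λ () ; elem∈ = λ () ; injective = λ () }
    centralSubgroup Z-infinite (suc N) = record
      { S = S ; ε∈ = ε , H.ε∈ , 0 , sym (identityˡ ε) ; ∙∈ = ∙∈
      ; resp = λ y≈z (s , s∈ , i , eq) → s , s∈ , i , trans (sym y≈z) eq
      ; finite = finite ; elem = elem ; elem∈ = elem∈ ; injective = injective }
      where
      module H = CentralSubgroup (centralSubgroup Z-infinite N)
      new = infinite-∖ Z-infinite H.finite
      x = proj₁ new
      x-central : Central x
      x-central = proj₁ (proj₂ new)
      S : G → Set (a ⊔ ℓ)
      S y = Σ[ s ∈ G ] (H.S s × Σ[ i ∈ ℕ ] y ≈ s ∙ x ↑ i)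
      ∙∈ : ∀ {y z} → S y → S z → S (y ∙ z)
      ∙∈ {y} {z} (s , s∈ , i , y≈) (t , t∈ , j , z≈) = s ∙ t , H.∙∈ s∈ t∈ , i + j , (begin
        y ∙ z                       ≈⟨ ∙-cong y≈ z≈ ⟩
        (s ∙ x ↑ i) ∙ (t ∙ x ↑ j)   ≈⟨ Solver.solve 4 (λ s p t q → (s ⊕ p) ⊕ (t ⊕ q) ⊜ (s ⊕ (p ⊕ t)) ⊕ q) ≈-refl s (x ↑ i) t (x ↑ j) ⟩
        (s ∙ (x ↑ i ∙ t)) ∙ x ↑ j   ≈⟨ ∙-congʳ (∙-congˡ (central-↑ i x-central t)) ⟨
        (s ∙ (t ∙ x ↑ i)) ∙ x ↑ j   ≈⟨ Solver.solve 4 (λ s t p q → (s ⊕ (t ⊕ p)) ⊕ q ⊜ (s ⊕ t) ⊕ (p ⊕ q)) ≈-refl s t (x ↑ i) (x ↑ j) ⟩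
        (s ∙ t) ∙ (x ↑ i ∙ x ↑ j)   ≈⟨ ∙-congˡ (↑-+ x i j) ⟨
        (s ∙ t) ∙ x ↑ (i + j)       ∎)
      order = torsion x
      finite : Finite S
      finite = finite-⊆
        (λ y (s , s∈ , i , eq) → s , s∈ , fromℕ< (m%n<n i (suc (proj₁ order))) ,
          trans eq (∙-congˡ (trans (↑-mod x (proj₂ order) i)
            (reflexive (cong (x ↑_) (≡.sym (toℕ-fromℕ< (m%n<n i (suc (proj₁ order))))))))))
        (finite-bind (λ y s≈s′ (i , eq) → i , trans eq (∙-congʳ s≈s′)) H.finite
          λ s → finite-fin em setoid {n = suc (proj₁ order)} λ i → 1 , atMost1 (s ∙ x ↑ toℕ i))
      elem : Fin (suc N) → G
      elem zero    = x
      elem (suc i) = H.elem i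
      elem∈ : ∀ i → S (elem i)
      elem∈ zero    = ε , H.ε∈ , 1 , sym (trans (identityˡ _) (identityʳ x))
      elem∈ (suc i) = H.elem i , H.elem∈ i , 0 , sym (identityʳ _)
      injective : ∀ i j → elem i ≈ elem j → i ≡ j
      injective zero    zero    _  = refl
      injective zero    (suc j) eq = ⊥-elim (proj₂ (proj₂ new) (H.resp (sym eq) (H.elem∈ j)))
      injective (suc i) zero    eq = ⊥-elim (proj₂ (proj₂ new) (H.resp eq (H.elem∈ i)))
      injective (suc i) (suc j) eq = cong suc (H.injective i j eq)

    finiteSubgroup : Infinite Central → ∀ N → ApproximateSubgroup N
    finiteSubgroup Z-infinite N with centralSubgroup Z-infinite N
    ... | H with finite-enum (CentralSubgroup.S H) (CentralSubgroup.finite H)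
    ...   | n , e , e∈ , e-inj , n-bound = record
      { n = n ; N≤n = pigeonhole n-bound H.elem H.elem∈ H.injective ; elem = e ; injective = e-inj
      ; doubling = atMost-≤ (ℕ.m≤m+n n _) (atMost-⊆ (λ g (i , j , eq) → H.resp (sym eq) (H.∙∈ (e∈ i) (e∈ j))) n-bound) }
      where module H = CentralSubgroup H

    -- Reineke's argument that a minimal group is abelian, in the torsion case:
    -- otherwise all noncentral elements are conjugate.
    module _ (G-infinite : Infinite {p = a} (λ _ → ⊤))
             (centralizer : ∀ d → Finite (λ g → Commute g d) ⊎ Finite (λ g → ¬ Commute g d))
             (class : ∀ d → Finite (Conjugate d) ⊎ Finite (λ g → ¬ Conjugate d g)) where

      -- Suppose the centralizer of `x` is cofinite and misses `y`. Its translate by `y` is then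
      -- infinite and lies entirely outside it, which is impossible.
      noncentral⇒centralizer-finite : ∀ {x} → ¬ Central x → Finite (λ g → Commute g x)
      noncentral⇒centralizer-finite {x} ¬central with centralizer x
      ... | inj₁ fin   = fin
      ... | inj₂ cofin = ⊥-elim (¬central λ y → byContradiction (coset-escapes y))
        where
        C-infinite : Infinite (λ g → Commute g x)
        C-infinite fin = G-infinite (finite-⊆ (λ g _ → classify g) (finite-∪ fin cofin))
          where
          classify : ∀ g → Commute g x ⊎ ¬ Commute g x
          classify g with em {P = Commute g x}
          ... | yes h = inj₁ h
          ... | no  h = inj₂ h
        coset-escapes : ∀ y → ¬ ¬ Commute y x
        coset-escapes y ¬yx = infinite-fromSequence (λ n → enumerate C-infinite n ∙ y)
          (λ n cyx → ¬yx (∙-cancelˡ (enumerate C-infinite n) _ _ (begin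
            c n ∙ (y ∙ x) ≈⟨ assoc (c n) y x ⟨
            (c n ∙ y) ∙ x ≈⟨ cyx ⟩
            x ∙ (c n ∙ y) ≈⟨ assoc x (c n) y ⟨
            (x ∙ c n) ∙ y ≈⟨ ∙-congʳ (enumerate-∈ C-infinite n) ⟨
            (c n ∙ x) ∙ y ≈⟨ assoc (c n) x y ⟩
            c n ∙ (x ∙ y) ∎)))
          (λ i j eq → enumerate-injective C-infinite i j (∙-cancelʳ y _ _ eq)) cofin
          where c = enumerate C-infinite

      -- Orbit and stabilizer: the elements that carry `x` to a given `y` form a coset of the finite
      -- centralizer or nothing, so finitely many conjugates would account for only finitely many
      -- group elements.
      noncentral⇒class-infinite : ∀ {x} → ¬ Central x → Infinite (Conjugate x)
      noncentral⇒class-infinite {x} ¬central fin = G-infinite (finite-⊆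
        (λ t _ → t ∙ x ∙ t ⁻¹ , (t , sym (conj t)) , sym (conj t))
        (finite-bind {Q = λ y t → t ∙ x ≈ y ∙ t} (λ t y≈y′ eq → trans eq (∙-congʳ y≈y′)) fin transporter))
        where
        conj : ∀ t → (t ∙ x ∙ t ⁻¹) ∙ t ≈ t ∙ x
        conj t = trans (assoc _ _ _) (trans (∙-congˡ (inverseˡ t)) (identityʳ _))
        transporter : ∀ y → Finite (λ t → t ∙ x ≈ y ∙ t)
        transporter y with em {P = Σ[ t ∈ G ] t ∙ x ≈ y ∙ t}
        ... | no none       = covers⇒finite [] (λ t eq → ⊥-elim (none (t , eq)))
        ... | yes (t , tx≈yt) = finite-⊆
          (λ u ux≈yu → t ⁻¹ ∙ u , ∙-cancelˡ t _ _ (begin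
             t ∙ ((t ⁻¹ ∙ u) ∙ x) ≈⟨ ∙-congˡ (assoc _ _ _) ⟩
             t ∙ (t ⁻¹ ∙ (u ∙ x)) ≈⟨ cancel t _ ⟩
             u ∙ x                ≈⟨ ux≈yu ⟩
             y ∙ u                ≈⟨ ∙-congˡ (cancel t u) ⟨
             y ∙ (t ∙ (t ⁻¹ ∙ u)) ≈⟨ assoc _ _ _ ⟨
             (y ∙ t) ∙ (t ⁻¹ ∙ u) ≈⟨ ∙-congʳ tx≈yt ⟨
             (t ∙ x) ∙ (t ⁻¹ ∙ u) ≈⟨ assoc _ _ _ ⟩
             t ∙ (x ∙ (t ⁻¹ ∙ u)) ∎) , sym (cancel t u))
          (finite-image (t ∙_) ∙-congˡ (noncentral⇒centralizer-finite ¬central))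
          where
          cancel : ∀ t u → t ∙ (t ⁻¹ ∙ u) ≈ u
          cancel t u = trans (sym (assoc _ _ _)) (trans (∙-congʳ (inverseʳ t)) (identityˡ u))

      noncentral⇒class-cofinite : ∀ {x} → ¬ Central x → Finite (λ g → ¬ Conjugate x g)
      noncentral⇒class-cofinite {x} ¬central with class x
      ... | inj₁ fin   = ⊥-elim (noncentral⇒class-infinite ¬central fin)
      ... | inj₂ cofin = cofin

      -- Two cofinite classes in an infinite group share an element.
      noncentral⇒conjugate : ∀ {x y} → ¬ Central x → ¬ Central y → Conjugate x y
      noncentral⇒conjugate {x} {y} ¬x ¬y
        with infinite-∖ G-infinite (finite-∪ (noncentral⇒class-cofinite ¬x) (noncentral⇒class-cofinite ¬y))
      ... | g , _ , in-both with byContradiction (in-both ∘ inj₁) | byContradiction (in-both ∘ inj₂)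
      ...   | t , tx≈gt | u , uy≈gu = u ⁻¹ ∙ t , ∙-cancelˡ u _ _ (begin
        u ∙ ((u ⁻¹ ∙ t) ∙ x)  ≈⟨ ∙-congˡ (assoc _ _ _) ⟩
        u ∙ (u ⁻¹ ∙ (t ∙ x))  ≈⟨ cancel (t ∙ x) ⟩
        t ∙ x                 ≈⟨ tx≈gt ⟩
        g ∙ t                 ≈⟨ ∙-congˡ (cancel t) ⟨
        g ∙ (u ∙ (u ⁻¹ ∙ t))  ≈⟨ assoc _ _ _ ⟨
        (g ∙ u) ∙ (u ⁻¹ ∙ t)  ≈⟨ ∙-congʳ uy≈gu ⟨
        (u ∙ y) ∙ (u ⁻¹ ∙ t)  ≈⟨ assoc _ _ _ ⟩
        u ∙ (y ∙ (u ⁻¹ ∙ t))  ∎)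
        where
        cancel : ∀ v → u ∙ (u ⁻¹ ∙ v) ≈ v
        cancel v = trans (sym (assoc _ _ _)) (trans (∙-congʳ (inverseʳ u)) (identityˡ v))

      -- Modulo the centre the group has exponent 2, so it is abelian there and conjugation changes
      -- `y` by a central factor. The factor `z` is the commutator of `t` and `y`, written as a
      -- product of squares and their inverses.
      centralSquares⇒class⊆coset : (∀ x → Central (x ∙ x)) → ∀ y g → Conjugate y g →
        Σ[ z ∈ G ] (Central z × g ≈ z ∙ y)
      centralSquares⇒class⊆coset squares y g (t , ty≈gt) =
        z , central-∙ (squares (t ∙ y)) (central-⁻¹ (central-∙ (squares t) (squares y))) ,
        ∙-cancelʳ (t ∙ t ∙ (y ∙ y)) _ _ (begin
          g ∙ (t ∙ t ∙ (y ∙ y))               ≈⟨ Solver.solve 3 (λ g t y → g ⊕ ((t ⊕ t) ⊕ (y ⊕ y)) ⊜ ((g ⊕ t) ⊕ (t ⊕ y)) ⊕ y) ≈-refl g t y ⟩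
          (g ∙ t) ∙ (t ∙ y) ∙ y               ≈⟨ ∙-congʳ (∙-congʳ ty≈gt) ⟨
          (t ∙ y) ∙ (t ∙ y) ∙ y               ≈⟨ ∙-congʳ (identityʳ _) ⟨
          (t ∙ y) ∙ (t ∙ y) ∙ ε ∙ y           ≈⟨ ∙-congʳ (∙-congˡ (inverseˡ w)) ⟨
          (t ∙ y) ∙ (t ∙ y) ∙ (w ⁻¹ ∙ w) ∙ y
            ≈⟨ Solver.solve 4 (λ s v w y → (s ⊕ (v ⊕ w)) ⊕ y ⊜ (s ⊕ v) ⊕ (w ⊕ y)) ≈-refl ((t ∙ y) ∙ (t ∙ y)) (w ⁻¹) w y ⟩
          z ∙ (w ∙ y)                         ≈⟨ ∙-congˡ (central-∙ (squares t) (squares y) y) ⟨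
          z ∙ (y ∙ w)                         ≈⟨ assoc _ _ _ ⟨
          (z ∙ y) ∙ w                         ∎)
        where
        w = t ∙ t ∙ (y ∙ y)
        z = (t ∙ y) ∙ (t ∙ y) ∙ w ⁻¹

      -- As `t` inverts `x`, its even powers commute with `x`, while `t` does not, or else `x ∙ x`
      -- would be `ε`. So no odd power of `t` is central. If `t ↑ m` is noncentral, it is conjugate
      -- to `x`; a central `t ↑ (m + m)` would then equal its conjugate `x ∙ x`, which is not
      -- central. In a torsion group this excludes such a `t`.
      centralSquare-descent : ∀ {x t} → ¬ Central (x ∙ x) → t ∙ x ≈ x ⁻¹ ∙ t →
                              ∀ s → 0 < s → ¬ Central (t ↑ s)
      centralSquare-descent {x} {t} ¬x² inverts = <-rec (λ s → 0 < s → ¬ Central (t ↑ s)) step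
        where
        ¬x : ¬ Central x
        ¬x c = ¬x² (central-∙ c c)
        xtx : x ∙ (t ∙ x) ≈ t
        xtx = trans (∙-congˡ inverts) (trans (sym (assoc _ _ _)) (trans (∙-congʳ (inverseʳ x)) (identityˡ t)))
        t²-commutes : Commute x (t ∙ t)
        t²-commutes = begin
          x ∙ (t ∙ t)               ≈⟨ ∙-congˡ (∙-congˡ xtx) ⟨
          x ∙ (t ∙ (x ∙ (t ∙ x)))   ≈⟨ Solver.solve 2 (λ x t → x ⊕ (t ⊕ (x ⊕ (t ⊕ x))) ⊜ (x ⊕ (t ⊕ x)) ⊕ (t ⊕ x)) ≈-refl x t ⟩
          (x ∙ (t ∙ x)) ∙ (t ∙ x)   ≈⟨ ∙-congʳ xtx ⟩
          t ∙ (t ∙ x)               ≈⟨ assoc t t x ⟨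
          (t ∙ t) ∙ x               ∎
        ¬commute : ¬ Commute x t
        ¬commute xt = ¬x² (central-resp (sym x²≈ε) commute-ε)
          where
          x²≈ε : x ∙ x ≈ ε
          x²≈ε = ∙-cancelʳ t _ _ (begin
            (x ∙ x) ∙ t  ≈⟨ assoc x x t ⟩
            x ∙ (x ∙ t)  ≈⟨ ∙-congˡ xt ⟩
            x ∙ (t ∙ x)  ≈⟨ xtx ⟩
            t            ≈⟨ identityˡ t ⟨
            ε ∙ t        ∎)
        commutes-even : ∀ m → Commute x (t ↑ (m + m))
        commutes-even m = commute-↑-even m t²-commutes
        even-or-odd : ∀ s → Σ[ m ∈ ℕ ] (s ≡ m + m ⊎ s ≡ suc (m + m))
        even-or-odd zero = 0 , inj₁ refl
        even-or-odd (suc s) with even-or-odd s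
        ... | m , inj₁ refl = m , inj₂ refl
        ... | m , inj₂ refl = suc m , inj₁ (cong suc (≡.sym (ℕ.+-suc m m)))
        odd-step : ∀ m → ¬ Central (t ↑ suc (m + m))
        odd-step m central = ¬commute (∙-cancelʳ (t ↑ (m + m)) (x ∙ t) (t ∙ x) (begin
          (x ∙ t) ∙ t ↑ (m + m)  ≈⟨ assoc x t (t ↑ (m + m)) ⟩
          x ∙ (t ∙ t ↑ (m + m))  ≈⟨ central x ⟩
          (t ∙ t ↑ (m + m)) ∙ x  ≈⟨ assoc t (t ↑ (m + m)) x ⟩
          t ∙ (t ↑ (m + m) ∙ x)  ≈⟨ ∙-congˡ (commutes-even m) ⟨
          t ∙ (x ∙ t ↑ (m + m))  ≈⟨ assoc t x (t ↑ (m + m)) ⟨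
          (t ∙ x) ∙ t ↑ (m + m)  ∎))
        even-step : ∀ m → ¬ Central (t ↑ m) → ¬ Central (t ↑ (m + m))
        even-step m ¬c central = ¬x² (central-resp x²≈ (central-resp (↑-+ t m m) central))
          where
          p = t ↑ m
          conj : Conjugate p x
          conj = noncentral⇒conjugate ¬c ¬x
          u = proj₁ conj
          x²≈ : p ∙ p ≈ x ∙ x
          x²≈ = ∙-cancelʳ u (p ∙ p) (x ∙ x) (begin
            (p ∙ p) ∙ u  ≈⟨ central-resp (↑-+ t m m) central u ⟨
            u ∙ (p ∙ p)  ≈⟨ assoc u p p ⟨
            (u ∙ p) ∙ p  ≈⟨ ∙-congʳ (proj₂ conj) ⟩
            (x ∙ u) ∙ p  ≈⟨ assoc x u p ⟩
            x ∙ (u ∙ p)  ≈⟨ ∙-congˡ (proj₂ conj) ⟩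
            x ∙ (x ∙ u)  ≈⟨ assoc x x u ⟨
            (x ∙ x) ∙ u  ∎)
        step : ∀ s → (∀ {m} → m < s → 0 < m → ¬ Central (t ↑ m)) → 0 < s → ¬ Central (t ↑ s)
        step s rec 0<s central with even-or-odd s
        ... | m     , inj₂ refl = odd-step m central
        ... | suc m , inj₁ refl = even-step (suc m) (rec (ℕ.m<m+n (suc m) (s≤s z≤n)) (s≤s z≤n)) central

      -- A noncentral class would be contained in a coset of the finite centre.
      central-squares⇒⊥ : Finite Central → (∀ x → Central (x ∙ x)) → ⊥
      central-squares⇒⊥ Z-finite squares = noncentral⇒class-infinite (proj₂ (proj₂ new))
        (finite-⊆ (centralSquares⇒class⊆coset squares (proj₁ new)) (finite-image (_∙ proj₁ new) ∙-congʳ Z-finite))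
        where
        new : Σ[ y ∈ G ] (⊤ × ¬ Central y)
        new = infinite-∖ G-infinite Z-finite

      -- If `x ∙ x` is noncentral, then so are `x` and its inverse. They are therefore conjugate, by
      -- some `t` that inverts `x`, and the descent contradicts the finite order of `t`.
      squares-central : ∀ x → Central (x ∙ x)
      squares-central x = byContradiction λ ¬x² →
        let ¬x : ¬ Central x
            ¬x c = ¬x² (central-∙ c c)
            ¬x⁻¹ : ¬ Central (x ⁻¹)
            ¬x⁻¹ c = ¬x (central-resp (⁻¹-involutive x) (central-⁻¹ c))
            (t , tx≈x⁻¹t) = noncentral⇒conjugate ¬x ¬x⁻¹
            (n , tⁿ≈ε) = torsion t
        in centralSquare-descent ¬x² tx≈x⁻¹t (suc n) (s≤s z≤n) (central-resp (sym tⁿ≈ε) commute-ε)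

      center-infinite : Infinite Central
      center-infinite Z-finite = central-squares⇒⊥ Z-finite squares-central

  approximateSubgroups :
    Infinite {p = a} (λ _ → ⊤) →
    (∀ d → Finite (λ g → Commute g d) ⊎ Finite (λ g → ¬ Commute g d)) →
    (∀ d → Finite (Conjugate d) ⊎ Finite (λ g → ¬ Conjugate d g)) →
    ∀ N → ApproximateSubgroup N
  approximateSubgroups G-infinite centralizer class N with em {P = Σ[ d ∈ G ] InfiniteOrder d}
  ... | yes (d , inf) = progression inf N
  ... | no none = finiteSubgroup (center-infinite G-infinite centralizer class) N
    where
    torsion : ∀ d → Σ[ n ∈ ℕ ] d ↑ suc n ≈ ε
    torsion d = byContradiction λ ¬torsion → none (d , λ { (suc n) _ dⁿ≈ε → ¬torsion (n , dⁿ≈ε) })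
    open Torsion torsion

-- The definable group of rank 1 and degree 1.

module GroupDefinability (em : Classical) {ℓ : Level} {L : Language ℓ} (M : Structure L)
    (s₀ : Language.Sort L) {C : Definability.ParamSet M} (𝒢 : DefinableGroup M C)
    (rank-degree : Definability.HasRMDegree M (DefinableGroup.domain 𝒢) 1 1) where
  open Language L
  open Structure M
  open Definability M
  open Logic M using (⟦⟧-resp)
  open DefinableRelations em M s₀
  open Rank em M s₀
  open DefinableGroup 𝒢
  open Classically em

  group : Group ℓ ℓ
  group = record { isGroup = isGroup }

  open Group group using (setoid; ∙-congʳ)
    renaming (refl to ≈-refl; sym to ≈-sym; trans to ≈-trans)
  open MinimalGroup em group using (Commute; Conjugate; ApproximateSubgroup; approximateSubgroups)

  private
    module E = Card em setoid
    module T = Card em (tuples Γ)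

  Dom : Tuple Γ → Set ℓ
  Dom = ⟦ domain ⟧

  Mul : Tuple Γ → Tuple Γ → Tuple Γ → Set ℓ
  Mul p q r = ⟦ graph ⟧ (p ⧺ q ⧺ r)

  dom-def : {Ξ : Context} (x : Γ ∈ Ξ) → Def C (λ e → Dom (All.lookup e x))
  dom-def x = def-⟦⟧ domain dom-over (block x)

  mul-def : {Ξ : Context} (x y z : Γ ∈ Ξ) → Def C (λ e → Mul (All.lookup e x) (All.lookup e y) (All.lookup e z))
  mul-def x y z = def-⟦⟧ graph graph-over (block x ⧺ᵗ block y ⧺ᵗ block z)

  -- Minimality speaks of tuples, the group theory of elements, which are tuples with a proof of
  -- membership. Finiteness is moved between the two.
  tupleFinite⇒elementFinite : {P : Tuple Γ → Set ℓ} → T.Finite (λ p → Dom p × P p) → E.Finite (P ∘ proj₁)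
  tupleFinite⇒elementFinite {P} fin = E.finite-⊆ (λ (p , p∈) Pp → p , (p∈ , Pp) , Setoid.refl (tuples Γ) {p})
    (CardBind.finite-bind em (tuples Γ) setoid (λ g p≋q g≋p → Setoid.trans (tuples Γ) {proj₁ g} g≋p p≋q) fin fibre)
    where
    fibre : ∀ p → E.Finite (λ g → proj₁ g ≋ p)
    fibre p with em {P = Dom p}
    ... | yes p∈ = 1 , E.atMost1 (p , p∈)
    ... | no p∉  = E.covers⇒finite [] λ (q , q∈) q≋p → ⊥-elim (p∉ (⟦⟧-resp domain q≋p q∈))

  elementFinite⇒tupleFinite : {P : Tuple Γ → Set ℓ} → E.Finite (P ∘ proj₁) → T.Finite (λ p → Dom p × P p)
  elementFinite⇒tupleFinite {P} fin = T.finite-⊆ (λ p (p∈ , Pp) → (p , p∈) , Pp , Setoid.refl (tuples Γ) {p})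
    (CardBind.finite-image em setoid (tuples Γ) proj₁ id fin)

  elements-infinite : E.Infinite {p = ℓ} (λ _ → ⊤)
  elements-infinite fin = proj₁ (minimal domain rank-degree)
    (T.finite-⊆ (λ p p∈ → p∈ , tt) (elementFinite⇒tupleFinite {λ _ → ⊤} fin))

  finite⊎cofinite : {P : Tuple Γ → Set ℓ} → Def allParameters (↓₁ P) →
                    E.Finite (λ g → P (proj₁ g)) ⊎ E.Finite (λ g → ¬ P (proj₁ g))
  finite⊎cofinite {P} P-def = Sum.map
    (λ fin → tupleFinite⇒elementFinite (T.finite-⊆ (λ p → to (spec p)) fin))
    (λ fin → tupleFinite⇒elementFinite
      (T.finite-⊆ (λ p (p∈ , ¬Pp) → p∈ , ¬Pp ∘ proj₂ ∘ from (spec p)) fin))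
    (proj₂ (minimal domain rank-degree) (proj₁ D) (λ p → proj₁ ∘ from (spec p)))
    where
    D : DefinableOver allParameters (λ p → Dom p × P p)
    D = def⇒definable (def-≡ (def-⟦⟧₁ domain def-∧ def-select P-def (here refl ∷ [])) λ { (p ∷ []) → refl })
    spec : ∀ p → (Dom p × P p) ⇔ ⟦ proj₁ D ⟧ p
    spec = proj₂ (proj₂ D)

  centralizer : ∀ d → E.Finite (λ g → Commute g d) ⊎ E.Finite (λ g → ¬ Commute g d)
  centralizer d = Sum.map (E.finite-⊆ (λ g → from (spec g))) (E.finite-⊆ (λ g ¬c → ¬c ∘ to (spec g)))
    (finite⊎cofinite P-def)
    where
    -- Commuting means having a common product `k`, which the graph can express.
    P : Tuple Γ → Set ℓ
    P p = Σ[ k ∈ Tuple Γ ] (Dom k × Mul p (proj₁ d) k × Mul (proj₁ d) p k)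
    P-def : Def allParameters (↓₁ P)
    P-def = def-≡ (def-parameter {P = λ e → Σ[ k ∈ Tuple Γ ]
        (Dom k × Mul (All.lookup e (there (here refl))) (All.lookup e (here refl)) k ×
         Mul (All.lookup e (here refl)) (All.lookup e (there (here refl))) k)}
        (def-weaken (def-∃ (dom-def (here refl) def-∧ mul-def (there (there (here refl))) (there (here refl)) (here refl)
          def-∧ mul-def (there (here refl)) (there (there (here refl))) (here refl))))
        (proj₁ d) (λ _ → tt))
      λ { (p ∷ []) → refl }
    spec : ∀ g → P (proj₁ g) ⇔ Commute g d
    spec g = mk⇔
      (λ (k , k∈ , gd , dg) → ≈-trans {g ∙ d} {k , k∈} {d ∙ g} (from (graph-spec g d (k , k∈)) gd)
        (≈-sym {d ∙ g} {k , k∈} (from (graph-spec d g (k , k∈)) dg)))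
      (λ c → proj₁ (d ∙ g) , proj₂ (d ∙ g) , to (graph-spec g d (d ∙ g)) c , to (graph-spec d g (d ∙ g)) (≈-refl {d ∙ g}))

  conjugacyClass : ∀ d → E.Finite (Conjugate d) ⊎ E.Finite (λ g → ¬ Conjugate d g)
  conjugacyClass d = Sum.map (E.finite-⊆ (λ g → from (spec g))) (E.finite-⊆ (λ g ¬c → ¬c ∘ to (spec g)))
    (finite⊎cofinite P-def)
    where
    P : Tuple Γ → Set ℓ
    P p = Σ[ t ∈ Tuple Γ ] (Dom t × Σ[ k ∈ Tuple Γ ] (Dom k × Mul t (proj₁ d) k × Mul p t k))
    P-def : Def allParameters (↓₁ P)
    P-def = def-≡ (def-parameter {P = λ e → Σ[ t ∈ Tuple Γ ] (Dom t × Σ[ k ∈ Tuple Γ ]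
        (Dom k × Mul t (All.lookup e (here refl)) k × Mul (All.lookup e (there (here refl))) t k))}
        (def-weaken (def-∃ (dom-def (here refl) def-∧ def-∃ (dom-def (here refl)
          def-∧ mul-def (there (here refl)) (there (there (here refl))) (here refl)
          def-∧ mul-def (there (there (there (here refl)))) (there (here refl)) (here refl)))))
        (proj₁ d) (λ _ → tt))
      λ { (p ∷ []) → refl }
    spec : ∀ g → P (proj₁ g) ⇔ Conjugate d g
    spec g = mk⇔
      (λ (t , t∈ , k , k∈ , td , gt) → (t , t∈) ,
        ≈-trans {(t , t∈) ∙ d} {k , k∈} {g ∙ (t , t∈)} (from (graph-spec (t , t∈) d (k , k∈)) td)
          (≈-sym {g ∙ (t , t∈)} {k , k∈} (from (graph-spec g (t , t∈) (k , k∈)) gt)))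
      (λ (t , eq) → proj₁ t , proj₂ t , proj₁ (g ∙ t) , proj₂ (g ∙ t) ,
        to (graph-spec t d (g ∙ t)) eq , to (graph-spec g t (g ∙ t)) (≈-refl {g ∙ t}))

  approximateSubgroup : ∀ N → ApproximateSubgroup N
  approximateSubgroup = approximateSubgroups elements-infinite centralizer conjugacyClass

  -- The relation u v w = 1, with the identity recovered as the only idempotent.
  Product1 : Tuple Γ → Tuple Γ → Tuple Γ → Set ℓ
  Product1 u v w = Dom u × Dom v × Dom w × Σ[ p ∈ Tuple Γ ] (Dom p × Mul u v p ×
    Σ[ e ∈ Tuple Γ ] (Dom e × Mul e e e × Mul p w e))

  product1-def : {Ξ : Context} (x y z : Γ ∈ Ξ) →
                 Def C (λ e → Product1 (All.lookup e x) (All.lookup e y) (All.lookup e z))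
  product1-def x y z = dom-def x def-∧ dom-def y def-∧ dom-def z def-∧
    def-∃ (dom-def (here refl) def-∧ mul-def (there x) (there y) (here refl) def-∧
      def-∃ (dom-def (here refl) def-∧ mul-def (here refl) (here refl) (here refl)
        def-∧ mul-def (there (here refl)) (there (there z)) (here refl)))

  product1-intro : ∀ u v w → ((u ∙ v) ∙ w) ≈ ε → Product1 (proj₁ u) (proj₁ v) (proj₁ w)
  product1-intro u v w eq = proj₂ u , proj₂ v , proj₂ w , proj₁ (u ∙ v) , proj₂ (u ∙ v) ,
    to (graph-spec u v (u ∙ v)) (≈-refl {u ∙ v}) , proj₁ ε , proj₂ ε ,
    to (graph-spec ε ε ε) (Group.identityˡ group ε) , to (graph-spec (u ∙ v) w ε) eq

  product1-elim : ∀ {u v w} ((u∈ , v∈ , w∈ , _) : Product1 u v w) → (((u , u∈) ∙ (v , v∈)) ∙ (w , w∈)) ≈ ε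
  product1-elim {u} {v} {w} (u∈ , v∈ , w∈ , p , p∈ , uvp , e , e∈ , eee , pwe) = begin
    (u′ ∙ v′) ∙ w′  ≈⟨ ∙-congʳ {w′} {u′ ∙ v′} {p′} (from (graph-spec u′ v′ p′) uvp) ⟩
    p′ ∙ w′         ≈⟨ from (graph-spec p′ w′ e′) pwe ⟩
    e′
      ≈⟨ ∙-cancelˡ e′ e′ ε (≈-trans {e′ ∙ e′} {e′} {e′ ∙ ε} (from (graph-spec e′ e′ e′) eee)
           (≈-sym {e′ ∙ ε} {e′} (Group.identityʳ group e′))) ⟩
    ε               ∎
    where
    open Algebra.Properties.Group group using (∙-cancelˡ)
    open import Relation.Binary.Reasoning.Setoid setoid
    u′ v′ w′ p′ e′ : Element
    u′ = u , u∈
    v′ = v , v∈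
    w′ = w , w∈
    p′ = p , p∈
    e′ = e , e∈

  private
    atMost1-unique : {P : Tuple Γ → Set ℓ} → (∀ p q → P p → P q → p ≋ q) → T.AtMost 1 P
    atMost1-unique {P} unique with em {P = ∃ P}
    ... | yes (p , Pp) = T.atMost-⊆ (λ q Pq → unique q p Pq Pp) (T.atMost1 p)
    ... | no none      = [] , z≤n , λ p Pp → ⊥-elim (none (p , Pp))

  product1-unique₁ : ∀ v w → T.AtMost 1 (λ u → Product1 u v w)
  product1-unique₁ v w = atMost1-unique λ p q (p∈ , v∈ , w∈ , h) (q∈ , v∈′ , w∈′ , k) →
    ∙-cancelʳ (v , v∈) (p , p∈) (q , q∈) (∙-cancelʳ (w , w∈) ((p , p∈) ∙ (v , v∈)) ((q , q∈) ∙ (v , v∈))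
      (≈-trans {((p , p∈) ∙ (v , v∈)) ∙ (w , w∈)} {ε} {((q , q∈) ∙ (v , v∈)) ∙ (w , w∈)}
        (product1-elim (p∈ , v∈ , w∈ , h)) (≈-sym {((q , q∈) ∙ (v , v∈)) ∙ (w , w∈)} {ε} (product1-elim (q∈ , v∈ , w∈ , k)))))
    where open Algebra.Properties.Group group using (∙-cancelʳ)

  product1-unique₂ : ∀ u w → T.AtMost 1 (λ v → Product1 u v w)
  product1-unique₂ u w = atMost1-unique λ p q (u∈ , p∈ , w∈ , h) (u∈′ , q∈ , w∈′ , k) →
    ∙-cancelˡ (u , u∈) (p , p∈) (q , q∈) (∙-cancelʳ (w , w∈) ((u , u∈) ∙ (p , p∈)) ((u , u∈) ∙ (q , q∈))
      (≈-trans {((u , u∈) ∙ (p , p∈)) ∙ (w , w∈)} {ε} {((u , u∈) ∙ (q , q∈)) ∙ (w , w∈)}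
        (product1-elim (u∈ , p∈ , w∈ , h)) (≈-sym {((u , u∈) ∙ (q , q∈)) ∙ (w , w∈)} {ε} (product1-elim (u∈ , q∈ , w∈ , k)))))
    where open Algebra.Properties.Group group using (∙-cancelˡ; ∙-cancelʳ)

  product1-unique₃ : ∀ u v → T.AtMost 1 (λ w → Product1 u v w)
  product1-unique₃ u v = atMost1-unique λ p q (u∈ , v∈ , p∈ , h) (u∈′ , v∈′ , q∈ , k) →
    ∙-cancelˡ ((u , u∈) ∙ (v , v∈)) (p , p∈) (q , q∈)
      (≈-trans {((u , u∈) ∙ (v , v∈)) ∙ (p , p∈)} {ε} {((u , u∈) ∙ (v , v∈)) ∙ (q , q∈)}
        (product1-elim (u∈ , v∈ , p∈ , h)) (≈-sym {((u , u∈) ∙ (v , v∈)) ∙ (q , q∈)} {ε} (product1-elim (u∈ , v∈ , q∈ , k))))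
    where open Algebra.Properties.Group group using (∙-cancelˡ)

private
  i0 : {A : Set ℓ} {a : A} {as : List A} → a ∈ a ∷ as
  i0 = here refl
  i1 : {A : Set ℓ} {a b : A} {as : List A} → a ∈ b ∷ a ∷ as
  i1 = there i0
  i2 : {A : Set ℓ} {a b c : A} {as : List A} → a ∈ b ∷ c ∷ a ∷ as
  i2 = there i1
  i3 : {A : Set ℓ} {a b c d : A} {as : List A} → a ∈ b ∷ c ∷ d ∷ a ∷ as
  i3 = there i2
  i4 : {A : Set ℓ} {a b c d e : A} {as : List A} → a ∈ b ∷ c ∷ d ∷ e ∷ a ∷ as
  i4 = there i3
  i5 : {A : Set ℓ} {a b c d e f : A} {as : List A} → a ∈ b ∷ c ∷ d ∷ e ∷ f ∷ a ∷ as
  i5 = there i4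

-- Uniform correspondences between coordinates and group elements.

module GroupLikeRelations (em : Classical) {ℓ : Level} {L : Language ℓ} (M : Structure L)
    (s₀ : Language.Sort L) {Γ₁ Γ₂ Γ₃ : List (Language.Sort L)} (κ : Set ℓ)
    (X : Definability.Definable M Γ₁) (Y : Definability.Definable M Γ₂) (Z : Definability.Definable M Γ₃)
    (F : Definability.Definable M (Γ₁ ++ Γ₂ ++ Γ₃))
    (groupLike : Conditions.GroupLike M X Y Z F κ) where
  open Language L
  open Structure M
  open Definability M
  open Imaginaries M using (InterAlgebraic)
  open Elimination M using (∈aclᵉᵠ⇒∈acl)
  open Logic M using (≋-refl; ≋-sym; ≋-trans; ⧺-injective)
  open DefinableRelations em M s₀
  open Algebraicity em M s₀
  open Rank em M s₀
  open Conditions.GroupLike groupLike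
  open GroupDefinability em M s₀ G rank-degree

  private
    Γ = G.Γ
    Θ = Γ₁ ++ Γ₂ ++ Γ₃

  α : Tuple Θ
  α = α₁ ⧺ α₂ ⧺ α₃

  -- Inter-algebraicity over `C` made uniform: one `C`-definable relation, finite-to-finite on all
  -- tuples, instead of two formulas that are finite only at `a` and `g`.
  record Correspondence {Δ : List Sort} (a : Tuple Δ) (g : Tuple Γ) : Set (Level.suc ℓ) where
    field
      R      : Tuple Δ → Tuple Γ → Set ℓ
      R-def  : Def C (↓₂ R)
      R-holds : R a g
      k      : ℕ
      boundˡ : ∀ u → Size.AtMost (tuples Δ) k (λ x → R x u)
      boundʳ : ∀ x → Size.AtMost (tuples Γ) k (λ u → R x u)

    R-resp : ∀ {x x′ u u′} → x ≋ x′ → u ≋ u′ → R x u → R x′ u′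
    R-resp {x} {x′} {u} {u′} p q = def-resp R-def {x ∷ u ∷ []} {x′ ∷ u′ ∷ []} (p , q , tt)

  abstract
    correspondence : {Δ : List Sort} (a : Tuple Δ) (g : Tuple Γ) → InterAlgebraic C a g → Correspondence a g
    correspondence {Δ} a g (a∈ , g∈) = record
      { R       = λ x u → A.R x u × B.R u x
      ; R-def   = def-≡ (def-select A.R-def (here refl ∷ there (here refl) ∷ []) def-∧
                         def-select B.R-def (there (here refl) ∷ here refl ∷ [])) λ { (x ∷ u ∷ []) → refl }
      ; R-holds = A.R-holds , B.R-holds
      -- The sum is a common bound for both directions.
      ; k       = A.k + B.k
      ; boundˡ  = λ u → Card.atMost-≤ em (tuples Δ) (ℕ.m≤m+n A.k B.k)
                          (Card.atMost-⊆ em (tuples Δ) (λ _ → proj₁) (A.bound u))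
      ; boundʳ  = λ x → Card.atMost-≤ em (tuples Γ) (ℕ.m≤n+m B.k A.k)
                          (Card.atMost-⊆ em (tuples Γ) (λ _ → proj₂) (B.bound x))
      }
      where
      module A = Algebraic (⊆acl⇒algebraic C g a (∈aclᵉᵠ⇒∈acl (entries g ∪ C) a a∈))
      module B = Algebraic (⊆acl⇒algebraic C a g (∈aclᵉᵠ⇒∈acl (entries a ∪ C) g g∈))

  module R₁ = Correspondence (correspondence α₁ (proj₁ g₁) α₁↔g₁)
  module R₂ = Correspondence (correspondence α₂ (proj₁ g₂) α₂↔g₂)
  module R₃ = Correspondence (correspondence α₃ (proj₁ g₃) α₃↔g₃)

  -- a = (x , y , z) corresponds to (u , v , (u v)⁻¹).
  Lies : Tuple Θ → Tuple Γ → Tuple Γ → Set ℓ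
  Lies a u v = Σ[ x ∈ Tuple Γ₁ ] (R₁.R x u × Σ[ y ∈ Tuple Γ₂ ] (R₂.R y v ×
    Σ[ w ∈ Tuple Γ ] (Product1 u v w × Σ[ z ∈ Tuple Γ₃ ] (R₃.R z w × a ≋ x ⧺ y ⧺ z))))

  lies-def : Def C (↓₃ Lies)
  lies-def = def-≡
    (def-∃ (def-select R₁.R-def (i0 ∷ i2 ∷ []) def-∧
     def-∃ (def-select R₂.R-def (i0 ∷ i4 ∷ []) def-∧
     def-∃ (product1-def i4 i5 i0 def-∧
     def-∃ (def-select R₃.R-def (i0 ∷ i1 ∷ []) def-∧
       def-≋ (block i4) (block i3 ⧺ᵗ block i2 ⧺ᵗ block i0))))))
    λ { (a ∷ u ∷ v ∷ []) → refl }

  α-lies : Lies α (proj₁ g₁) (proj₁ g₂)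
  α-lies = α₁ , R₁.R-holds , α₂ , R₂.R-holds , proj₁ g₃ , product1-intro g₁ g₂ g₃ product≈ε ,
           α₃ , R₃.R-holds , ≋-refl α

  lies-elim : ∀ {x y z u v} → Lies (x ⧺ y ⧺ z) u v →
              R₁.R x u × R₂.R y v × Σ[ w ∈ Tuple Γ ] (Product1 u v w × R₃.R z w)
  lies-elim {x} {y} {z} {u} {v} (x′ , xu , y′ , yv , w , uvw , z′ , zw , eq) =
    let (x≋ , yz≋) = ⧺-injective {a = x} {x′} eq
        (y≋ , z≋) = ⧺-injective {a = y} {y′} yz≋
    in R₁.R-resp (≋-sym x≋) (≋-refl u) xu , R₂.R-resp (≋-sym y≋) (≋-refl v) yv ,
       w , uvw , R₃.R-resp (≋-sym z≋) (≋-refl w) zw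

  -- The factors count the choices of `x`, of `y`, of `w`, which is determined by `u` and `v`, of
  -- `z`, and of the tuple that these form.
  K : ℕ
  K = R₁.k * (R₂.k * (1 * (R₃.k * 1)))

  lies-bound : ∀ u v → Size.AtMost (tuples Θ) K (λ a → Lies a u v)
  lies-bound u v =
    CardBind.atMost-bind em (tuples Γ₁) (tuples Θ)
      (λ { a x≋x′ (y , yv , w , uvw , z , zw , eq) → y , yv , w , uvw , z , zw ,
           ≋-trans eq (pw-++ universe x≋x′ (≋-refl (y ⧺ z))) })
      (R₁.boundˡ u) λ x →
    CardBind.atMost-bind em (tuples Γ₂) (tuples Θ)
      (λ { a y≋y′ (w , uvw , z , zw , eq) → w , uvw , z , zw ,
           ≋-trans eq (pw-++ universe (≋-refl x) (pw-++ universe y≋y′ (≋-refl z))) })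
      (R₂.boundˡ v) λ y →
    CardBind.atMost-bind em (tuples Γ) (tuples Θ)
      (λ { a w≋w′ (z , zw , eq) → z , R₃.R-resp (≋-refl z) w≋w′ zw , eq })
      (product1-unique₃ u v) λ w →
    CardBind.atMost-bind em (tuples Γ₃) (tuples Θ)
      (λ a z≋z′ eq → ≋-trans eq (pw-++ universe (≋-refl x) (pw-++ universe (≋-refl y) z≋z′)))
      (R₃.boundˡ w) λ z → Card.atMost1 em (tuples Θ) (x ⧺ y ⧺ z)

  -- The parameters with which `F` is given need not lie in `C`; genericity supplies an equivalent
  -- definition over `C`.
  F-def : {Ξ : Context} (x : Θ ∈ Ξ) → Def C (λ e → ⟦ F ⟧ (All.lookup e x))
  F-def x = def-⇔ (λ e → mk⇔ (from (spec (All.lookup e x))) (to (spec (All.lookup e x))))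
    (def-⟦⟧ (proj₁ (proj₁ α-generic)) (proj₁ (proj₂ (proj₁ α-generic))) (block x))
    where
    spec : ∀ a → ⟦ F ⟧ a ⇔ ⟦ proj₁ (proj₁ α-generic) ⟧ a
    spec = proj₂ (proj₂ (proj₁ α-generic))

  α∈F : ⟦ F ⟧ α
  α∈F = proj₁ (proj₂ α-generic)

  generic⇒RM≥2 : {P : Tuple Θ → Set ℓ} (D : DefinableOver C P) → P α → RM≥ 2 (proj₁ D)
  generic⇒RM≥2 (D , over , spec) Pα = proj₁ (proj₁ (proj₂ (proj₂ α-generic))) D over (to (spec α) Pα)

  -- Independence of g₁ and g₂ over C.
  module _ (P : Tuple Γ → Tuple Γ → Set ℓ) (P-def : Def C (↓₂ P)) (P-holds : P (proj₁ g₁) (proj₁ g₂)) where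

    private
      lies-resp : ∀ {u u′ v v′} a → u ≋ u′ → v ≋ v′ → Lies a u v → Lies a u′ v′
      lies-resp {u} {u′} {v} {v′} a p q =
        def-resp lies-def {a ∷ u ∷ v ∷ []} {a ∷ u′ ∷ v′ ∷ []} (≋-refl a , p , q , tt)

    -- If `P` allowed at most `k` values `v` for each `u`, the points lying over pairs in `P` would
    -- be finite-to-one over `u`, so they could not have rank 2. But they form a `C`-definable set
    -- that contains `α`.
    ¬bounded₂ : ∀ k → ¬ (∀ u → Size.AtMost (tuples Γ) k (λ v → P u v))
    ¬bounded₂ k bound = finiteToOne⇒¬RM≥2 (proj₁ D) G.domain (minimal G.domain rank-degree) S (def-weaken S-def)
      (λ a a∈D → from (proj₂ (proj₂ D) a) a∈D) (k * K)
      (λ u → CardBind.atMost-bind em (tuples Γ) (tuples Θ) (λ a v≋v′ → lies-resp a (≋-refl u) v≋v′) (bound u) (lies-bound u))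
      (generic⇒RM≥2 D (proj₁ g₁ , proj₂ g₁ , proj₁ g₂ , P-holds , α-lies))
      where
      S : Tuple Θ → Tuple Γ → Set ℓ
      S a u = Σ[ v ∈ Tuple Γ ] (P u v × Lies a u v)
      S-def : Def C (↓₂ S)
      S-def = def-≡ (def-∃ (def-select P-def (there (there (here refl)) ∷ here refl ∷ []) def-∧
                            def-select lies-def (there (here refl) ∷ there (there (here refl)) ∷ here refl ∷ [])))
                λ { (a ∷ u ∷ []) → refl }
      D : DefinableOver C (λ a → Σ[ u ∈ Tuple Γ ] (Dom u × S a u))
      D = def⇒definable (def-≡ (def-∃ (dom-def (here refl) def-∧ def-select S-def (there (here refl) ∷ here refl ∷ [])))
            λ { (a ∷ []) → refl })

    ¬bounded₁ : ∀ k → ¬ (∀ v → Size.AtMost (tuples Γ) k (λ u → P u v))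
    ¬bounded₁ k bound = finiteToOne⇒¬RM≥2 (proj₁ D) G.domain (minimal G.domain rank-degree) S (def-weaken S-def)
      (λ a a∈D → from (proj₂ (proj₂ D) a) a∈D) (k * K)
      (λ v → CardBind.atMost-bind em (tuples Γ) (tuples Θ) (λ a u≋u′ → lies-resp a u≋u′ (≋-refl v)) (bound v) (λ u → lies-bound u v))
      (generic⇒RM≥2 D (proj₁ g₂ , proj₂ g₂ , proj₁ g₁ , P-holds , α-lies))
      where
      S : Tuple Θ → Tuple Γ → Set ℓ
      S a v = Σ[ u ∈ Tuple Γ ] (P u v × Lies a u v)
      S-def : Def C (↓₂ S)
      S-def = def-≡ (def-∃ (def-select P-def (here refl ∷ there (there (here refl)) ∷ []) def-∧
                            def-select lies-def (there (here refl) ∷ here refl ∷ there (there (here refl)) ∷ [])))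
                λ { (a ∷ v ∷ []) → refl }
      D : DefinableOver C (λ a → Σ[ v ∈ Tuple Γ ] (Dom v × S a v))
      D = def⇒definable (def-≡ (def-∃ (dom-def (here refl) def-∧ def-select S-def (there (here refl) ∷ here refl ∷ [])))
            λ { (a ∷ []) → refl })

-- Grids from a group-like set.

module GroupLikeGrids (em : Classical) {ℓ : Level} {L : Language ℓ} (M : Structure L)
    (s₀ : Language.Sort L) {Γ₁ Γ₂ Γ₃ : List (Language.Sort L)} (κ : Set ℓ)
    (X : Definability.Definable M Γ₁) (Y : Definability.Definable M Γ₂) (Z : Definability.Definable M Γ₃)
    (F : Definability.Definable M (Γ₁ ++ Γ₂ ++ Γ₃))
    (F⊆XYZ : Conditions.SubsetOfProduct M X Y Z F)
    (groupLike : Conditions.GroupLike M X Y Z F κ) where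
  open Language L
  open Structure M
  open Definability M
  open Logic M using (⟦⟧-resp)
  open DefinableRelations em M s₀
  open Rank em M s₀
  open Classically em
  open Conditions.GroupLike groupLike
  open GroupDefinability em M s₀ G rank-degree
  open GroupLikeRelations em M s₀ κ X Y Z F groupLike
  open Group group using (setoid; _∙_; _⁻¹; _≈_; ∙-cong; ∙-congˡ; ∙-congʳ; ⁻¹-cong; assoc)
    renaming (refl to ≈-refl; sym to ≈-sym)
  open MinimalGroup em group using (ApproximateSubgroup)

  private
    Γ = G.Γ
    Θ = Γ₁ ++ Γ₂ ++ Γ₃
    Element = G.Element
    module E = Card em setoid

  U : Tuple Γ → Tuple Γ → Set ℓ
  U u v = Σ[ a ∈ Tuple Θ ] (⟦ F ⟧ a × Lies a u v)

  U-def : Def C (↓₂ U)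
  U-def = def-≡ (def-∃ (F-def (here refl) def-∧ def-select lies-def everything)) λ { (u ∷ v ∷ []) → refl }

  U-holds : U (proj₁ g₁) (proj₁ g₂)
  U-holds = α , α∈F , α-lies

  private
    P : ℕ → Tuple Γ → Tuple Γ → Set ℓ
    P k u v = (Dom v × U u v) × CountedBy k (λ v′ → Dom v′ × U u v′)

    P-def : ∀ k → Def C (↓₂ (P k))
    P-def k = def-≡ ((dom-def (there (here refl)) def-∧ def-select U-def (here refl ∷ there (here refl) ∷ [])) def-∧
                     def-countedBy k (dom-def (here refl) def-∧ def-select U-def (there (here refl) ∷ here refl ∷ [])))
                λ { (u ∷ v ∷ []) → refl }

    -- `P k` keeps only fibres with at most `k` elements, so it is bounded. If the fibre over `g₁`
    -- were one of them, `P k` would hold at `g₁` and `g₂`, against `¬bounded₂`.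
    fibre-uncounted : ∀ k → ¬ CountedBy k (λ v → Dom v × U (proj₁ g₁) v)
    fibre-uncounted k counted = ¬bounded₂ (P k) (P-def k) ((proj₂ g₂ , U-holds) , counted) k
      λ u → atMost-countedBy k (λ v → Dom v × U u v)

    fibre-infinite : ¬ E.Finite (λ h → U (proj₁ g₁) (proj₁ h))
    fibre-infinite fin =
      let (k , counted) = finite⇒countedBy (elementFinite⇒tupleFinite {U (proj₁ g₁)} fin) in fibre-uncounted k counted

    fibre-def : Def allParameters (↓₁ (U (proj₁ g₁)))
    fibre-def = def-≡ (def-parameter (def-weaken U-def) (proj₁ g₁) (λ _ → tt)) λ { (v ∷ []) → refl }

  cofibre-count : Σ[ k ∈ ℕ ] CountedBy k (λ v → Dom v × ¬ U (proj₁ g₁) v)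
  cofibre-count = finite⇒countedBy (elementFinite⇒tupleFinite {λ v → ¬ U (proj₁ g₁) v}
    ([ ⊥-elim ∘ fibre-infinite , id ]′ (finite⊎cofinite {U (proj₁ g₁)} fibre-def)))

  translateʳ-finite : {P : Element → Set ℓ} → E.Finite P → ∀ s → E.Finite (λ g → P (g ∙ s))
  translateʳ-finite fin s = E.finite-⊆ (λ g Pgs → g ∙ s , Pgs , ≈-sym {(g ∙ s) ∙ (s ⁻¹)} {g} (//-rightDividesʳ s g))
    (CardBind.finite-image em setoid setoid (_∙ (s ⁻¹)) (λ {x} {y} → ∙-congʳ {s ⁻¹} {x} {y}) fin)
    where open Algebra.Properties.Group group using (//-rightDividesʳ)

  translateˡ-finite : {P : Element → Set ℓ} → E.Finite P → ∀ s → E.Finite (λ g → P (s ∙ g))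
  translateˡ-finite fin s = E.finite-⊆ (λ g Psg → s ∙ g , Psg , ≈-sym {(s ⁻¹) ∙ (s ∙ g)} {g} (\\-leftDividesʳ s g))
    (CardBind.finite-image em setoid setoid ((s ⁻¹) ∙_) (λ {x} {y} → ∙-congˡ {s ⁻¹} {x} {y}) fin)
    where open Algebra.Properties.Group group using (\\-leftDividesʳ)

  module _ (k₀ : ℕ) (counted : CountedBy k₀ (λ v → Dom v × ¬ U (proj₁ g₁) v)) where

    -- Cofiniteness of the fibre over `u` is not, as it stands, a formula in `u`. Fixing a number
    -- `k₀` that serves for `g₁` makes it one, definable over `C` and true at `g₁`.
    Good : Tuple Γ → Set ℓ
    Good u = CountedBy k₀ (λ v → Dom v × ¬ U u v)

    good-def : {Ξ : Context} (x : Γ ∈ Ξ) → Def C (λ e → Good (All.lookup e x))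
    good-def x = def-countedBy k₀
      (dom-def (here refl) def-∧ def-¬ (def-select U-def (there x ∷ here refl ∷ [])))

    -- Otherwise `g₁` would lie in a finite `C`-definable set, which `¬bounded₁` excludes.
    good-infinite : ¬ E.Finite (λ g → Good (proj₁ g))
    good-infinite fin = ¬bounded₁ (λ u v → Dom u × Good u)
      (def-≡ (dom-def (here refl) def-∧ good-def (here refl)) λ { (u ∷ v ∷ []) → refl })
      (proj₂ g₁ , counted) (proj₁ fin′) (λ v → proj₂ fin′)
      where
      fin′ : Size.Finite (tuples Γ) (λ u → Dom u × Good u)
      fin′ = elementFinite⇒tupleFinite {Good} fin

    good-cofinite : E.Finite (λ g → ¬ Good (proj₁ g))
    good-cofinite = [ ⊥-elim ∘ good-infinite , id ]′
      (finite⊎cofinite {Good} (def-≡ (def-weaken (good-def (here refl))) λ { (u ∷ []) → refl }))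

    good⇒fibre-cofinite : (g : Element) → Good (proj₁ g) → E.Finite (λ h → ¬ U (proj₁ g) (proj₁ h))
    good⇒fibre-cofinite g good = tupleFinite⇒elementFinite {λ v → ¬ U (proj₁ g) v} (_ , countedBy⇒atMost _ good)

    -- Cofiniteness is used twice: `g` is chosen so that every `g ∙ e i` is good, and then `h`
    -- avoids the finitely many bad elements that each pair `i`, `j` contributes.
    generalPosition′ : ∀ {n} (e : Fin n → Element) →
      Σ[ g ∈ Element ] Σ[ h ∈ Element ] (∀ i j → U (proj₁ (g ∙ e i)) (proj₁ (e j ∙ h)))
    generalPosition′ e = g , h , λ i j → byContradiction λ ¬U → proj₂ (proj₂ h-choice) (i , j , ¬U)
      where
      g-choice : Σ[ g ∈ Element ] (⊤ × ¬ (Σ[ i ∈ Fin _ ] ¬ Good (proj₁ (g ∙ e i))))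
      g-choice = E.infinite-∖ elements-infinite (finite-fin em setoid λ i → translateʳ-finite good-cofinite (e i))
      g = proj₁ g-choice
      good : ∀ i → Good (proj₁ (g ∙ e i))
      good i = byContradiction λ ¬good → proj₂ (proj₂ g-choice) (i , ¬good)
      h-choice : Σ[ h ∈ Element ] (⊤ × ¬ (Σ[ i ∈ Fin _ ] Σ[ j ∈ Fin _ ] ¬ U (proj₁ (g ∙ e i)) (proj₁ (e j ∙ h))))
      h-choice = E.infinite-∖ elements-infinite (finite-fin em setoid λ i → finite-fin em setoid λ j →
        translateˡ-finite (good⇒fibre-cofinite (g ∙ e i) (good i)) (e j))
      h = proj₁ h-choice

  -- Some left translate gH and right translate Hh of every finite H are in
  -- general position: U contains gH × Hh.
  generalPosition : ∀ {n} (e : Fin n → Element) →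
    Σ[ g ∈ Element ] Σ[ h ∈ Element ] (∀ i j → U (proj₁ (g ∙ e i)) (proj₁ (e j ∙ h)))
  generalPosition = generalPosition′ (proj₁ cofibre-count) (proj₂ cofibre-count)

  -- The summands serve the sizes of `A`, `B` and `C′`, where doubling gives the factor 2, and the
  -- number of pairs of group elements over one point; `suc` keeps `c` nonzero.
  c : ℕ
  c = suc (R₁.k + R₂.k + 2 * R₃.k + R₁.k * (R₂.k * 1))

  module _ {N : ℕ} (H : ApproximateSubgroup N) (g h : Element)
           (inU : ∀ i j → U (proj₁ (g ∙ ApproximateSubgroup.elem H i)) (proj₁ (ApproximateSubgroup.elem H j ∙ h))) where
    open ApproximateSubgroup H

    private
      us vs : Fin n → Element
      us i = g ∙ elem i
      vs j = elem j ∙ h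

      -- The inverse of `us i ∙ vs j` depends on `i` and `j` only through the product `p` of
      -- `elem i` and `elem j`. So the third coordinates lie over at most `2 * n` group elements.
      third : Element → Element
      third p = ((g ∙ p) ∙ h) ⁻¹

      Points = tuples Γ₁ ×ₛ (tuples Γ₂ ×ₛ tuples Γ₃)
      Pairs  = tuples Γ ×ₛ tuples Γ

      A : Tuple Γ₁ → Set ℓ
      A x = ⟦ X ⟧ x × Σ[ i ∈ Fin n ] R₁.R x (proj₁ (us i))

      B : Tuple Γ₂ → Set ℓ
      B y = ⟦ Y ⟧ y × Σ[ j ∈ Fin n ] R₂.R y (proj₁ (vs j))

      Products : Element → Set ℓ
      Products p = Σ[ i ∈ Fin n ] Σ[ j ∈ Fin n ] p ≈ elem i ∙ elem j

      C′ : Tuple Γ₃ → Set ℓ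
      C′ z = ⟦ Z ⟧ z × Σ[ p ∈ Element ] (Products p × R₃.R z (proj₁ (third p)))

      IsPoint : Tuple Γ₁ × Tuple Γ₂ × Tuple Γ₃ → Set ℓ
      IsPoint (x , y , z) = A x × B y × C′ z × ⟦ F ⟧ (x ⧺ y ⧺ z)

      point′ : ∀ i j → U (proj₁ (us i)) (proj₁ (vs j)) → Σ[ (x , y , z) ∈ Tuple Γ₁ × Tuple Γ₂ × Tuple Γ₃ ]
        (IsPoint (x , y , z) × R₁.R x (proj₁ (us i)) × R₂.R y (proj₁ (vs j)))
      point′ i j (a , a∈F , x , xu , y , yv , w , uvw@(u∈ , v∈ , w∈ , _) , z , zw , a≋) =
        (x , y , z) , ((x∈ , i , xu) , (y∈ , j , yv) , (z∈ , elem i ∙ elem j , (i , j , ≈-refl {elem i ∙ elem j}) , zw′) , F∋) , xu , yv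
        where
        F∋ : ⟦ F ⟧ (x ⧺ y ⧺ z)
        F∋ = ⟦⟧-resp F a≋ a∈F
        x∈ : ⟦ X ⟧ x
        x∈ = proj₁ (F⊆XYZ x y z F∋)
        y∈ : ⟦ Y ⟧ y
        y∈ = proj₁ (proj₂ (F⊆XYZ x y z F∋))
        z∈ : ⟦ Z ⟧ z
        z∈ = proj₂ (proj₂ (F⊆XYZ x y z F∋))
        open import Relation.Binary.Reasoning.Setoid setoid
        open Algebra.Properties.Group group using (inverseʳ-unique)
        u′ v′ w′ : Element
        u′ = proj₁ (us i) , u∈
        v′ = proj₁ (vs j) , v∈
        w′ = w , w∈
        w≈ : w′ ≈ third (elem i ∙ elem j)
        w≈ = begin
          w′                                   ≈⟨ inverseʳ-unique (u′ ∙ v′) w′ (product1-elim uvw) ⟩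
          (u′ ∙ v′) ⁻¹
            ≈⟨ ⁻¹-cong {u′ ∙ v′} {us i ∙ vs j} (∙-cong {u′} {us i} {v′} {vs j} (≈-refl {us i}) (≈-refl {vs j})) ⟩
          ((g ∙ elem i) ∙ (elem j ∙ h)) ⁻¹
            ≈⟨ ⁻¹-cong {us i ∙ vs j} {(us i ∙ elem j) ∙ h} (≈-sym {(us i ∙ elem j) ∙ h} {us i ∙ vs j} (assoc (us i) (elem j) h)) ⟩
          (((g ∙ elem i) ∙ elem j) ∙ h) ⁻¹
            ≈⟨ ⁻¹-cong {(us i ∙ elem j) ∙ h} {(g ∙ (elem i ∙ elem j)) ∙ h}
               (∙-congʳ {h} {us i ∙ elem j} {g ∙ (elem i ∙ elem j)} (assoc g (elem i) (elem j))) ⟩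
          third (elem i ∙ elem j)              ∎
        zw′ : R₃.R z (proj₁ (third (elem i ∙ elem j)))
        zw′ = R₃.R-resp (Setoid.refl (tuples Γ₃) {z}) w≈ zw

      point : ∀ i j → Σ[ (x , y , z) ∈ Tuple Γ₁ × Tuple Γ₂ × Tuple Γ₃ ]
        (IsPoint (x , y , z) × R₁.R x (proj₁ (us i)) × R₂.R y (proj₁ (vs j)))
      point i j = point′ i j (inU i j)

      pairs-bound : ∀ x y → Size.AtMost Pairs (R₁.k * (R₂.k * 1)) (λ (u , v) → R₁.R x u × R₂.R y v)
      pairs-bound x y = Card.atMost-⊆ em Pairs (λ (u , v) (xu , yv) → u , xu , v , yv , Setoid.refl Pairs {u , v})
        (CardBind.atMost-bind em (tuples Γ) Pairs
          (λ { q u≋u′ (v , yv , q≈) → v , yv , Setoid.trans Pairs {q} q≈ (u≋u′ , Setoid.refl (tuples Γ) {v}) })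
          (R₁.boundʳ x) λ u → CardBind.atMost-bind em (tuples Γ) Pairs
          (λ q v≋v′ q≈ → Setoid.trans Pairs {q} q≈ (Setoid.refl (tuples Γ) {u} , v≋v′))
          (R₂.boundʳ y) λ v → Card.atMost1 em Pairs (u , v))

      -- Double counting: the `n * n` pairs `(us i , vs j)` are distinct, by cancellation of `g` and
      -- `h`, and a single point corresponds to boundedly many of them.
      covered-pairs : ∀ {m} → Size.AtMost Points m IsPoint → n * n ≤ m * (R₁.k * (R₂.k * 1))
      covered-pairs {m} bound = Card.pigeonhole em Pairs
        (CardBind.atMost-bind em Points Pairs
          (λ { q (x≋ , y≋ , _) (xu , yv) → R₁.R-resp x≋ (Setoid.refl (tuples Γ) {proj₁ q}) xu ,
                                            R₂.R-resp y≋ (Setoid.refl (tuples Γ) {proj₂ q}) yv })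
          bound (λ (x , y , _) → pairs-bound x y))
        pair
        (λ k → let (i , j) = remQuot n k ; (pt , pt∈ , xu , yv) = point i j in pt , pt∈ , xu , yv)
        pair-injective
        where
        open Algebra.Properties.Group group using (∙-cancelˡ; ∙-cancelʳ)
        pair : Fin (n * n) → Tuple Γ × Tuple Γ
        pair k = let (i , j) = remQuot n k in proj₁ (us i) , proj₁ (vs j)
        pair-injective : ∀ k l → Setoid._≈_ Pairs (pair k) (pair l) → k ≡ l
        pair-injective k l (p , q) = ≡.trans (≡.sym (combine-remQuot {n} n k)) (≡.trans
          (cong₂ combine (injective _ _ (∙-cancelˡ g (elem (proj₁ (remQuot n k))) (elem (proj₁ (remQuot {n} n l))) p))
                         (injective _ _ (∙-cancelʳ h (elem (proj₂ (remQuot {n} n k))) (elem (proj₂ (remQuot {n} n l))) q)))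
          (combine-remQuot {n} n l))

      scale : ∀ {k} → k ≤ c → n * k ≤ c * n
      scale {k} k≤c = ℕ.≤-trans (ℕ.≤-reflexive (ℕ.*-comm n k)) (ℕ.*-monoˡ-≤ n k≤c)

      k₁≤ : R₁.k ≤ c
      k₁≤ = ℕ.m≤n⇒m≤1+n (ℕ.≤-trans (ℕ.m≤m+n R₁.k R₂.k) (ℕ.≤-trans (ℕ.m≤m+n _ (2 * R₃.k)) (ℕ.m≤m+n _ (R₁.k * (R₂.k * 1)))))

      k₂≤ : R₂.k ≤ c
      k₂≤ = ℕ.m≤n⇒m≤1+n (ℕ.≤-trans (ℕ.m≤n+m R₂.k R₁.k) (ℕ.≤-trans (ℕ.m≤m+n _ (2 * R₃.k)) (ℕ.m≤m+n _ (R₁.k * (R₂.k * 1)))))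

      2k₃≤ : 2 * R₃.k ≤ c
      2k₃≤ = ℕ.m≤n⇒m≤1+n (ℕ.≤-trans (ℕ.m≤n+m (2 * R₃.k) (R₁.k + R₂.k)) (ℕ.m≤m+n _ (R₁.k * (R₂.k * 1))))

      k₁k₂≤ : R₁.k * (R₂.k * 1) ≤ c
      k₁k₂≤ = ℕ.m≤n⇒m≤1+n (ℕ.m≤n+m _ (R₁.k + R₂.k + 2 * R₃.k))

    grid : Grid M X Y Z F c n
    grid = record
      { A = A ; B = B ; C = C′
      ; A⊆X = λ _ → proj₁ ; B⊆Y = λ _ → proj₁ ; C⊆Z = λ _ → proj₁
      ; ∣A∣ = Card.atMost-≤ em (tuples Γ₁) (scale k₁≤) (Card.atMost-⊆ em (tuples Γ₁) (λ _ → proj₂)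
                (atMost-fin em (tuples Γ₁) λ i → R₁.boundˡ (proj₁ (us i))))
      ; ∣B∣ = Card.atMost-≤ em (tuples Γ₂) (scale k₂≤) (Card.atMost-⊆ em (tuples Γ₂) (λ _ → proj₂)
                (atMost-fin em (tuples Γ₂) λ j → R₂.boundˡ (proj₁ (vs j))))
      ; ∣C∣ = Card.atMost-≤ em (tuples Γ₃) (ℕ.≤-trans (ℕ.≤-reflexive 2nk) (scale 2k₃≤))
                (Card.atMost-⊆ em (tuples Γ₃) (λ _ → proj₂)
                  (CardBind.atMost-bind em setoid (tuples Γ₃)
                    (λ {p} {p′} z p≈p′ → R₃.R-resp (Setoid.refl (tuples Γ₃) {z}) (third-cong p p′ p≈p′))
                    doubling (λ p → R₃.boundˡ (proj₁ (third p)))))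
      ; many = λ m bound → ℕ.≤-trans (covered-pairs bound)
                 (ℕ.≤-trans (ℕ.≤-reflexive (ℕ.*-comm m _)) (ℕ.*-monoˡ-≤ m k₁k₂≤))
      }
      where
      2nk : 2 * n * R₃.k ≡ n * (2 * R₃.k)
      2nk = ≡.trans (cong (_* R₃.k) (ℕ.*-comm 2 n)) (ℕ.*-assoc n 2 R₃.k)
      third-cong : ∀ p p′ → p ≈ p′ → third p ≈ third p′
      third-cong p p′ eq = ⁻¹-cong {(g ∙ p) ∙ h} {(g ∙ p′) ∙ h}
        (∙-congʳ {h} {g ∙ p} {g ∙ p′} (∙-congˡ {g} {p} {p′} eq))

  ¬powerSaving : ¬ Conditions.PowerSaving M X Y Z F
  ¬powerSaving = grids⇒¬powerSaving M X Y Z F c λ N →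
    let H = approximateSubgroup N
        (g , h , inU) = generalPosition (ApproximateSubgroup.elem H)
    in ApproximateSubgroup.n H , ApproximateSubgroup.N≤n H , grid H g h inU

-- Grids from a cylinder.

module CylinderGrids (em : Classical) {ℓ : Level} {L : Language ℓ} (M : Structure L)
    {Γ₁ Γ₂ Γ₃ : List (Language.Sort L)}
    (X : Definability.Definable M Γ₁) (Y : Definability.Definable M Γ₂) (Z : Definability.Definable M Γ₃)
    (F : Definability.Definable M (Γ₁ ++ Γ₂ ++ Γ₃))
    (F⊆XYZ : Conditions.SubsetOfProduct M X Y Z F) where
  open Structure M
  open Definability M
  open Logic M using (≋-sym; ⟦⟧-resp)
  open Conditions M {Γ₁} {Γ₂} {Γ₃}

  private
    Points = tuples Γ₁ ×ₛ (tuples Γ₂ ×ₛ tuples Γ₃)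

  -- A cylinder supplies a sequence for one coordinate and a sequence of pairs for the other two;
  -- `index` tells which coordinates follow `i` and which follow `j`. Single coordinates of the
  -- pairs may repeat, so injectivity is asked of whole points only.
  grid-fromPoints : (n : ℕ) (as : ℕ → Tuple Γ₁) (bs : ℕ → Tuple Γ₂) (cs : ℕ → Tuple Γ₃)
    (index : Fin n → Fin n → Fin n × Fin n × Fin n) →
    let point : Fin n → Fin n → Tuple Γ₁ × Tuple Γ₂ × Tuple Γ₃
        point i j = let (p , q , r) = index i j in as (toℕ p) , bs (toℕ q) , cs (toℕ r) in
    (∀ i → ⟦ X ⟧ (as i)) → (∀ i → ⟦ Y ⟧ (bs i)) → (∀ i → ⟦ Z ⟧ (cs i)) →
    (∀ i j → let (x , y , z) = point i j in ⟦ F ⟧ (x ⧺ y ⧺ z)) →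
    (∀ {i j i′ j′} → Setoid._≈_ Points (point i j) (point i′ j′) → i ≡ i′ × j ≡ j′) →
    Grid M X Y Z F 1 n
  grid-fromPoints n as bs cs index as∈ bs∈ cs∈ point∈F point-injective = record
    { A   = λ x → Σ[ i ∈ Fin n ] x ≋ as (toℕ i)
    ; B   = λ y → Σ[ i ∈ Fin n ] y ≋ bs (toℕ i)
    ; C   = λ z → Σ[ i ∈ Fin n ] z ≋ cs (toℕ i)
    ; A⊆X = λ x (i , x≋) → ⟦⟧-resp X (≋-sym x≋) (as∈ (toℕ i))
    ; B⊆Y = λ y (i , y≋) → ⟦⟧-resp Y (≋-sym y≋) (bs∈ (toℕ i))
    ; C⊆Z = λ z (i , z≋) → ⟦⟧-resp Z (≋-sym z≋) (cs∈ (toℕ i))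
    ; ∣A∣ = few (tuples Γ₁) as
    ; ∣B∣ = few (tuples Γ₂) bs
    ; ∣C∣ = few (tuples Γ₃) cs
    ; many = λ m bound → ℕ.≤-trans
        (Card.pigeonhole em Points bound pair
          (λ k → let (i , j) = remQuot {n} n k
                     (p , q , r) = index i j
                 in (p , Setoid.refl (tuples Γ₁) {as (toℕ p)}) , (q , Setoid.refl (tuples Γ₂) {bs (toℕ q)}) ,
                    (r , Setoid.refl (tuples Γ₃) {cs (toℕ r)}) , point∈F i j)
          (λ k l eq → let (i≡ , j≡) = point-injective eq
             in ≡.trans (≡.sym (combine-remQuot {n} n k)) (≡.trans (cong₂ combine i≡ j≡) (combine-remQuot {n} n l))))
        (ℕ.≤-reflexive (≡.sym (ℕ.*-identityˡ m)))
    }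
    where
    pair : Fin (n * n) → Tuple Γ₁ × Tuple Γ₂ × Tuple Γ₃
    pair k = let (i , j) = remQuot {n} n k
                 (p , q , r) = index i j
             in as (toℕ p) , bs (toℕ q) , cs (toℕ r)
    few : (S : Setoid ℓ ℓ) (f : ℕ → Setoid.Carrier S) → Size.AtMost S (1 * n) (λ x → Σ[ i ∈ Fin n ] Setoid._≈_ S x (f (toℕ i)))
    few S f = Card.atMost-≤ em S (ℕ.≤-reflexive (ℕ.*-comm n 1)) (atMost-fin em S λ i → Card.atMost1 em S (f (toℕ i)))

  cylindrical⇒grid : Cylindrical X Y Z F → ∀ n → Grid M X Y Z F 1 n
  cylindrical⇒grid (inj₁ (I , J , I⊆ , J⊆ , I-infinite , J-infinite , I×J⊆F)) n =
    grid-fromPoints n xs (proj₁ ∘ yzs) (proj₂ ∘ yzs) (λ i j → i , j , j)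
      (λ i → I⊆ _ (I.enumerate-∈ I-infinite i))
      (λ j → proj₁ (J⊆ _ (J.enumerate-∈ J-infinite j))) (λ j → proj₂ (J⊆ _ (J.enumerate-∈ J-infinite j)))
      (λ i j → I×J⊆F _ _ (I.enumerate-∈ I-infinite (toℕ i)) (J.enumerate-∈ J-infinite (toℕ j)))
      (λ { (p , q , r) → toℕ-injective (I.enumerate-injective I-infinite _ _ p) ,
                         toℕ-injective (J.enumerate-injective J-infinite _ _ (q , r)) })
    where
    module I = Card em (tuples Γ₁)
    module J = Card em (tuples Γ₂ ×ₛ tuples Γ₃)
    xs = I.enumerate I-infinite
    yzs = J.enumerate J-infinite
  cylindrical⇒grid (inj₂ (inj₁ (I , J , I⊆ , J⊆ , I-infinite , J-infinite , I×J⊆F))) n =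
    grid-fromPoints n (proj₁ ∘ xzs) ys (proj₂ ∘ xzs) (λ i j → j , i , j)
      (λ j → proj₁ (J⊆ _ (J.enumerate-∈ J-infinite j))) (λ i → I⊆ _ (I.enumerate-∈ I-infinite i))
      (λ j → proj₂ (J⊆ _ (J.enumerate-∈ J-infinite j)))
      (λ i j → I×J⊆F _ _ (I.enumerate-∈ I-infinite (toℕ i)) (J.enumerate-∈ J-infinite (toℕ j)))
      (λ { (p , q , r) → toℕ-injective (I.enumerate-injective I-infinite _ _ q) ,
                         toℕ-injective (J.enumerate-injective J-infinite _ _ (p , r)) })
    where
    module I = Card em (tuples Γ₂)
    module J = Card em (tuples Γ₁ ×ₛ tuples Γ₃)
    ys = I.enumerate I-infinite
    xzs = J.enumerate J-infinite
  cylindrical⇒grid (inj₂ (inj₂ (I , J , I⊆ , J⊆ , I-infinite , J-infinite , I×J⊆F))) n =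
    grid-fromPoints n (proj₁ ∘ xys) (proj₂ ∘ xys) zs (λ i j → j , j , i)
      (λ j → proj₁ (J⊆ _ (J.enumerate-∈ J-infinite j))) (λ j → proj₂ (J⊆ _ (J.enumerate-∈ J-infinite j)))
      (λ i → I⊆ _ (I.enumerate-∈ I-infinite i))
      (λ i j → I×J⊆F _ _ (I.enumerate-∈ I-infinite (toℕ i)) (J.enumerate-∈ J-infinite (toℕ j)))
      (λ { (p , q , r) → toℕ-injective (I.enumerate-injective I-infinite _ _ r) ,
                         toℕ-injective (J.enumerate-injective J-infinite _ _ (p , q)) })
    where
    module I = Card em (tuples Γ₃)
    module J = Card em (tuples Γ₁ ×ₛ tuples Γ₂)
    zs = I.enumerate I-infinite
    xys = J.enumerate J-infinite

  cylindrical⇒¬powerSaving : Cylindrical X Y Z F → ¬ PowerSaving X Y Z F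
  cylindrical⇒¬powerSaving cyl = grids⇒¬powerSaving M X Y Z F 1 λ N → N , ℕ.≤-refl , cylindrical⇒grid cyl N

-- Splitting a group-like set that contains a cylinder.

module GroupLikeCylinders (em : Classical) {ℓ : Level} {L : Language ℓ} (M : Structure L)
    (s₀ : Language.Sort L) {Γ₁ Γ₂ Γ₃ : List (Language.Sort L)} (κ : Set ℓ)
    (X : Definability.Definable M Γ₁) (Y : Definability.Definable M Γ₂) (Z : Definability.Definable M Γ₃)
    (F : Definability.Definable M (Γ₁ ++ Γ₂ ++ Γ₃))
    (groupLike : Conditions.GroupLike M X Y Z F κ) where
  open Language L
  open Structure M
  open Definability M
  open Logic M using (≋-refl; ⧺-injective)
  open DefinableRelations em M s₀
  open Rank em M s₀
  open Conditions.GroupLike groupLike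
  open GroupDefinability em M s₀ G rank-degree
  open GroupLikeRelations em M s₀ κ X Y Z F groupLike

  private
    Γ = G.Γ
    Θ = Γ₁ ++ Γ₂ ++ Γ₃

    product1-resp : ∀ u u′ v v′ w w′ → u ≋ u′ → v ≋ v′ → w ≋ w′ → Product1 u v w → Product1 u′ v′ w′
    product1-resp u u′ v v′ w w′ p q r =
      def-resp (product1-def i0 i1 i2) {u ∷ v ∷ w ∷ []} {u′ ∷ v′ ∷ w′ ∷ []} (p , q , r , tt)

  -- The part of `F` on which the coordinates obey the group relation. It is definable over `C` and
  -- contains `α`, whence its rank.
  generic : DefinableOver C (λ a → ⟦ F ⟧ a × Σ[ u ∈ Tuple Γ ] Σ[ v ∈ Tuple Γ ] Lies a u v)
  generic = def⇒definable (def-≡ (F-def i0 def-∧ def-∃ (def-∃ (def-select lies-def (i2 ∷ i1 ∷ i0 ∷ []))))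
    λ { (a ∷ []) → refl })

  D : Definable Θ
  D = proj₁ generic

  D⊑F : D ⊑ F
  D⊑F a a∈D = proj₁ (from (proj₂ (proj₂ generic) a) a∈D)

  D-rank : RM≥ 2 D
  D-rank = generic⇒RM≥2 generic (α∈F , proj₁ g₁ , proj₁ g₂ , α-lies)

  D-elim : ∀ x y z → ⟦ D ⟧ (x ⧺ y ⧺ z) → Σ[ u ∈ Tuple Γ ] Σ[ v ∈ Tuple Γ ] Σ[ w ∈ Tuple Γ ]
             (R₁.R x u × R₂.R y v × R₃.R z w × Product1 u v w)
  D-elim x y z xyz∈D =
    let (_ , u , v , lies) = from (proj₂ (proj₂ generic) (x ⧺ y ⧺ z)) xyz∈D
        (xu , yv , w , uvw , zw) = lies-elim {x} {y} {z} lies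
    in u , v , w , xu , yv , zw , uvw

  -- Given `y` and `z`, the correspondences leave finitely many `v` and `w`, the group law
  -- determines `u`, and `u` leaves finitely many `x`.
  D-finite₁ : ∀ y z → Size.Finite (tuples Γ₁) (λ x → ⟦ D ⟧ (x ⧺ y ⧺ z))
  D-finite₁ y z = Card.finite-⊆ em (tuples Γ₁)
    (λ x h → let (u , v , w , xu , yv , zw , uvw) = D-elim x y z h in v , yv , w , zw , u , uvw , xu)
    (CardBind.finite-bind₃ em (tuples Γ) (tuples Γ₁)
      {P = λ v → R₂.R y v} {Q = λ w → R₃.R z w} {W = λ v w u → Product1 u v w} {R = λ u x → R₁.R x u}
      (λ {v} {v′} {w} {w′} u p q → product1-resp u u v v′ w w′ (≋-refl u) p q) (λ x → R₁.R-resp (≋-refl x))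
      (R₂.k , R₂.boundʳ y) (R₃.k , R₃.boundʳ z) (λ v w → 1 , product1-unique₁ v w) (λ u → R₁.k , R₁.boundˡ u))

  D-finite₂ : ∀ x z → Size.Finite (tuples Γ₂) (λ y → ⟦ D ⟧ (x ⧺ y ⧺ z))
  D-finite₂ x z = Card.finite-⊆ em (tuples Γ₂)
    (λ y h → let (u , v , w , xu , yv , zw , uvw) = D-elim x y z h in u , xu , w , zw , v , uvw , yv)
    (CardBind.finite-bind₃ em (tuples Γ) (tuples Γ₂)
      {P = λ u → R₁.R x u} {Q = λ w → R₃.R z w} {W = λ u w v → Product1 u v w} {R = λ v y → R₂.R y v}
      (λ {u} {u′} {w} {w′} v p q → product1-resp u u′ v v w w′ p (≋-refl v) q) (λ y → R₂.R-resp (≋-refl y))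
      (R₁.k , R₁.boundʳ x) (R₃.k , R₃.boundʳ z) (λ u w → 1 , product1-unique₂ u w) (λ v → R₂.k , R₂.boundˡ v))

  D-finite₃ : ∀ x y → Size.Finite (tuples Γ₃) (λ z → ⟦ D ⟧ (x ⧺ y ⧺ z))
  D-finite₃ x y = Card.finite-⊆ em (tuples Γ₃)
    (λ z h → let (u , v , w , xu , yv , zw , uvw) = D-elim x y z h in u , xu , v , yv , w , uvw , zw)
    (CardBind.finite-bind₃ em (tuples Γ) (tuples Γ₃)
      {P = λ u → R₁.R x u} {Q = λ v → R₂.R y v} {W = Product1} {R = λ w z → R₃.R z w}
      (λ {u} {u′} {v} {v′} w p q → product1-resp u u′ v v′ w w p q (≋-refl w)) (λ z → R₃.R-resp (≋-refl z))
      (R₁.k , R₁.boundʳ x) (R₂.k , R₂.boundʳ y) (λ u v → 1 , product1-unique₃ u v) (λ w → R₃.k , R₃.boundˡ w))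

  private
    ≋-concat-elim : ∀ {x x′ : Tuple Γ₁} {y y′ : Tuple Γ₂} {z z′ : Tuple Γ₃} →
                    x ⧺ y ⧺ z ≋ x′ ⧺ y′ ⧺ z′ → (x ≋ x′) × (y ≋ y′) × (z ≋ z′)
    ≋-concat-elim {x} {x′} {y} {y′} h = let (p , q) = ⧺-injective {a = x} {x′} h in p , ⧺-injective {a = y} {y′} q

    ≋-join : {a b c : Tuple Θ} → a ≋ b → a ≋ c → b ≋ c
    ≋-join {a} {b} p q = Setoid.trans (tuples Θ) {b} (Setoid.sym (tuples Θ) {a} p) q

  -- Slices over different pairs are disjoint because concatenation is injective. Intersected with
  -- `F` minus `D`, they are the infinite pieces that give this set rank 2.
  slice₁ : (y : Tuple Γ₂) (z : Tuple Γ₃) → DefinableOver allParameters (λ a → Σ[ x ∈ Tuple Γ₁ ] a ≋ x ⧺ y ⧺ z)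
  slice₁ y z = def⇒definable (def-≡
    (def-parameter (def-parameter {Ξ = Γ₃ ∷ Θ ∷ []} (def-∃ (def-≋ (block i3) (block i0 ⧺ᵗ block i1 ⧺ᵗ block i2))) y (λ _ → tt)) z (λ _ → tt))
    λ { (a ∷ []) → refl })

  slice₂ : (x : Tuple Γ₁) (z : Tuple Γ₃) → DefinableOver allParameters (λ a → Σ[ y ∈ Tuple Γ₂ ] a ≋ x ⧺ y ⧺ z)
  slice₂ x z = def⇒definable (def-≡
    (def-parameter (def-parameter {Ξ = Γ₃ ∷ Θ ∷ []} (def-∃ (def-≋ (block i3) (block i1 ⧺ᵗ block i0 ⧺ᵗ block i2))) x (λ _ → tt)) z (λ _ → tt))
    λ { (a ∷ []) → refl })

  slice₃ : (x : Tuple Γ₁) (y : Tuple Γ₂) → DefinableOver allParameters (λ a → Σ[ z ∈ Tuple Γ₃ ] a ≋ x ⧺ y ⧺ z)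
  slice₃ x y = def⇒definable (def-≡
    (def-parameter (def-parameter {Ξ = Γ₂ ∷ Θ ∷ []} (def-∃ (def-≋ (block i3) (block i1 ⧺ᵗ block i2 ⧺ᵗ block i0))) x (λ _ → tt)) y (λ _ → tt))
    λ { (a ∷ []) → refl })

  cylindrical⇒splitsF : Conditions.Cylindrical M X Y Z F → Splits F 2 2
  cylindrical⇒splitsF (inj₁ (I , J , _ , _ , I-infinite , J-infinite , I×J⊆F)) =
    cylinder⇒splits F D D⊑F D-rank (tuples Γ₁) (tuples Γ₂ ×ₛ tuples Γ₃) I-infinite J-infinite
      (λ x (y , z) → x ⧺ y ⧺ z) (λ x yz → I×J⊆F x yz)
      (λ {x} {x′} {yz} eq → proj₁ (≋-concat-elim {x} {x′} {proj₁ yz} {proj₁ yz} {proj₂ yz} {proj₂ yz} eq))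
      (λ (y , z) → proj₁ (slice₁ y z))
      (λ x (y , z) → to (proj₂ (proj₂ (slice₁ y z)) _) (x , ≋-refl (x ⧺ y ⧺ z)))
      (λ {(y , z)} {(y′ , z′)} a h k →
        let (x , p) = from (proj₂ (proj₂ (slice₁ y z)) a) h
            (x′ , q) = from (proj₂ (proj₂ (slice₁ y′ z′)) a) k
        in proj₂ (≋-concat-elim {x} {x′} {y} {y′} {z} {z′} (≋-join {a} p q)))
      (λ (y , z) → D-finite₁ y z)
  cylindrical⇒splitsF (inj₂ (inj₁ (I , J , _ , _ , I-infinite , J-infinite , I×J⊆F))) =
    cylinder⇒splits F D D⊑F D-rank (tuples Γ₂) (tuples Γ₁ ×ₛ tuples Γ₃) I-infinite J-infinite
      (λ y (x , z) → x ⧺ y ⧺ z) (λ y xz → I×J⊆F y xz)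
      (λ {y} {y′} {xz} eq → proj₁ (proj₂ (≋-concat-elim {proj₁ xz} {proj₁ xz} {y} {y′} {proj₂ xz} {proj₂ xz} eq)))
      (λ (x , z) → proj₁ (slice₂ x z))
      (λ y (x , z) → to (proj₂ (proj₂ (slice₂ x z)) _) (y , ≋-refl (x ⧺ y ⧺ z)))
      (λ {(x , z)} {(x′ , z′)} a h k →
        let (y , p) = from (proj₂ (proj₂ (slice₂ x z)) a) h
            (y′ , q) = from (proj₂ (proj₂ (slice₂ x′ z′)) a) k
            (x≋ , _ , z≋) = ≋-concat-elim {x} {x′} {y} {y′} {z} {z′} (≋-join {a} p q)
        in x≋ , z≋)
      (λ (x , z) → D-finite₂ x z)
  cylindrical⇒splitsF (inj₂ (inj₂ (I , J , _ , _ , I-infinite , J-infinite , I×J⊆F))) =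
    cylinder⇒splits F D D⊑F D-rank (tuples Γ₃) (tuples Γ₁ ×ₛ tuples Γ₂) I-infinite J-infinite
      (λ z (x , y) → x ⧺ y ⧺ z) (λ z xy → I×J⊆F z xy)
      (λ {z} {z′} {xy} eq → proj₂ (proj₂ (≋-concat-elim {proj₁ xy} {proj₁ xy} {proj₂ xy} {proj₂ xy} {z} {z′} eq)))
      (λ (x , y) → proj₁ (slice₃ x y))
      (λ z (x , y) → to (proj₂ (proj₂ (slice₃ x y)) _) (z , ≋-refl (x ⧺ y ⧺ z)))
      (λ {(x , y)} {(x′ , y′)} a h k →
        let (z , p) = from (proj₂ (proj₂ (slice₃ x y)) a) h
            (z′ , q) = from (proj₂ (proj₂ (slice₃ x′ y′)) a) k
            (x≋ , y≋ , _) = ≋-concat-elim {x} {x′} {y} {y′} {z} {z′} (≋-join {a} p q)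
        in x≋ , y≋)
      (λ (x , y) → D-finite₃ x y)

-- Formulas need a sort to quantify over; there is one because the empty
-- sequence of sorts has a single tuple.
someSort : {ℓ : Level} {L : Language ℓ} (M : Structure L) → let open Definability M in
           {Γ : List (Language.Sort L)} (D : Definable Γ) → RM≥ 1 D → Language.Sort L
someSort M {s ∷ Γ} D _ = s
someSort M {[]}    D (E , (_ , disjoint) , nonempty) with nonempty 0 | nonempty 1
... | [] , h | [] , k = ⊥-elim (disjoint 0 1 (λ ()) [] h k)

proposition1p7 :
    Classical →
    {ℓ : Level} (L : Language ℓ) (M : Structure L)
    (κ : Set ℓ) → InfiniteCardinal κ → Saturation.Saturated M κ →
    (Γ₁ Γ₂ Γ₃ : List (Language.Sort L)) →
    let open Definability M
        open Conditions M {Γ₁} {Γ₂} {Γ₃} in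
    (X : Definable Γ₁) (Y : Definable Γ₂) (Z : Definable Γ₃) →
    StronglyMinimal M X → StronglyMinimal M Y → StronglyMinimal M Z →
    (F : Definable (Γ₁ ++ Γ₂ ++ Γ₃)) → SubsetOfProduct X Y Z F →
    HasRM F 2 → HasRMDegree F 2 1 →
    (¬ (PowerSaving X Y Z F × GroupLike X Y Z F κ))
      × (¬ (PowerSaving X Y Z F × Cylindrical X Y Z F))
      × (¬ (GroupLike X Y Z F κ × Cylindrical X Y Z F))
proposition1p7 em L M κ _ _ Γ₁ Γ₂ Γ₃ X Y Z _ _ _ F F⊆XYZ _ (_ , _ , ¬splits) =
  (λ (saving , groupLike) →
    GroupLikeGrids.¬powerSaving em M (sortOf groupLike) κ X Y Z F F⊆XYZ groupLike saving) ,
  (λ (saving , cylindrical) →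
    CylinderGrids.cylindrical⇒¬powerSaving em M X Y Z F F⊆XYZ cylindrical saving) ,
  (λ (groupLike , cylindrical) →
    ¬splits (GroupLikeCylinders.cylindrical⇒splitsF em M (sortOf groupLike) κ X Y Z F groupLike cylindrical))
  where
  open Definability M
  sortOf : Conditions.GroupLike M X Y Z F κ → Language.Sort L
  sortOf groupLike = someSort M (DefinableGroup.domain (Conditions.GroupLike.G groupLike))
    (proj₁ (proj₁ (Conditions.GroupLike.rank-degree groupLike)))
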